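{- There exists a (randomized) streaming algorithm that, given $n$ coins arriving one by one in a stream in arbitrary order, with gap parameter $\Delta>0$ and confidence parameter $\delta\in(0,1)$, finds the most biased coin with probability at least $1-\delta$ using $O\!\left(\frac{n}{\Delta^2}\cdot\log(1/\delta)\right)$ coin tosses and a memory of a single coin.
   Context: Streaming coin tossing. There are $n$ coins $\mathrm{coin}_1,\dots,\mathrm{coin}_n$ with unknown biases $p_1,\dots,p_n\in[0,1]$; each toss of $\mathrm{coin}_i$ is an independent Bernoulli$(p_i)$ random variable. The gap parameter $\Delta$ is the difference between the largest bias and the second largest bias; it is assumed that $\Delta>0$ (so the most biased coin is unique) and that $\Delta$ and $\delta$ are known to the algorithm. The coins arrive one by one in a stream. At any time the algorithm may toss only the currently arriving coin or a coin explicitly stored in its memory; a coin that is not stored, or that is removed from memory, can no longer be tossed or recovered. The memory (space complexity) of the algorithm is the maximum number of coins it stores at any point during the stream (the coin currently arriving is not counted unless it is stored; auxiliary information such as counters is not counted). "Finds the most biased coin" means that at the end of the stream the algorithm outputs a coin, and this coin is the one with the largest bias. $O(\cdot)$ hides an absolute constant independent of $n,\Delta,\delta$ and the biases. -}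

module Defs where

open import Algebra.Bundles using (AbelianGroup)
import Algebra.Properties.AbelianGroup as AbelianGroupProperties
import Algebra.Properties.CommutativeSemigroup as CommutativeSemigroupProperties
import Algebra.Properties.Ring as RingProperties
open import Data.Bool using (Bool; true; false)
open import Data.Fin using (Fin)
import Data.Fin.Properties as Fin
open import Data.Integer using (+_)
open import Data.List using (List; []; _∷_; map; concatMap; filter; foldr; allFin; upTo)
open import Data.Maybe using (Maybe; just)
import Data.Maybe as Maybe
import Data.Maybe.Properties as Maybe
open import Data.Nat using (ℕ; zero; suc; _!)
import Data.Nat as ℕ
import Data.Nat.Properties as ℕ
open import Data.Product using (Σ-syntax; _×_; _,_; proj₁; proj₂; map₁)
open import Data.Rational using (ℚ; 0ℚ; 1ℚ; ½)
import Data.Rational as ℚ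
import Data.Rational.Properties as ℚ
open import Data.Unit using (⊤; tt)
open import Data.Vec using (Vec; []; _∷_; lookup; removeAt)
open import Function using (_∘_)
open import Relation.Binary using (DecidableEquality)
open import Relation.Binary.PropositionalEquality
  using (_≡_; _≢_; refl; sym; trans; cong; cong₂; subst)
open import Relation.Unary using (Decidable)

-- A real number is a Cauchy sequence of rationals, taken up to _≃_.

infix 4 _CloseTo_within_
_CloseTo_within_ : ℚ → ℚ → ℚ → Set
p CloseTo q within ε = ℚ.∣ p ℚ.- q ∣ ℚ.≤ ε

IsCauchy : (ℕ → ℚ) → Set
IsCauchy u = ∀ ε → 0ℚ ℚ.< ε →
  Σ[ N ∈ ℕ ] ∀ m n → N ℕ.≤ m → N ℕ.≤ n → u m CloseTo u n within ε

record ℝ : Set where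
  constructor mkℝ
  field
    seq    : ℕ → ℚ
    cauchy : IsCauchy seq

open ℝ public

infix 4 _≃_ _≤_ _<_

_≃_ : ℝ → ℝ → Set
x ≃ y = ∀ ε → 0ℚ ℚ.< ε →
  Σ[ N ∈ ℕ ] ∀ n → N ℕ.≤ n → seq x n CloseTo seq y n within ε

_≤_ : ℝ → ℝ → Set
x ≤ y = ∀ ε → 0ℚ ℚ.< ε →
  Σ[ N ∈ ℕ ] ∀ n → N ℕ.≤ n → seq x n ℚ.≤ seq y n ℚ.+ ε

_<_ : ℝ → ℝ → Set
x < y = Σ[ ε ∈ ℚ ] (0ℚ ℚ.< ε ×
  Σ[ N ∈ ℕ ] ∀ n → N ℕ.≤ n → seq x n ℚ.+ ε ℚ.≤ seq y n)

private
  module ≤ℚ = ℚ.≤-Reasoning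
  open AbelianGroupProperties ℚ.+-0-abelianGroup using (xyx⁻¹≈y)
  open RingProperties ℚ.+-*-ring using (x[y-z]≈xy-xz; [y-z]x≈yx-zx)
  open CommutativeSemigroupProperties
    (AbelianGroup.commutativeSemigroup ℚ.+-0-abelianGroup) using (interchange)

  -‿swap : ∀ p q → (ℚ.- p) ℚ.- (ℚ.- q) ≡ ℚ.- (p ℚ.- q)
  -‿swap p q = sym (ℚ.neg-distrib-+ p (ℚ.- q))

  +-swap : ∀ p q r s → (p ℚ.+ q) ℚ.- (r ℚ.+ s) ≡ (p ℚ.- r) ℚ.+ (q ℚ.- s)
  +-swap p q r s = trans (cong (p ℚ.+ q ℚ.+_) (ℚ.neg-distrib-+ r s))
                         (interchange p q (ℚ.- r) (ℚ.- s))

  q+[p-q]≡p : ∀ p q → q ℚ.+ (p ℚ.- q) ≡ p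
  q+[p-q]≡p p q = trans (sym (ℚ.+-assoc q p (ℚ.- q))) (xyx⁻¹≈y q p)

  telescope : ∀ p q r → (p ℚ.- q) ℚ.+ (q ℚ.- r) ≡ p ℚ.- r
  telescope p q r = trans (sym (ℚ.+-assoc (p ℚ.- q) q (ℚ.- r)))
    (cong (ℚ._- r) (trans (ℚ.+-comm (p ℚ.- q) q) (q+[p-q]≡p p q)))

  *-swap : ∀ p q r s →
    (p ℚ.* q) ℚ.- (r ℚ.* s) ≡ p ℚ.* (q ℚ.- s) ℚ.+ (p ℚ.- r) ℚ.* s
  *-swap p q r s = sym (trans
    (cong₂ ℚ._+_ (x[y-z]≈xy-xz p q s) ([y-z]x≈yx-zx s p r))
    (telescope (p ℚ.* q) (p ℚ.* s) (r ℚ.* s)))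

  ½+½ : ∀ ε → ε ℚ.* ½ ℚ.+ ε ℚ.* ½ ≡ ε
  ½+½ ε = trans (sym (ℚ.*-distribˡ-+ ε ½ ½)) (ℚ.*-identityʳ ε)

  *-pos : ∀ {p q} → 0ℚ ℚ.< p → 0ℚ ℚ.< q → 0ℚ ℚ.< p ℚ.* q
  *-pos {p} {q} 0<p 0<q = ℚ.positive⁻¹ (p ℚ.* q)
    {{ℚ.pos*pos⇒pos p {{ℚ.positive 0<p}} q {{ℚ.positive 0<q}}}}

  0<½ : 0ℚ ℚ.< ½
  0<½ = ℚ.positive⁻¹ ½

  0<1 : 0ℚ ℚ.< 1ℚ
  0<1 = ℚ.positive⁻¹ 1ℚ

  *-mono : ∀ {p q r s} → 0ℚ ℚ.≤ q → 0ℚ ℚ.≤ r →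
           p ℚ.≤ r → q ℚ.≤ s → p ℚ.* q ℚ.≤ r ℚ.* s
  *-mono {p} {q} {r} {s} 0≤q 0≤r p≤r q≤s = ℚ.≤-trans
    (ℚ.*-monoʳ-≤-nonNeg q {{ℚ.nonNegative 0≤q}} p≤r)
    (ℚ.*-monoˡ-≤-nonNeg r {{ℚ.nonNegative 0≤r}} q≤s)

  const-cauchy : ∀ q → IsCauchy (λ _ → q)
  const-cauchy q ε 0<ε = 0 , λ _ _ _ _ →
    subst (λ d → ℚ.∣ d ∣ ℚ.≤ ε) (sym (ℚ.+-inverseʳ q)) (ℚ.<⇒≤ 0<ε)

  neg-cauchy : ∀ u → IsCauchy u → IsCauchy (λ n → ℚ.- u n)
  neg-cauchy u cu ε 0<ε with cu ε 0<ε
  ... | N , h = N , λ m n N≤m N≤n →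
    subst (ℚ._≤ ε)
      (sym (trans (cong ℚ.∣_∣ (-‿swap (u m) (u n))) (ℚ.∣-p∣≡∣p∣ (u m ℚ.- u n))))
      (h m n N≤m N≤n)

  +-cauchy : ∀ u v → IsCauchy u → IsCauchy v → IsCauchy (λ n → u n ℚ.+ v n)
  +-cauchy u v cu cv ε 0<ε
    with cu (ε ℚ.* ½) (*-pos 0<ε 0<½) | cv (ε ℚ.* ½) (*-pos 0<ε 0<½)
  ... | N , h | M , g = N ℕ.⊔ M , λ m n le le′ → ≤ℚ.begin
    ℚ.∣ (u m ℚ.+ v m) ℚ.- (u n ℚ.+ v n) ∣
      ≤ℚ.≡⟨ cong ℚ.∣_∣ (+-swap (u m) (v m) (u n) (v n)) ⟩
    ℚ.∣ (u m ℚ.- u n) ℚ.+ (v m ℚ.- v n) ∣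
      ≤ℚ.≤⟨ ℚ.∣p+q∣≤∣p∣+∣q∣ (u m ℚ.- u n) (v m ℚ.- v n) ⟩
    ℚ.∣ u m ℚ.- u n ∣ ℚ.+ ℚ.∣ v m ℚ.- v n ∣
      ≤ℚ.≤⟨ ℚ.+-mono-≤
              (h m n (ℕ.m⊔n≤o⇒m≤o N M le) (ℕ.m⊔n≤o⇒m≤o N M le′))
              (g m n (ℕ.m⊔n≤o⇒n≤o N M le) (ℕ.m⊔n≤o⇒n≤o N M le′)) ⟩
    ε ℚ.* ½ ℚ.+ ε ℚ.* ½
      ≤ℚ.≡⟨ ½+½ ε ⟩
    ε ≤ℚ.∎

  bounded : ∀ u → IsCauchy u →
    Σ[ b ∈ ℚ ] (0ℚ ℚ.< b × Σ[ N ∈ ℕ ] ∀ n → N ℕ.≤ n → ℚ.∣ u n ∣ ℚ.≤ b)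
  bounded u cu with cu 1ℚ 0<1
  ... | N , h =
    ℚ.∣ u N ∣ ℚ.+ 1ℚ , ℚ.+-mono-≤-< (ℚ.0≤∣p∣ (u N)) 0<1 , N , λ n N≤n → ≤ℚ.begin
      ℚ.∣ u n ∣                       ≤ℚ.≡⟨ cong ℚ.∣_∣ (sym (q+[p-q]≡p (u n) (u N))) ⟩
      ℚ.∣ u N ℚ.+ (u n ℚ.- u N) ∣     ≤ℚ.≤⟨ ℚ.∣p+q∣≤∣p∣+∣q∣ (u N) (u n ℚ.- u N) ⟩
      ℚ.∣ u N ∣ ℚ.+ ℚ.∣ u n ℚ.- u N ∣ ≤ℚ.≤⟨ ℚ.+-monoʳ-≤ ℚ.∣ u N ∣ (h n N N≤n ℕ.≤-refl) ⟩
      ℚ.∣ u N ∣ ℚ.+ 1ℚ                ≤ℚ.∎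

  *-cauchy : ∀ u v → IsCauchy u → IsCauchy v → IsCauchy (λ n → u n ℚ.* v n)
  *-cauchy u v cu cv ε 0<ε with bounded u cu | bounded v cv
  ... | b , 0<b , B , hb | c , 0<c , D , hc = N , close
    where
    s = b ℚ.+ c
    instance
      s-pos : ℚ.Positive s
      s-pos = ℚ.positive (ℚ.+-mono-< 0<b 0<c)
      s-nz : ℚ.NonZero s
      s-nz = ℚ.pos⇒nonZero s
    η = (ℚ.1/ s) ℚ.* ε
    0<η : 0ℚ ℚ.< η
    0<η = *-pos (ℚ.positive⁻¹ (ℚ.1/ s) {{ℚ.1/pos⇒pos s}}) 0<ε
    K = proj₁ (cu η 0<η)
    L = proj₁ (cv η 0<η)
    N = (B ℕ.⊔ D) ℕ.⊔ (K ℕ.⊔ L)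
    sη≡ε : b ℚ.* η ℚ.+ η ℚ.* c ≡ ε
    sη≡ε = trans (cong (b ℚ.* η ℚ.+_) (ℚ.*-comm η c))
          (trans (sym (ℚ.*-distribʳ-+ η b c))
          (trans (sym (ℚ.*-assoc s (ℚ.1/ s) ε))
          (trans (cong (ℚ._* ε) (ℚ.*-inverseʳ s)) (ℚ.*-identityˡ ε))))
    close : ∀ m n → N ℕ.≤ m → N ℕ.≤ n → (u m ℚ.* v m) CloseTo (u n ℚ.* v n) within ε
    close m n N≤m N≤n = ≤ℚ.begin
      ℚ.∣ (u m ℚ.* v m) ℚ.- (u n ℚ.* v n) ∣
        ≤ℚ.≡⟨ cong ℚ.∣_∣ (*-swap (u m) (v m) (u n) (v n)) ⟩
      ℚ.∣ u m ℚ.* (v m ℚ.- v n) ℚ.+ (u m ℚ.- u n) ℚ.* v n ∣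
        ≤ℚ.≤⟨ ℚ.∣p+q∣≤∣p∣+∣q∣ (u m ℚ.* (v m ℚ.- v n)) ((u m ℚ.- u n) ℚ.* v n) ⟩
      ℚ.∣ u m ℚ.* (v m ℚ.- v n) ∣ ℚ.+ ℚ.∣ (u m ℚ.- u n) ℚ.* v n ∣
        ≤ℚ.≡⟨ cong₂ ℚ._+_ (ℚ.∣p*q∣≡∣p∣*∣q∣ (u m) (v m ℚ.- v n))
                          (ℚ.∣p*q∣≡∣p∣*∣q∣ (u m ℚ.- u n) (v n)) ⟩
      ℚ.∣ u m ∣ ℚ.* ℚ.∣ v m ℚ.- v n ∣ ℚ.+ ℚ.∣ u m ℚ.- u n ∣ ℚ.* ℚ.∣ v n ∣
        ≤ℚ.≤⟨ ℚ.+-mono-≤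
                (*-mono (ℚ.0≤∣p∣ (v m ℚ.- v n)) (ℚ.<⇒≤ 0<b)
                  (hb m (ℕ.m⊔n≤o⇒m≤o B D (lo N≤m)))
                  (proj₂ (cv η 0<η) m n (ℕ.m⊔n≤o⇒n≤o K L (hi N≤m)) (ℕ.m⊔n≤o⇒n≤o K L (hi N≤n))))
                (*-mono (ℚ.0≤∣p∣ (v n)) (ℚ.<⇒≤ 0<η)
                  (proj₂ (cu η 0<η) m n (ℕ.m⊔n≤o⇒m≤o K L (hi N≤m)) (ℕ.m⊔n≤o⇒m≤o K L (hi N≤n)))
                  (hc n (ℕ.m⊔n≤o⇒n≤o B D (lo N≤n)))) ⟩
      b ℚ.* η ℚ.+ η ℚ.* c
        ≤ℚ.≡⟨ sη≡ε ⟩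
      ε ≤ℚ.∎
      where
      lo : ∀ {o} → N ℕ.≤ o → B ℕ.⊔ D ℕ.≤ o
      lo = ℕ.m⊔n≤o⇒m≤o (B ℕ.⊔ D) (K ℕ.⊔ L)
      hi : ∀ {o} → N ℕ.≤ o → K ℕ.⊔ L ℕ.≤ o
      hi = ℕ.m⊔n≤o⇒n≤o (B ℕ.⊔ D) (K ℕ.⊔ L)

infix  8 -_
infixl 7 _*_
infixl 6 _+_ _-_

fromℚ : ℚ → ℝ
fromℚ q = mkℝ (λ _ → q) (const-cauchy q)

fromℕ : ℕ → ℝ
fromℕ n = fromℚ (+ n ℚ./ 1)

0ℝ 1ℝ : ℝ
0ℝ = fromℚ 0ℚ
1ℝ = fromℚ 1ℚ

-_ : ℝ → ℝ
- x = mkℝ (λ n → ℚ.- seq x n) (neg-cauchy (seq x) (cauchy x))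

_+_ _*_ _-_ : ℝ → ℝ → ℝ
x + y = mkℝ (λ n → seq x n ℚ.+ seq y n) (+-cauchy (seq x) (seq y) (cauchy x) (cauchy y))
x * y = mkℝ (λ n → seq x n ℚ.* seq y n) (*-cauchy (seq x) (seq y) (cauchy x) (cauchy y))
x - y = x + (- y)

infixr 8 _^_
_^_ : ℝ → ℕ → ℝ
x ^ zero  = 1ℝ
x ^ suc k = x * x ^ k

sum : List ℝ → ℝ
sum = foldr _+_ 0ℝ

_HasSum_ : (ℕ → ℝ) → ℝ → Set
f HasSum s = ∀ ε → 0ℚ ℚ.< ε → Σ[ N ∈ ℕ ] ∀ n → N ℕ.≤ n →
  (sum (map f (upTo n)) ≤ s + fromℚ ε) × (s ≤ sum (map f (upTo n)) + fromℚ ε)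

1/_! : ℕ → ℝ
1/ k ! = fromℚ ((+ 1 ℚ./ (k !)) {{k ℕ.!≢0}})

_IsExpOf_ : ℝ → ℝ → Set
y IsExpOf x = (λ k → x ^ k * 1/ k !) HasSum y

-- ℓ is the natural logarithm of y.
_IsLogOf_ : ℝ → ℝ → Set
ℓ IsLogOf y = y IsExpOf ℓ

-- Finitely supported: weighted outcomes, possibly with repetitions.
Dist : Set → Set
Dist A = List (ℝ × A)

pure : ∀ {A} → A → Dist A
pure a = (1ℝ , a) ∷ []

infixl 1 _>>=_
_>>=_ : ∀ {A B} → Dist A → (A → Dist B) → Dist B
d >>= f = concatMap (λ (w , a) → map (map₁ (w *_)) (f a)) d

bernoulli : ℝ → Dist Bool
bernoulli p = (p , true) ∷ (1ℝ - p , false) ∷ []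

uniform : ∀ j → Dist (Fin (suc j))
uniform j = map (λ i → fromℚ (+ 1 ℚ./ suc j) , i) (allFin (suc j))

Pr : ∀ {A} {P : A → Set} → Dist A → Decidable P → ℝ
Pr d P? = sum (map proj₁ (filter (P? ∘ proj₂) d))

data Phase : Set where
  arrival ended : Phase

-- What an algorithm with room for m coins may do while k coins are stored,
-- either while a coin is arriving or after the stream has ended.  Coins are
-- referred to only by their position among the stored ones; a result may
-- depend on how many coins are stored when it is returned.
data Program (m : ℕ) (R : ℕ → Set) : Phase → ℕ → Set where
  return       : ∀ {φ k} → R k → Program m R φ k
  random       : ∀ {φ k} j → (Fin (suc j) → Program m R φ k) → Program m R φ k
  tossArriving : ∀ {k} → (Bool → Program m R arrival k) → Program m R arrival k
  tossStored   : ∀ {φ k} → Fin k → (Bool → Program m R φ k) → Program m R φ k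
  store        : ∀ {k} → k ℕ.< m → Program m R arrival (suc k) → Program m R arrival k
  discard      : ∀ {φ k} → Fin (suc k) → Program m R φ k → Program m R φ (suc k)

-- State is the auxiliary information kept between arrivals.  The algorithm
-- does not know the length of the stream.  Its output is one of the stored
-- coins, or nothing.
record StreamingAlgorithm (m : ℕ) : Set₁ where
  field
    State  : Set
    start  : State
    step   : State → ∀ k → Program m (λ _ → State) arrival k
    finish : State → ∀ k → Program m (λ k → Maybe (Fin k)) ended k

record Outcome (n : ℕ) (R : ℕ → Set) : Set where
  constructor outcome
  field
    {stored} : ℕ
    tosses   : ℕ
    memory   : Vec (Fin n) stored
    result   : R stored

open Outcome public

Arriving : Phase → ℕ → Set
Arriving arrival n = Fin n
Arriving ended   n = ⊤

module _ {n : ℕ} (p : Fin n → ℝ) where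

  run : ∀ {m R φ k} → Arriving φ n → ℕ → Vec (Fin n) k →
        Program m R φ k → Dist (Outcome n R)
  run c t M (return r)       = pure (outcome t M r)
  run c t M (random j f)     = uniform j >>= λ i → run c t M (f i)
  run c t M (tossArriving f) = bernoulli (p c) >>= λ b → run c (suc t) M (f b)
  run c t M (tossStored i f) =
    bernoulli (p (lookup M i)) >>= λ b → run c (suc t) M (f b)
  run c t M (store _ P)      = run c t (c ∷ M) P
  run c t M (discard i P)    = run c t (removeAt M i) P

  module _ {m : ℕ} (A : StreamingAlgorithm m) where
    open StreamingAlgorithm A

    arrivals : List (Fin n) → Outcome n (λ _ → State) → Dist (Outcome n (λ _ → State))
    arrivals []       o = pure o
    arrivals (c ∷ cs) o =
      run c (tosses o) (memory o) (step (result o) (stored o)) >>= arrivals cs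

    -- Coin i is the i-th to arrive and has bias p i.
    execute : Dist (Outcome n (λ k → Maybe (Fin k)))
    execute = arrivals (allFin n) (outcome 0 [] start) >>= λ o →
      run tt (tosses o) (memory o) (finish (result o) (stored o))

output : ∀ {n} → Outcome n (λ k → Maybe (Fin k)) → Maybe (Fin n)
output o = Maybe.map (lookup (memory o)) (result o)

_≟_ : ∀ {n} → DecidableEquality (Maybe (Fin n))
_≟_ = Maybe.≡-dec Fin._≟_

record HasGap {n : ℕ} (p : Fin n → ℝ) (best : Fin n) (Δ : ℝ) : Set where
  field
    best-largest   : ∀ i → p i ≤ p best
    second         : Fin n
    second≢best    : second ≢ best
    second-largest : ∀ i → i ≢ best → p i ≤ p second
    gap            : p best - p second ≃ Δ

module Submission where

open import Defs
open import Algebra.Bundles using (CommutativeRing)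
import Algebra.Solver.Ring as RingSolver
open import Algebra.Solver.Ring.AlmostCommutativeRing
  using (AlmostCommutativeRing; fromCommutativeRing; _-Raw-AlmostCommutative⟶_)
open import Data.Bool using (Bool; true; false; if_then_else_)
open import Data.Fin using (Fin; zero; toℕ; fromℕ<)
import Data.Fin.Properties as Fin
open import Data.Integer using (+_; +<+)
import Data.Integer as ℤ
import Data.Integer.Properties as ℤ
open import Data.List using (List; []; _∷_; _++_; map; filter; length; allFin; applyUpTo)
open import Data.List.Membership.Propositional using (_∈_)
open import Data.List.Membership.Propositional.Properties using (∈-allFin)
import Data.List.Properties as List
open import Data.List.Relation.Unary.All using (All; []; _∷_)
import Data.List.Relation.Unary.All as All
import Data.List.Relation.Unary.All.Properties as All
open import Data.List.Relation.Unary.AllPairs using (_∷_)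
open import Data.List.Relation.Unary.Any using (here; there)
open import Data.List.Relation.Unary.Unique.Propositional using (Unique)
open import Data.List.Relation.Unary.Unique.Propositional.Properties using (allFin⁺)
open import Data.Maybe using (Maybe; just; nothing)
open import Data.Nat using (ℕ; zero; suc; _!)
import Data.Nat as ℕ
import Data.Nat.DivMod as ℕ
import Data.Nat.Properties as ℕ
open import Data.Nat.Solver renaming (module +-*-Solver to ℕ-Solver)
open import Data.Product using (Σ-syntax; _×_; _,_; proj₁; proj₂; map₁)
open import Data.Rational using (ℚ; 0ℚ; 1ℚ; ½)
import Data.Rational as ℚ
import Data.Rational.Properties as ℚ
open import Data.Rational.Solver renaming (module +-*-Solver to ℚ-Solver)
import Data.Rational.Unnormalised as ℚᵘ
import Data.Rational.Unnormalised.Properties as ℚᵘ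
open import Data.Sum using (_⊎_; inj₁; inj₂)
open import Data.Unit using (⊤; tt)
open import Data.Vec using (Vec; []; _∷_; lookup)
open import Function using (_∘_; id)
open import Relation.Binary.Bundles using (Preorder)
open import Relation.Binary.PropositionalEquality
  using (_≡_; _≢_; refl; sym; trans; cong; cong₂; subst; subst₂)
import Relation.Binary.Reasoning.Preorder as PreorderReasoning
open import Relation.Nullary using (¬_; Dec; yes; no; does; contradiction)
open import Relation.Nullary.Decidable using (dec-true; dec-false; decidable-stable)
open import Relation.Unary using (Decidable)
open ℚ-Solver using (solve; con; _:=_; _:+_; _:*_; _:-_; :-_)
open ℕ-Solver using () renaming (solve to semiring; con to ♯; _:=_ to _≗_; _:+_ to _∔_; _:*_ to _⨰_)
module ℕ-Reasoning = ℕ.≤-Reasoning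

-- A challenge is a random walk of the distance by which the challenger still has to be beaten;
-- every round of one toss each also consumes one unit of the king's budget.  If the best coin
-- challenges, z^distance with z < 1 is a supermartingale, so it loses with probability at most
-- z^h, whatever the budget.  If the best coin is king, x^distance y^budget with x > 1 > y is a
-- supermartingale throughout the stream, because the budget b granted for every challenge pays
-- for resetting the distance to h; so it is ever dethroned with probability at most y^S₀.
-- Every arrival adds a bounded budget, which bounds the tosses in the worst case.
--
-- For δ near 1 the toss bound allows less than one toss per coin.  The algorithm then considers
-- only one coin in B ≈ 1/ℓ, at a random offset; this still succeeds with probability 1/(2B) ≥ 1 − δ.

-- Carrying the king's budget over between challenges is what avoids a factor log n. With a separate
-- budget per challenge the best coin would risk dethronement anew up to n times, and a union bound
-- would push each risk below δ/n. Here all challenges share one supermartingale, and its initial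
-- budget pays for the whole stream.
--
-- Both roles of the best coin rest on the same drift inequality, `contraction`, because z = 1/x.
-- With t = 1/u of order Δ its slack is of second order, y = 1 - t²/2. Hence each factor ½ in the
-- error costs a distance of order 1/Δ but a budget of order 1/Δ², the source of the 1/Δ² in the
-- toss bound.
--
-- The considered coins occupy one residue class of positions modulo B, so exactly one of the B
-- offsets meets the best coin; the other offsets are bounded below by zero.
--
-- The logarithm is known only through the exponential series, the sign of ℓ is not given, and the
-- order on reals is undecidable. Everything about ℓ, even its positivity, is therefore derived from
-- e^(-m/(u+1)) ≥ (1 - 1/(u+1))^m, and case distinctions use overlapping ranges.

-- Inequalities between rationals

≤-by : ∀ {p q} r → 0ℚ ℚ.≤ r → p ℚ.+ r ≡ q → p ℚ.≤ q
≤-by {p} r 0≤r eq = subst₂ ℚ._≤_ (ℚ.+-identityʳ p) eq (ℚ.+-monoʳ-≤ p 0≤r)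

0≤-difference : ∀ {p q} → p ℚ.≤ q → 0ℚ ℚ.≤ q ℚ.- p
0≤-difference {p} {q} p≤q =
  subst (ℚ._≤ q ℚ.- p) (ℚ.+-inverseʳ p) (ℚ.+-monoˡ-≤ (ℚ.- p) p≤q)

0≤-+ : ∀ {p q} → 0ℚ ℚ.≤ p → 0ℚ ℚ.≤ q → 0ℚ ℚ.≤ p ℚ.+ q
0≤-+ = ℚ.+-mono-≤

0≤-* : ∀ {p q} → 0ℚ ℚ.≤ p → 0ℚ ℚ.≤ q → 0ℚ ℚ.≤ p ℚ.* q
0≤-* {p} {q} 0≤p 0≤q = ℚ.nonNegative⁻¹ (p ℚ.* q)
  {{ℚ.nonNeg*nonNeg⇒nonNeg p {{ℚ.nonNegative 0≤p}} q {{ℚ.nonNegative 0≤q}}}}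

0<-* : ∀ {p q} → 0ℚ ℚ.< p → 0ℚ ℚ.< q → 0ℚ ℚ.< p ℚ.* q
0<-* {p} {q} 0<p 0<q = ℚ.positive⁻¹ (p ℚ.* q)
  {{ℚ.pos*pos⇒pos p {{ℚ.positive 0<p}} q {{ℚ.positive 0<q}}}}

p≤∣p∣ : ∀ p → p ℚ.≤ ℚ.∣ p ∣
p≤∣p∣ p with ℚ.≤-total 0ℚ p
... | inj₁ 0≤p = ℚ.≤-reflexive (sym (ℚ.0≤p⇒∣p∣≡p 0≤p))
... | inj₂ p≤0 = ℚ.≤-trans p≤0 (ℚ.0≤∣p∣ p)

close⇒≤ : ∀ p q {ε} → p CloseTo q within ε → p ℚ.≤ q ℚ.+ ε
close⇒≤ p q {ε} h = ≤-by (ε ℚ.- (p ℚ.- q))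
  (0≤-difference (ℚ.≤-trans (p≤∣p∣ (p ℚ.- q)) h))
  (solve 3 (λ p q ε → p :+ (ε :- (p :- q)) := q :+ ε) refl p q ε)

close-sym : ∀ p q {ε} → p CloseTo q within ε → q CloseTo p within ε
close-sym p q {ε} = subst (ℚ._≤ ε) (trans (sym (ℚ.∣-p∣≡∣p∣ (p ℚ.- q)))
  (cong ℚ.∣_∣ (solve 2 (λ p q → :- (p :- q) := q :- p) refl p q)))

0<½ : 0ℚ ℚ.< ½
0<½ = ℚ.positive⁻¹ ½

0≤1 : 0ℚ ℚ.≤ 1ℚ
0≤1 = ℚ.nonNegative⁻¹ 1ℚ

half+half : ∀ ε → ε ℚ.* ½ ℚ.+ ε ℚ.* ½ ≡ ε
half+half = solve 1 (λ ε → ε :* con ½ :+ ε :* con ½ := ε) refl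

-- The reals as an ordered commutative ring

-- The ring operations are sealed: the Cauchy proofs inside their values would otherwise be
-- compared by the type checker.  The relations are records so that their arguments can be inferred.

infix  8 ⊝_
infixl 7 _⊗_
infixl 6 _⊕_ _⊖_
infix  4 _≐_ _≼_

-- Termwise equality is finer than `≃`. The ring laws of ℚ hold in every term, so this finer
-- relation already yields a commutative ring and lets the ring solver run on `ℝ`.
record _≐_ (x y : ℝ) : Set where
  constructor pointwise
  field at : ∀ n → seq x n ≡ seq y n

record _≼_ (x y : ℝ) : Set where
  constructor ⟨_⟩
  field bound : x ≤ y

open _≐_
open _≼_

opaque
  ι : ℚ → ℝ
  ι = fromℚ

  _⊕_ _⊗_ : ℝ → ℝ → ℝ
  _⊕_ = _+_
  _⊗_ = _*_

  ⊝_ : ℝ → ℝ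
  ⊝_ = -_

_⊖_ : ℝ → ℝ → ℝ
x ⊖ y = x ⊕ ⊝ y

0# 1# : ℝ
0# = ι 0ℚ
1# = ι 1ℚ

≐-refl : ∀ {x} → x ≐ x
≐-refl = pointwise λ _ → refl

≐-sym : ∀ {x y} → x ≐ y → y ≐ x
≐-sym e = pointwise λ n → sym (at e n)

≐-trans : ∀ {x y z} → x ≐ y → y ≐ z → x ≐ z
≐-trans e f = pointwise λ n → trans (at e n) (at f n)

≼-reflexive : ∀ {x y} → x ≐ y → x ≼ y
≼-reflexive {x} {y} e = ⟨ (λ ε 0<ε → 0 , λ n _ →
  ≤-by {seq x n} {seq y n ℚ.+ ε} ε (ℚ.<⇒≤ 0<ε) (cong (ℚ._+ ε) (at e n))) ⟩

≼-refl : ∀ {x} → x ≼ x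
≼-refl = ≼-reflexive ≐-refl

≼-trans : ∀ {x y z} → x ≼ y → y ≼ z → x ≼ z
≼-trans {x} {y} {z} ⟨ f ⟩ ⟨ g ⟩ = ⟨ (λ ε 0<ε →
  let 0<ε/2 = 0<-* 0<ε 0<½
      N , hN = f (ε ℚ.* ½) 0<ε/2
      M , hM = g (ε ℚ.* ½) 0<ε/2
  in N ℕ.⊔ M , λ n le → ℚ.≤-trans (hN n (ℕ.m⊔n≤o⇒m≤o N M le))
       (ℚ.≤-trans (ℚ.+-monoˡ-≤ _ (hM n (ℕ.m⊔n≤o⇒n≤o N M le)))
         (ℚ.≤-reflexive (trans (ℚ.+-assoc (seq z n) _ _)
           (cong (seq z n ℚ.+_) (half+half ε)))))) ⟩

ℝ-preorder : Preorder _ _ _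
ℝ-preorder = record
  { Carrier = ℝ ; _≈_ = _≐_ ; _≲_ = _≼_
  ; isPreorder = record
    { isEquivalence = record { refl = ≐-refl ; sym = ≐-sym ; trans = ≐-trans }
    ; reflexive = ≼-reflexive ; trans = ≼-trans } }

open PreorderReasoning ℝ-preorder

≃⇒≽ : ∀ {x y} → x ≃ y → y ≼ x
≃⇒≽ {x} {y} e = ⟨ (λ ε 0<ε → let N , h = e ε 0<ε in N , λ n le →
  close⇒≤ (seq y n) (seq x n) (close-sym (seq x n) (seq y n) (h n le))) ⟩

eventually-bounded : ∀ x → Σ[ b ∈ ℚ ] (0ℚ ℚ.< b × Σ[ N ∈ ℕ ] ∀ n → N ℕ.≤ n → seq x n ℚ.≤ b)
eventually-bounded x =
  let N , h = cauchy x 1ℚ (ℚ.positive⁻¹ 1ℚ)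
  in ℚ.∣ seq x N ∣ ℚ.+ 1ℚ
   , ℚ.+-mono-≤-< (ℚ.0≤∣p∣ (seq x N)) (ℚ.positive⁻¹ 1ℚ)
   , N , λ n N≤n → ℚ.≤-trans (close⇒≤ (seq x n) (seq x N) (h n N N≤n ℕ.≤-refl)) (ℚ.+-monoˡ-≤ 1ℚ (p≤∣p∣ (seq x N)))

positive-quotient : ∀ ε s → 0ℚ ℚ.< ε → 0ℚ ℚ.< s →
  Σ[ η ∈ ℚ ] (0ℚ ℚ.< η × η ℚ.* s ≡ ε)
positive-quotient ε s 0<ε 0<s = ε ℚ.* (ℚ.1/ s)
  , 0<-* 0<ε (ℚ.positive⁻¹ (ℚ.1/ s) {{ℚ.1/pos⇒pos s}})
  , trans (ℚ.*-assoc ε (ℚ.1/ s) s)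
      (trans (cong (ε ℚ.*_) (ℚ.*-inverseˡ s)) (ℚ.*-identityʳ ε))
  where
  instance
    s-pos : ℚ.Positive s
    s-pos = ℚ.positive 0<s
    s-nz : ℚ.NonZero s
    s-nz = ℚ.pos⇒nonZero s

-- With η (1 + ε + b + c) = ε, a bound -η on both factors gives a bound -ε on the product,
-- since pq = (p + η)(q + η) − η (p + q + η).
product-lower-bound : ∀ {p q η b c ε} → 0ℚ ℚ.≤ η → 0ℚ ℚ.≤ b → 0ℚ ℚ.≤ c → 0ℚ ℚ.≤ ε →
  η ℚ.* ((1ℚ ℚ.+ ε) ℚ.+ (b ℚ.+ c)) ≡ ε →
  0ℚ ℚ.≤ p ℚ.+ η → 0ℚ ℚ.≤ q ℚ.+ η → p ℚ.≤ b → q ℚ.≤ c → 0ℚ ℚ.≤ p ℚ.* q ℚ.+ ε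
product-lower-bound {p} {q} {η} {b} {c} {ε} 0≤η 0≤b 0≤c 0≤ε ηs≡ε 0≤p+η 0≤q+η p≤b q≤c =
  subst (0ℚ ℚ.≤_)
    (trans (solve 6 (λ p q η b c ε →
       ((p :+ η) :* (q :+ η)) :+ (η :* (((b :- p) :+ (c :- q)) :+ ((con 1ℚ :+ ε) :- η)))
       := p :* q :+ η :* ((con 1ℚ :+ ε) :+ (b :+ c))) refl p q η b c ε)
      (cong (p ℚ.* q ℚ.+_) ηs≡ε))
    (0≤-+ (0≤-* 0≤p+η 0≤q+η) (0≤-* 0≤η
      (0≤-+ (0≤-+ (0≤-difference p≤b) (0≤-difference q≤c)) (0≤-difference η≤1+ε))))
  where
  η≤1+ε : η ℚ.≤ 1ℚ ℚ.+ ε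
  η≤1+ε = ≤-by (1ℚ ℚ.+ η ℚ.* (ε ℚ.+ (b ℚ.+ c)))
    (0≤-+ 0≤1 (0≤-* 0≤η (0≤-+ 0≤ε (0≤-+ 0≤b 0≤c))))
    (trans (solve 4 (λ η b c ε → η :+ (con 1ℚ :+ η :* (ε :+ (b :+ c)))
       := con 1ℚ :+ η :* ((con 1ℚ :+ ε) :+ (b :+ c))) refl η b c ε)
      (cong (1ℚ ℚ.+_) ηs≡ε))

opaque
  unfolding ι

  ι≐ : ∀ q → fromℚ q ≐ ι q
  ι≐ q = ≐-refl {fromℚ q}

  ⊕≐ : ∀ x y → x + y ≐ x ⊕ y
  ⊕≐ x y = ≐-refl {x + y}

  ⊗≐ : ∀ x y → x * y ≐ x ⊗ y
  ⊗≐ x y = ≐-refl {x * y}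

  ⊝≐ : ∀ x → - x ≐ ⊝ x
  ⊝≐ x = ≐-refl { - x}

  ι-+ : ∀ p q → ι (p ℚ.+ q) ≐ ι p ⊕ ι q
  ι-+ p q = pointwise λ _ → refl

  ι-* : ∀ p q → ι (p ℚ.* q) ≐ ι p ⊗ ι q
  ι-* p q = pointwise λ _ → refl

  ι-neg : ∀ p → ι (ℚ.- p) ≐ ⊝ ι p
  ι-neg p = pointwise λ _ → refl

  ⊕-cong : ∀ {x y u v} → x ≐ y → u ≐ v → x ⊕ u ≐ y ⊕ v
  ⊕-cong e f = pointwise λ n → cong₂ ℚ._+_ (at e n) (at f n)

  ⊗-cong : ∀ {x y u v} → x ≐ y → u ≐ v → x ⊗ u ≐ y ⊗ v
  ⊗-cong e f = pointwise λ n → cong₂ ℚ._*_ (at e n) (at f n)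

  ⊝-cong : ∀ {x y} → x ≐ y → ⊝ x ≐ ⊝ y
  ⊝-cong e = pointwise λ n → cong ℚ.-_ (at e n)

  ⊕-assoc : ∀ x y z → (x ⊕ y) ⊕ z ≐ x ⊕ (y ⊕ z)
  ⊕-assoc x y z = pointwise λ n → ℚ.+-assoc (seq x n) (seq y n) (seq z n)

  ⊕-comm : ∀ x y → x ⊕ y ≐ y ⊕ x
  ⊕-comm x y = pointwise λ n → ℚ.+-comm (seq x n) (seq y n)

  ⊕-identityˡ : ∀ x → 0# ⊕ x ≐ x
  ⊕-identityˡ x = pointwise λ n → ℚ.+-identityˡ (seq x n)

  ⊝-inverseˡ : ∀ x → ⊝ x ⊕ x ≐ 0#
  ⊝-inverseˡ x = pointwise λ n → ℚ.+-inverseˡ (seq x n)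

  ⊗-assoc : ∀ x y z → (x ⊗ y) ⊗ z ≐ x ⊗ (y ⊗ z)
  ⊗-assoc x y z = pointwise λ n → ℚ.*-assoc (seq x n) (seq y n) (seq z n)

  ⊗-comm : ∀ x y → x ⊗ y ≐ y ⊗ x
  ⊗-comm x y = pointwise λ n → ℚ.*-comm (seq x n) (seq y n)

  ⊗-identityˡ : ∀ x → 1# ⊗ x ≐ x
  ⊗-identityˡ x = pointwise λ n → ℚ.*-identityˡ (seq x n)

  ⊗-distribˡ-⊕ : ∀ x y z → x ⊗ (y ⊕ z) ≐ (x ⊗ y) ⊕ (x ⊗ z)
  ⊗-distribˡ-⊕ x y z = pointwise λ n → ℚ.*-distribˡ-+ (seq x n) (seq y n) (seq z n)

  ι-mono : ∀ {p q} → p ℚ.≤ q → ι p ≼ ι q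
  ι-mono {p} {q} p≤q = ⟨ (λ ε 0<ε → 0 , λ _ _ →
    ≤-by ((q ℚ.- p) ℚ.+ ε) (0≤-+ (0≤-difference p≤q) (ℚ.<⇒≤ 0<ε))
      (solve 3 (λ p q ε → p :+ ((q :- p) :+ ε) := q :+ ε) refl p q ε)) ⟩

  ⊕-mono : ∀ {x y u v} → x ≼ y → u ≼ v → x ⊕ u ≼ y ⊕ v
  ⊕-mono {x} {y} {u} {v} ⟨ f ⟩ ⟨ g ⟩ = ⟨ (λ ε 0<ε →
    let 0<ε/2 = 0<-* 0<ε 0<½
        N , hN = f (ε ℚ.* ½) 0<ε/2
        M , hM = g (ε ℚ.* ½) 0<ε/2
    in N ℕ.⊔ M , λ n le → ℚ.≤-trans
         (ℚ.+-mono-≤ (hN n (ℕ.m⊔n≤o⇒m≤o N M le)) (hM n (ℕ.m⊔n≤o⇒n≤o N M le)))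
         (ℚ.≤-reflexive (solve 3 (λ p q ε → (p :+ ε :* con ½) :+ (q :+ ε :* con ½)
           := (p :+ q) :+ ε) refl (seq y n) (seq v n) ε))) ⟩

  0≼-⊗ : ∀ {x y} → 0# ≼ x → 0# ≼ y → 0# ≼ x ⊗ y
  0≼-⊗ {x} {y} ⟨ f ⟩ ⟨ g ⟩ = ⟨ (λ ε 0<ε →
    let b , 0<b , B , hb = eventually-bounded x
        c , 0<c , C , hc = eventually-bounded y
        s   = (1ℚ ℚ.+ ε) ℚ.+ (b ℚ.+ c)
        0<s = ℚ.+-mono-< (ℚ.+-mono-< (ℚ.positive⁻¹ 1ℚ) 0<ε) (ℚ.+-mono-< 0<b 0<c)
        η , 0<η , ηs≡ε = positive-quotient ε s 0<ε 0<s
        M , hM = f η 0<η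
        N , hN = g η 0<η
    in (B ℕ.⊔ C) ℕ.⊔ (M ℕ.⊔ N) , λ n le →
      let lo = ℕ.m⊔n≤o⇒m≤o (B ℕ.⊔ C) (M ℕ.⊔ N) le
          hi = ℕ.m⊔n≤o⇒n≤o (B ℕ.⊔ C) (M ℕ.⊔ N) le
      in product-lower-bound (ℚ.<⇒≤ 0<η) (ℚ.<⇒≤ 0<b) (ℚ.<⇒≤ 0<c) (ℚ.<⇒≤ 0<ε) ηs≡ε
           (hM n (ℕ.m⊔n≤o⇒m≤o M N hi)) (hN n (ℕ.m⊔n≤o⇒n≤o M N hi))
           (hb n (ℕ.m⊔n≤o⇒m≤o B C lo)) (hc n (ℕ.m⊔n≤o⇒n≤o B C lo))) ⟩

  -- Half of the tolerance goes to the hypothesis and half to its own eventual bound. This is how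
  -- estimates with an arbitrary rational error are closed.
  ≼-limit : ∀ {x y} → (∀ ε → 0ℚ ℚ.< ε → x ≼ y ⊕ ι ε) → x ≼ y
  ≼-limit {x} {y} h = ⟨ (λ ε 0<ε →
    let 0<ε/2 = 0<-* 0<ε 0<½
        N , hN = bound (h (ε ℚ.* ½) 0<ε/2) (ε ℚ.* ½) 0<ε/2
    in N , λ n le → ℚ.≤-trans (hN n le) (ℚ.≤-reflexive
         (trans (ℚ.+-assoc (seq y n) _ _) (cong (seq y n ℚ.+_) (half+half ε))))) ⟩

ℝ-commutativeRing : CommutativeRing _ _
ℝ-commutativeRing = record
  { Carrier = ℝ ; _≈_ = _≐_ ; _+_ = _⊕_ ; _*_ = _⊗_ ; -_ = ⊝_ ; 0# = 0# ; 1# = 1#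
  ; isCommutativeRing = record
    { isRing = record
      { +-isAbelianGroup = record
        { isGroup = record
          { isMonoid = record
            { isSemigroup = record
              { isMagma = record
                { isEquivalence = record { refl = ≐-refl ; sym = ≐-sym ; trans = ≐-trans }
                ; ∙-cong = ⊕-cong }
              ; assoc = ⊕-assoc }
            ; identity = ⊕-identityˡ , λ x → ≐-trans (⊕-comm x 0#) (⊕-identityˡ x) }
          ; inverse = ⊝-inverseˡ , λ x → ≐-trans (⊕-comm x (⊝ x)) (⊝-inverseˡ x)
          ; ⁻¹-cong = ⊝-cong }
        ; comm = ⊕-comm }
      ; *-cong = ⊗-cong
      ; *-assoc = ⊗-assoc
      ; *-identity = ⊗-identityˡ , λ x → ≐-trans (⊗-comm x 1#) (⊗-identityˡ x)
      ; distrib = ⊗-distribˡ-⊕ , λ x y z → ≐-trans (⊗-comm (y ⊕ z) x)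
          (≐-trans (⊗-distribˡ-⊕ x y z) (⊕-cong (⊗-comm x y) (⊗-comm x z))) }
    ; *-comm = ⊗-comm } }

ℝ-almostCommutativeRing : AlmostCommutativeRing _ _
ℝ-almostCommutativeRing = fromCommutativeRing ℝ-commutativeRing

ι-morphism : CommutativeRing.rawRing ℚ.+-*-commutativeRing
               -Raw-AlmostCommutative⟶ ℝ-almostCommutativeRing
ι-morphism = record
  { ⟦_⟧ = ι ; +-homo = ι-+ ; *-homo = ι-* ; -‿homo = ι-neg ; 0-homo = ≐-refl ; 1-homo = ≐-refl }

ι-≟ : ∀ p q → Maybe (ι p ≐ ι q)
ι-≟ p q with p ℚ.≟ q
... | yes refl = just ≐-refl
... | no  _    = nothing

module ℝ-Solver =
  RingSolver (CommutativeRing.rawRing ℚ.+-*-commutativeRing) ℝ-almostCommutativeRing ι-morphism ι-≟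

open ℝ-Solver using () renaming
  (solve to ring; con to κ; _:=_ to _∶=_; _:+_ to _∶+_; _:*_ to _∶*_; _:-_ to _∶-_; :-_ to ∶-_)

≼-by : ∀ {x y} z → 0# ≼ z → x ⊕ z ≐ y → x ≼ y
≼-by {x} {y} z 0≼z e = begin
  x      ≈⟨ ring 1 (λ x → x ∶= x ∶+ κ 0ℚ) ≐-refl x ⟩
  x ⊕ 0# ≲⟨ ⊕-mono ≼-refl 0≼z ⟩
  x ⊕ z  ≈⟨ e ⟩
  y      ∎

0≼-⊖ : ∀ {x y} → x ≼ y → 0# ≼ y ⊖ x
0≼-⊖ {x} {y} x≼y = begin
  0#    ≈⟨ ring 1 (λ x → κ 0ℚ ∶= x ∶- x) ≐-refl x ⟩
  x ⊖ x ≲⟨ ⊕-mono x≼y ≼-refl ⟩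
  y ⊖ x ∎

0≼-⊕ : ∀ {x y} → 0# ≼ x → 0# ≼ y → 0# ≼ x ⊕ y
0≼-⊕ {x} {y} 0≼x 0≼y = begin
  0#      ≈⟨ ring 0 (κ 0ℚ ∶= κ 0ℚ ∶+ κ 0ℚ) ≐-refl ⟩
  0# ⊕ 0# ≲⟨ ⊕-mono 0≼x 0≼y ⟩
  x ⊕ y   ∎

⊗-monoˡ : ∀ {x y z} → 0# ≼ x → y ≼ z → x ⊗ y ≼ x ⊗ z
⊗-monoˡ {x} {y} {z} 0≼x y≼z = ≼-by (x ⊗ (z ⊖ y)) (0≼-⊗ 0≼x (0≼-⊖ y≼z))
  (ring 3 (λ x y z → x ∶* y ∶+ x ∶* (z ∶- y) ∶= x ∶* z) ≐-refl x y z)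

-- Natural numbers, their reciprocals, and powers

/-+ : ∀ m n → (+ m ℚ./ 1) ℚ.+ (+ n ℚ./ 1) ≡ + (m ℕ.+ n) ℚ./ 1
/-+ m n = ℚ.toℚᵘ-injective (ℚᵘ.≃-trans (ℚ.toℚᵘ-homo-+ (+ m ℚ./ 1) (+ n ℚ./ 1))
  (ℚᵘ.≃-trans (ℚᵘ.+-cong (ℚ.toℚᵘ-fromℚᵘ (ℚᵘ.mkℚᵘ (+ m) 0)) (ℚ.toℚᵘ-fromℚᵘ (ℚᵘ.mkℚᵘ (+ n) 0)))
  (ℚᵘ.≃-trans (ℚᵘ.*≡* (cong (ℤ._* + 1) (cong₂ ℤ._+_ (ℤ.*-identityʳ (+ m)) (ℤ.*-identityʳ (+ n)))))
  (ℚᵘ.≃-sym (ℚ.toℚᵘ-fromℚᵘ (ℚᵘ.mkℚᵘ (+ (m ℕ.+ n)) 0))))))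

/-* : ∀ a b c d .{{_ : ℕ.NonZero b}} .{{_ : ℕ.NonZero d}} .{{_ : ℕ.NonZero (b ℕ.* d)}} →
      (+ a ℚ./ b) ℚ.* (+ c ℚ./ d) ≡ + (a ℕ.* c) ℚ./ (b ℕ.* d)
/-* a (suc b) c (suc d) = ℚ.toℚᵘ-injective (ℚᵘ.≃-trans (ℚ.toℚᵘ-homo-* (+ a ℚ./ suc b) (+ c ℚ./ suc d))
  (ℚᵘ.≃-trans (ℚᵘ.*-cong (ℚ.toℚᵘ-fromℚᵘ (ℚᵘ.mkℚᵘ (+ a) b)) (ℚ.toℚᵘ-fromℚᵘ (ℚᵘ.mkℚᵘ (+ c) d)))
  (ℚᵘ.≃-trans (ℚᵘ.*≡* (cong (ℤ._* + (suc b ℕ.* suc d)) (sym (ℤ.pos-* a c))))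
  (ℚᵘ.≃-sym (ℚ.toℚᵘ-fromℚᵘ (ℚᵘ.mkℚᵘ (+ (a ℕ.* c)) (d ℕ.+ b ℕ.* suc d)))))))

n/n≡1 : ∀ n .{{_ : ℕ.NonZero n}} → + n ℚ./ n ≡ 1ℚ
n/n≡1 (suc n) = ℚ.toℚᵘ-injective (ℚᵘ.≃-trans (ℚ.toℚᵘ-fromℚᵘ (ℚᵘ.mkℚᵘ (+ suc n) n))
  (ℚᵘ.*≡* (trans (ℤ.*-identityʳ (+ suc n)) (sym (ℤ.*-identityˡ (+ suc n))))))

0≤/ : ∀ m n .{{_ : ℕ.NonZero n}} → 0ℚ ℚ.≤ + m ℚ./ n
0≤/ m n = ℚ.nonNegative⁻¹ (+ m ℚ./ n) {{ℚ.normalize-nonNeg m n}}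

infixr 8 _↑_
_↑_ : ℝ → ℕ → ℝ
x ↑ zero  = 1#
x ↑ suc n = x ⊗ x ↑ n

ν : ℕ → ℝ
ν n = ι (+ n ℚ./ 1)

τ : ∀ n .{{_ : ℕ.NonZero n}} → ℝ
τ n = ι (+ 1 ℚ./ n)

ι-cong : ∀ {p q} → p ≡ q → ι p ≐ ι q
ι-cong refl = ≐-refl

0≼1 : 0# ≼ 1#
0≼1 = ι-mono 0≤1

0≼ν : ∀ n → 0# ≼ ν n
0≼ν n = ι-mono (0≤/ n 1)

0≼τ : ∀ n .{{_ : ℕ.NonZero n}} → 0# ≼ τ n
0≼τ n = ι-mono (0≤/ 1 n)

ν-⊕ : ∀ m n → ν (m ℕ.+ n) ≐ ν m ⊕ ν n
ν-⊕ m n = ≐-trans (ι-cong (sym (/-+ m n))) (ι-+ _ _)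

ν-⊗ : ∀ m n → ν (m ℕ.* n) ≐ ν m ⊗ ν n
ν-⊗ m n = ≐-trans (ι-cong (sym (/-* m 1 n 1))) (ι-* _ _)

ν-mono : ∀ {m n} → m ℕ.≤ n → ν m ≼ ν n
ν-mono {m} {n} m≤n = ≼-by (ν (n ℕ.∸ m)) (0≼ν (n ℕ.∸ m))
  (≐-trans (≐-sym (ν-⊕ m (n ℕ.∸ m))) (ι-cong (cong (λ k → + k ℚ./ 1) (ℕ.m+[n∸m]≡n m≤n))))

ν⊗τ : ∀ n .{{_ : ℕ.NonZero n}} → ν n ⊗ τ n ≐ 1#
ν⊗τ n@(suc _) = ≐-trans (≐-sym (ι-* _ _)) (ι-cong (trans (/-* n 1 1 n)
  (trans (ℚ./-cong (cong +_ (ℕ.*-identityʳ n)) (ℕ.*-identityˡ n)) (n/n≡1 n))))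

⊗-monoʳ : ∀ {x y z} → 0# ≼ x → y ≼ z → y ⊗ x ≼ z ⊗ x
⊗-monoʳ {x} {y} {z} 0≼x y≼z = begin
  y ⊗ x ≈⟨ ⊗-comm y x ⟩
  x ⊗ y ≲⟨ ⊗-monoˡ 0≼x y≼z ⟩
  x ⊗ z ≈⟨ ⊗-comm x z ⟩
  z ⊗ x ∎

⊗-mono : ∀ {x y u v} → 0# ≼ x → 0# ≼ v → x ≼ y → u ≼ v → x ⊗ u ≼ y ⊗ v
⊗-mono 0≼x 0≼v x≼y u≼v = ≼-trans (⊗-monoˡ 0≼x u≼v) (⊗-monoʳ 0≼v x≼y)

-- Division by a positive real is multiplication by a nonnegative y with x ⊗ y ≐ 1#.
⊗-cancelˡ : ∀ x {y u v} → 0# ≼ y → x ⊗ y ≐ 1# → x ⊗ u ≼ x ⊗ v → u ≼ v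
⊗-cancelˡ x {y} {u} {v} 0≼y xy≐1 xu≼xv = begin
  u           ≈⟨ undo u ⟨
  y ⊗ (x ⊗ u) ≲⟨ ⊗-monoˡ 0≼y xu≼xv ⟩
  y ⊗ (x ⊗ v) ≈⟨ undo v ⟩
  v           ∎
  where
  undo : ∀ w → y ⊗ (x ⊗ w) ≐ w
  undo w = ≐-trans (ring 3 (λ x y w → y ∶* (x ∶* w) ∶= (x ∶* y) ∶* w) ≐-refl x y w)
    (≐-trans (⊗-cong xy≐1 ≐-refl) (⊗-identityˡ w))

ν-cancelˡ : ∀ n {x y} .{{_ : ℕ.NonZero n}} → ν n ⊗ x ≼ ν n ⊗ y → x ≼ y
ν-cancelˡ n = ⊗-cancelˡ (ν n) (0≼τ n) (ν⊗τ n)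

⊗-identityʳ : ∀ x → x ⊗ 1# ≐ x
⊗-identityʳ x = ≐-trans (⊗-comm x 1#) (⊗-identityˡ x)

↑-cong : ∀ {x y} n → x ≐ y → x ↑ n ≐ y ↑ n
↑-cong zero    e = ≐-refl
↑-cong (suc n) e = ⊗-cong e (↑-cong n e)

0≼↑ : ∀ {x} n → 0# ≼ x → 0# ≼ x ↑ n
0≼↑ zero    0≼x = 0≼1
0≼↑ (suc n) 0≼x = 0≼-⊗ 0≼x (0≼↑ n 0≼x)

↑-mono : ∀ {x y} n → 0# ≼ x → x ≼ y → x ↑ n ≼ y ↑ n
↑-mono zero    0≼x x≼y = ≼-refl
↑-mono (suc n) 0≼x x≼y =
  ⊗-mono 0≼x (0≼↑ n (≼-trans 0≼x x≼y)) x≼y (↑-mono n 0≼x x≼y)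

1↑ : ∀ n → 1# ↑ n ≐ 1#
1↑ zero    = ≐-refl
1↑ (suc n) = ≐-trans (⊗-identityˡ (1# ↑ n)) (1↑ n)

↑-+ : ∀ x m n → x ↑ (m ℕ.+ n) ≐ x ↑ m ⊗ x ↑ n
↑-+ x zero    n = ≐-sym (⊗-identityˡ (x ↑ n))
↑-+ x (suc m) n = ≐-trans (⊗-cong ≐-refl (↑-+ x m n)) (≐-sym (⊗-assoc x (x ↑ m) (x ↑ n)))

⊗-↑ : ∀ x y n → (x ⊗ y) ↑ n ≐ x ↑ n ⊗ y ↑ n
⊗-↑ x y zero    = ≐-sym (⊗-identityˡ 1#)
⊗-↑ x y (suc n) = ≐-trans (⊗-cong ≐-refl (⊗-↑ x y n))
  (ring 4 (λ x y u v → (x ∶* y) ∶* (u ∶* v) ∶= (x ∶* u) ∶* (y ∶* v)) ≐-refl x y (x ↑ n) (y ↑ n))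

↑-* : ∀ x m n → x ↑ (m ℕ.* n) ≐ (x ↑ n) ↑ m
↑-* x zero    n = ≐-refl
↑-* x (suc m) n = ≐-trans (↑-+ x n (m ℕ.* n)) (⊗-cong ≐-refl (↑-* x m n))

-- The induction rests on (1 - a)(1 + (k+1)a) = 1 + ka - (k+1)a². This takes the place of (1 - a)^k
-- ≤ e^(-ka): it gives the halving times of y and z, the cost of resetting the distance, and the
-- decay of 2^(-n).
[1-a]^k[1+ka]≼1 : ∀ {a} k → 0# ≼ a → a ≼ 1# → (1# ⊖ a) ↑ k ⊗ (1# ⊕ ν k ⊗ a) ≼ 1#
[1-a]^k[1+ka]≼1 {a} zero 0≼a a≼1 = ≼-reflexive
  (ring 1 (λ a → κ 1ℚ ∶* (κ 1ℚ ∶+ κ 0ℚ ∶* a) ∶= κ 1ℚ) ≐-refl a)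
[1-a]^k[1+ka]≼1 {a} (suc k) 0≼a a≼1 = begin
  ((1# ⊖ a) ⊗ P) ⊗ (1# ⊕ ν (suc k) ⊗ a)
    ≈⟨ ⊗-cong ≐-refl (⊕-cong ≐-refl (⊗-cong (ν-⊕ 1 k) ≐-refl)) ⟩
  ((1# ⊖ a) ⊗ P) ⊗ (1# ⊕ (ν 1 ⊕ ν k) ⊗ a)
    ≲⟨ ≼-by (P ⊗ ((ν 1 ⊕ ν k) ⊗ (a ⊗ a)))
         (0≼-⊗ (0≼↑ k (0≼-⊖ a≼1)) (0≼-⊗ (0≼-⊕ (0≼ν 1) (0≼ν k)) (0≼-⊗ 0≼a 0≼a)))
         (ring 3 (λ a P n → ((κ 1ℚ ∶- a) ∶* P) ∶* (κ 1ℚ ∶+ (κ 1ℚ ∶+ n) ∶* a)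
                     ∶+ P ∶* ((κ 1ℚ ∶+ n) ∶* (a ∶* a)) ∶= P ∶* (κ 1ℚ ∶+ n ∶* a)) ≐-refl a P (ν k)) ⟩
  P ⊗ (1# ⊕ ν k ⊗ a)
    ≲⟨ [1-a]^k[1+ka]≼1 k 0≼a a≼1 ⟩
  1# ∎
  where P = (1# ⊖ a) ↑ k

half : ℝ
half = ι ½

0≼half : 0# ≼ half
0≼half = ι-mono (ℚ.<⇒≤ 0<½)

[1-a]^k≼½ : ∀ {a} k → 0# ≼ a → a ≼ 1# → 1# ≼ ν k ⊗ a → (1# ⊖ a) ↑ k ≼ half
[1-a]^k≼½ {a} k 0≼a a≼1 1≼ka = begin
  P                              ≈⟨ ring 1 (λ P → P ∶= κ ½ ∶* (P ∶* (κ 1ℚ ∶+ κ 1ℚ))) ≐-refl P ⟩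
  half ⊗ (P ⊗ (1# ⊕ 1#))         ≲⟨ ⊗-monoˡ 0≼half (⊗-monoˡ (0≼↑ k (0≼-⊖ a≼1)) (⊕-mono ≼-refl 1≼ka)) ⟩
  half ⊗ (P ⊗ (1# ⊕ ν k ⊗ a))    ≲⟨ ⊗-monoˡ 0≼half ([1-a]^k[1+ka]≼1 k 0≼a a≼1) ⟩
  half ⊗ 1#                      ≈⟨ ⊗-identityʳ half ⟩
  half                           ∎
  where P = (1# ⊖ a) ↑ k

-- Rounding to natural numbers

/1-mono : ∀ {m n} → m ℕ.≤ n → + m ℚ./ 1 ℚ.≤ + n ℚ./ 1
/1-mono {m} {n} m≤n = ≤-by (+ (n ℕ.∸ m) ℚ./ 1) (0≤/ (n ℕ.∸ m) 1)
  (trans (/-+ m (n ℕ.∸ m)) (cong (λ k → + k ℚ./ 1) (ℕ.m+[n∸m]≡n m≤n)))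

-- The witness is the floor plus one. It is a successor, so it can serve as a denominator.
rational-ceiling : ∀ p → 0ℚ ℚ.≤ p →
  Σ[ k ∈ ℕ ] (p ℚ.≤ + suc k ℚ./ 1 × + suc k ℚ./ 1 ℚ.≤ p ℚ.+ 1ℚ)
rational-ceiling p 0≤p = ceil p (ℚ.nonNegative 0≤p)
  where
  ceil : ∀ p → ℚ.NonNegative p →
    Σ[ k ∈ ℕ ] (p ℚ.≤ + suc k ℚ./ 1 × + suc k ℚ./ 1 ℚ.≤ p ℚ.+ 1ℚ)
  ceil p@(ℚ.mkℚ (+ n) d-1 _) _ = q
    , ℚ.*-cancelʳ-≤-pos d (subst₂ ℚ._≤_ (sym pd≡n) (sym (kd≡ (suc q)))
        (/1-mono (ℕ.≤-trans (ℕ.≤-reflexive (ℕ.m≡m%n+[m/n]*n n b))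
          (ℕ.+-monoˡ-≤ (q ℕ.* b) (ℕ.<⇒≤ (ℕ.m%n<n n b))))))
    , ℚ.*-cancelʳ-≤-pos d (subst₂ ℚ._≤_ (sym (kd≡ (suc q)))
        (sym (trans (ℚ.*-distribʳ-+ d p 1ℚ) (trans (cong₂ ℚ._+_ pd≡n (ℚ.*-identityˡ d)) (/-+ n b))))
        (/1-mono (ℕ.≤-trans (ℕ.≤-reflexive (ℕ.+-comm b (q ℕ.* b)))
          (ℕ.+-monoˡ-≤ b (ℕ.m/n*n≤m n b)))))
    where
    b = suc d-1
    q = n ℕ./ b
    d = + b ℚ./ 1
    instance
      d-pos : ℚ.Positive d
      d-pos = ℚ.normalize-pos b 1
    kd≡ : ∀ k → (+ k ℚ./ 1) ℚ.* d ≡ + (k ℕ.* b) ℚ./ 1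
    kd≡ k = /-* k 1 b 1
    pd≡n : p ℚ.* d ≡ + n ℚ./ 1
    pd≡n = trans (cong (ℚ._* d) (trans (sym (ℚ.↥p/↧p≡p p)) (sym (trans (/-* n 1 1 b)
        (ℚ./-cong (cong +_ (ℕ.*-identityʳ n)) (ℕ.*-identityˡ b))))))
      (trans (ℚ.*-assoc (+ n ℚ./ 1) (+ 1 ℚ./ b) d)
      (trans (cong ((+ n ℚ./ 1) ℚ.*_) (trans (/-* 1 b b 1)
        (trans (ℚ./-cong (cong +_ (ℕ.*-identityˡ b)) (ℕ.*-identityʳ b)) (n/n≡1 b))))
      (ℚ.*-identityʳ (+ n ℚ./ 1))))

eventually≤⇒≼ι : ∀ x q N → (∀ n → N ℕ.≤ n → seq x n ℚ.≤ q) → x ≼ ι q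
eventually≤⇒≼ι x q N h = ≼-trans {y = fromℚ q} ⟨ (λ ε 0<ε → N , λ n le →
    ℚ.≤-trans (h n le) (≤-by {q} {q ℚ.+ ε} ε (ℚ.<⇒≤ 0<ε) refl)) ⟩
  (≼-reflexive (ι≐ q))

eventually≥⇒ι≼ : ∀ x q N → (∀ n → N ℕ.≤ n → q ℚ.≤ seq x n) → ι q ≼ x
eventually≥⇒ι≼ x q N h = ≼-trans {y = fromℚ q} (≼-reflexive (≐-sym (ι≐ q)))
  ⟨ (λ ε 0<ε → N , λ n le → ℚ.≤-trans (h n le)
    (≤-by {seq x n} {seq x n ℚ.+ ε} ε (ℚ.<⇒≤ 0<ε) refl)) ⟩

archimedean : ∀ x → Σ[ k ∈ ℕ ] x ≼ ν k
archimedean x =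
  let b , 0<b , N , h = eventually-bounded x
      k , b≤k , _ = rational-ceiling b (ℚ.<⇒≤ 0<b)
  in suc k , ≼-trans (eventually≤⇒≼ι x b N h) (ι-mono b≤k)

ε-scaled : ∀ k .{{_ : ℕ.NonZero k}} ε → 0ℚ ℚ.< ε → Σ[ η ∈ ℚ ] (0ℚ ℚ.< η × ν k ⊗ ι η ≐ ι ε)
ε-scaled k ε 0<ε =
  let η , 0<η , eq = positive-quotient ε (+ k ℚ./ 1) 0<ε
                       (ℚ.positive⁻¹ (+ k ℚ./ 1) {{ℚ.normalize-pos k 1}})
  in η , 0<η , ≐-trans (≐-sym (ι-* _ η)) (ι-cong (trans (ℚ.*-comm _ η) eq))

-- Convolution of sequences and the exponential series

Σ≤ : (ℕ → ℝ) → ℕ → ℝ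
Σ≤ a zero    = a zero
Σ≤ a (suc n) = Σ≤ a n ⊕ a (suc n)

-- The Cauchy product. The recursion peels the first factor, so the inductions below generalise over
-- that factor.
conv : (ℕ → ℝ) → (ℕ → ℝ) → ℕ → ℝ
conv a b zero    = a zero ⊗ b zero
conv a b (suc n) = a zero ⊗ b (suc n) ⊕ conv (a ∘ suc) b n

-- The derivative of the power series with the given coefficients.
D : (ℕ → ℝ) → ℕ → ℝ
D a n = ν (suc n) ⊗ a (suc n)

ν-suc : ∀ n → ν (suc n) ≐ 1# ⊕ ν n
ν-suc n = ν-⊕ 1 n

Σ≤-cong : ∀ {a b} n → (∀ k → a k ≐ b k) → Σ≤ a n ≐ Σ≤ b n
Σ≤-cong zero    e = e zero
Σ≤-cong (suc n) e = ⊕-cong (Σ≤-cong n e) (e (suc n))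

Σ≤-mono : ∀ {a b} n → (∀ k → a k ≼ b k) → Σ≤ a n ≼ Σ≤ b n
Σ≤-mono zero    h = h zero
Σ≤-mono (suc n) h = ⊕-mono (Σ≤-mono n h) (h (suc n))

Σ≤-head : ∀ a n → Σ≤ a (suc n) ≐ a zero ⊕ Σ≤ (a ∘ suc) n
Σ≤-head a zero    = ≐-refl
Σ≤-head a (suc n) = ≐-trans (⊕-cong (Σ≤-head a n) ≐-refl) (⊕-assoc _ _ _)

conv-cong : ∀ {a a′ b b′} n → (∀ k → a k ≐ a′ k) → (∀ k → b k ≐ b′ k) → conv a b n ≐ conv a′ b′ n
conv-cong zero    e f = ⊗-cong (e zero) (f zero)
conv-cong (suc n) e f = ⊕-cong (⊗-cong (e zero) (f (suc n))) (conv-cong n (e ∘ suc) f)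

conv-mono : ∀ {a b b′} n → (∀ k → 0# ≼ a k) → (∀ k → b k ≼ b′ k) → conv a b n ≼ conv a b′ n
conv-mono zero    0≼a h = ⊗-monoˡ (0≼a zero) (h zero)
conv-mono (suc n) 0≼a h = ⊕-mono (⊗-monoˡ (0≼a zero) (h (suc n))) (conv-mono n (0≼a ∘ suc) h)

conv-⊕ˡ : ∀ a a′ b n → conv (λ k → a k ⊕ a′ k) b n ≐ conv a b n ⊕ conv a′ b n
conv-⊕ˡ a a′ b zero    = ring 3 (λ a a′ b → (a ∶+ a′) ∶* b ∶= a ∶* b ∶+ a′ ∶* b) ≐-refl
  (a zero) (a′ zero) (b zero)
conv-⊕ˡ a a′ b (suc n) = ≐-trans (⊕-cong ≐-refl (conv-⊕ˡ (a ∘ suc) (a′ ∘ suc) b n))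
  (ring 5 (λ a a′ b c c′ → (a ∶+ a′) ∶* b ∶+ (c ∶+ c′) ∶= (a ∶* b ∶+ c) ∶+ (a′ ∶* b ∶+ c′)) ≐-refl
    (a zero) (a′ zero) (b (suc n)) _ _)

conv-⊕ʳ : ∀ a b b′ n → conv a (λ k → b k ⊕ b′ k) n ≐ conv a b n ⊕ conv a b′ n
conv-⊕ʳ a b b′ zero    = ring 3 (λ a b b′ → a ∶* (b ∶+ b′) ∶= a ∶* b ∶+ a ∶* b′) ≐-refl
  (a zero) (b zero) (b′ zero)
conv-⊕ʳ a b b′ (suc n) = ≐-trans (⊕-cong ≐-refl (conv-⊕ʳ (a ∘ suc) b b′ n))
  (ring 5 (λ a b b′ c c′ → a ∶* (b ∶+ b′) ∶+ (c ∶+ c′) ∶= (a ∶* b ∶+ c) ∶+ (a ∶* b′ ∶+ c′)) ≐-refl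
    (a zero) (b (suc n)) (b′ (suc n)) _ _)

conv-⊗ˡ : ∀ x a b n → conv (λ k → x ⊗ a k) b n ≐ x ⊗ conv a b n
conv-⊗ˡ x a b zero    = ⊗-assoc x (a zero) (b zero)
conv-⊗ˡ x a b (suc n) = ≐-trans (⊕-cong ≐-refl (conv-⊗ˡ x (a ∘ suc) b n))
  (ring 4 (λ x a b c → (x ∶* a) ∶* b ∶+ x ∶* c ∶= x ∶* (a ∶* b ∶+ c)) ≐-refl
    x (a zero) (b (suc n)) _)

conv-⊗ʳ : ∀ x a b n → conv a (λ k → x ⊗ b k) n ≐ x ⊗ conv a b n
conv-⊗ʳ x a b zero    = ring 3 (λ x a b → a ∶* (x ∶* b) ∶= x ∶* (a ∶* b)) ≐-refl x (a zero) (b zero)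
conv-⊗ʳ x a b (suc n) = ≐-trans (⊕-cong ≐-refl (conv-⊗ʳ x (a ∘ suc) b n))
  (ring 4 (λ x a b c → a ∶* (x ∶* b) ∶+ x ∶* c ∶= x ∶* (a ∶* b ∶+ c)) ≐-refl
    x (a zero) (b (suc n)) _)

conv-const : ∀ a c n → conv a (λ _ → c) n ≐ Σ≤ a n ⊗ c
conv-const a c zero    = ≐-refl
conv-const a c (suc n) = ≐-trans (⊕-cong ≐-refl (conv-const (a ∘ suc) c n))
  (≐-trans (ring 3 (λ a s c → a ∶* c ∶+ s ∶* c ∶= (a ∶+ s) ∶* c) ≐-refl (a zero) _ c)
    (⊗-cong (≐-sym (Σ≤-head a n)) ≐-refl))

conv-Σ≤-suc : ∀ a b n → conv a (Σ≤ b) (suc n) ≐ conv a (Σ≤ b) n ⊕ conv a b (suc n)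
conv-Σ≤-suc a b zero = ring 4 (λ a a′ b b′ → a ∶* (b ∶+ b′) ∶+ a′ ∶* b ∶= a ∶* b ∶+ (a ∶* b′ ∶+ a′ ∶* b))
  ≐-refl (a 0) (a 1) (b 0) (b 1)
conv-Σ≤-suc a b (suc n) = ≐-trans (⊕-cong ≐-refl (conv-Σ≤-suc (a ∘ suc) b n))
  (ring 5 (λ a s b c c′ → a ∶* (s ∶+ b) ∶+ (c ∶+ c′) ∶= (a ∶* s ∶+ c) ∶+ (a ∶* b ∶+ c′)) ≐-refl
    (a zero) (Σ≤ b (suc n)) (b (suc (suc n))) _ _)

-- Taking partial sums is multiplication by 1/(1 - X), which may be moved onto one factor. This
-- makes `expSum-⊕` an exact identity with no remainder to estimate.
Σ≤-conv : ∀ a b n → Σ≤ (conv a b) n ≐ conv a (Σ≤ b) n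
Σ≤-conv a b zero    = ≐-refl
Σ≤-conv a b (suc n) = ≐-trans (⊕-cong (Σ≤-conv a b n) ≐-refl) (≐-sym (conv-Σ≤-suc a b n))

D-suc : ∀ a k → D a (suc k) ≐ D (a ∘ suc) k ⊕ a (suc (suc k))
D-suc a k = ≐-trans (⊗-cong (ν-suc (suc k)) ≐-refl)
  (ring 2 (λ n x → (κ 1ℚ ∶+ n) ∶* x ∶= n ∶* x ∶+ x) ≐-refl (ν (suc k)) (a (suc (suc k))))

conv-D-suc : ∀ a b n → conv (D a) b (suc n) ≐ conv (D (a ∘ suc)) b n ⊕ conv (a ∘ suc) b (suc n)
conv-D-suc a b n = ≐-trans
  (⊕-cong (⊗-cong (⊗-identityˡ (a 1)) ≐-refl)
    (≐-trans (conv-cong n (D-suc a) (λ _ → ≐-refl))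
      (conv-⊕ˡ (D (a ∘ suc)) (a ∘ suc ∘ suc) b n)))
  (ring 3 (λ h c c′ → h ∶+ (c ∶+ c′) ∶= c ∶+ (h ∶+ c′)) ≐-refl (a 1 ⊗ b (suc n)) _ _)

-- Leibniz's rule. Shifting the first factor changes its derivative by the extra summand of `D-suc`,
-- which balances the step from n + 1 to n + 2 in the outer coefficient.
D-conv : ∀ a b n → D (conv a b) n ≐ conv (D a) b n ⊕ conv a (D b) n
D-conv a b zero = ring 4 (λ a a′ b b′ → κ 1ℚ ∶* (a ∶* b′ ∶+ a′ ∶* b)
  ∶= (κ 1ℚ ∶* a′) ∶* b ∶+ a ∶* (κ 1ℚ ∶* b′)) ≐-refl (a 0) (a 1) (b 0) (b 1)
D-conv a b (suc n) = ≐-trans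
  (ring 4 (λ m a b c → m ∶* (a ∶* b ∶+ c) ∶= a ∶* (m ∶* b) ∶+ m ∶* c) ≐-refl
    (ν (suc (suc n))) (a zero) (b (suc (suc n))) (conv (a ∘ suc) b (suc n)))
  (≐-trans (⊕-cong ≐-refl (≐-trans (⊗-cong (ν-suc (suc n)) ≐-refl)
     (ring 2 (λ m c → (κ 1ℚ ∶+ m) ∶* c ∶= m ∶* c ∶+ c) ≐-refl (ν (suc n)) (conv (a ∘ suc) b (suc n)))))
  (≐-trans (⊕-cong ≐-refl (⊕-cong (D-conv (a ∘ suc) b n) ≐-refl))
  (≐-trans (ring 4 (λ h c c′ c″ → h ∶+ ((c ∶+ c′) ∶+ c″) ∶= (c ∶+ c″) ∶+ (h ∶+ c′)) ≐-refl
     (a zero ⊗ D b (suc n)) (conv (D (a ∘ suc)) b n) (conv (a ∘ suc) (D b) n) (conv (a ∘ suc) b (suc n)))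
  (⊕-cong (≐-sym (conv-D-suc a b n)) ≐-refl))))

⊗-cancelˡ-≐ : ∀ n {x y} .{{_ : ℕ.NonZero n}} → ν n ⊗ x ≐ ν n ⊗ y → x ≐ y
⊗-cancelˡ-≐ n {x} {y} e = ≐-trans (≐-sym (undo x)) (≐-trans (⊗-cong ≐-refl e) (undo y))
  where
  undo : ∀ w → τ n ⊗ (ν n ⊗ w) ≐ w
  undo w = ≐-trans (ring 3 (λ x y w → y ∶* (x ∶* w) ∶= (x ∶* y) ∶* w) ≐-refl (ν n) (τ n) w)
    (≐-trans (⊗-cong (ν⊗τ n) ≐-refl) (⊗-identityˡ w))

1/! : ℕ → ℝ
1/! k = τ (k !) {{k ℕ.!≢0}}

expTerm : ℝ → ℕ → ℝ
expTerm x k = x ↑ k ⊗ 1/! k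

ν⊗1/! : ∀ k → ν (suc k) ⊗ 1/! (suc k) ≐ 1/! k
ν⊗1/! k = ≐-trans (⊗-cong ≐-refl (≐-trans (ι-cong (sym (/-* 1 (suc k) 1 (k !)))) (ι-* _ _)))
  (≐-trans (≐-sym (⊗-assoc _ _ _)) (≐-trans (⊗-cong (ν⊗τ (suc k)) ≐-refl) (⊗-identityˡ _)))
  where instance
    _ = k ℕ.!≢0
    _ = suc k ℕ.!≢0

D-expTerm : ∀ x k → D (expTerm x) k ≐ x ⊗ expTerm x k
D-expTerm x k = ≐-trans
  (ring 4 (λ n x p f → n ∶* ((x ∶* p) ∶* f) ∶= (x ∶* p) ∶* (n ∶* f)) ≐-refl
    (ν (suc k)) x (x ↑ k) (1/! (suc k)))
  (≐-trans (⊗-cong ≐-refl (ν⊗1/! k)) (⊗-assoc x (x ↑ k) (1/! k)))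

expTerm-cong : ∀ {x y} k → x ≐ y → expTerm x k ≐ expTerm y k
expTerm-cong k e = ⊗-cong (↑-cong k e) ≐-refl

-- Both sides have the same constant term and satisfy the recursion f′ = (x + y) f, so they agree
-- coefficient by coefficient. Binomial coefficients are thereby avoided.
conv-expTerm : ∀ x y n → conv (expTerm x) (expTerm y) n ≐ expTerm (x ⊕ y) n
conv-expTerm x y zero    = ≐-trans (⊗-cong one one) (≐-trans (⊗-identityˡ 1#) (≐-sym one))
  where
  one : 1# ⊗ 1/! 0 ≐ 1#
  one = ⊗-identityˡ 1#
conv-expTerm x y (suc n) = ⊗-cancelˡ-≐ (suc n) (≐-trans (D-conv (expTerm x) (expTerm y) n)
  (≐-trans (⊕-cong
     (≐-trans (conv-cong n (D-expTerm x) (λ _ → ≐-refl)) (conv-⊗ˡ x (expTerm x) (expTerm y) n))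
     (≐-trans (conv-cong n (λ _ → ≐-refl) (D-expTerm y)) (conv-⊗ʳ y (expTerm x) (expTerm y) n)))
  (≐-trans (ring 3 (λ x y c → x ∶* c ∶+ y ∶* c ∶= (x ∶+ y) ∶* c) ≐-refl x y (conv (expTerm x) (expTerm y) n))
  (≐-trans (⊗-cong ≐-refl (conv-expTerm x y n)) (≐-sym (D-expTerm (x ⊕ y) n))))))

expSum : ℝ → ℕ → ℝ
expSum x = Σ≤ (expTerm x)

expSum-⊕ : ∀ x y n → expSum (x ⊕ y) n ≐ conv (expTerm x) (expSum y) n
expSum-⊕ x y n = ≐-trans (Σ≤-cong n (λ k → ≐-sym (conv-expTerm x y k)))
  (Σ≤-conv (expTerm x) (expTerm y) n)

0≼expTerm : ∀ {x} k → 0# ≼ x → 0# ≼ expTerm x k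
0≼expTerm k 0≼x = 0≼-⊗ (0≼↑ k 0≼x) (0≼τ (k !) {{k ℕ.!≢0}})

expSum-mono : ∀ {x y} n → 0# ≼ x → x ≼ y → expSum x n ≼ expSum y n
expSum-mono n 0≼x x≼y =
  Σ≤-mono n (λ k → ⊗-monoʳ (0≼τ (k !) {{k ℕ.!≢0}}) (↑-mono k 0≼x x≼y))

1≼expSum : ∀ {x} n → 0# ≼ x → 1# ≼ expSum x n
1≼expSum zero    0≼x = ≼-reflexive (≐-sym (⊗-identityˡ 1#))
1≼expSum (suc n) 0≼x = ≼-trans (1≼expSum n 0≼x)
  (≼-by _ (0≼expTerm (suc n) 0≼x) ≐-refl)

expSum-⊕≼ : ∀ {x y c} n → 0# ≼ x → (∀ k → expSum y k ≼ c) → expSum (x ⊕ y) n ≼ expSum x n ⊗ c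
expSum-⊕≼ {x} {y} {c} n 0≼x h = begin
  expSum (x ⊕ y) n              ≈⟨ expSum-⊕ x y n ⟩
  conv (expTerm x) (expSum y) n ≲⟨ conv-mono n (λ k → 0≼expTerm k 0≼x) h ⟩
  conv (expTerm x) (λ _ → c) n  ≈⟨ conv-const (expTerm x) c n ⟩
  expSum x n ⊗ c                ∎

-- A form of e^r ≤ 1/(1 - r) for partial sums. The extra summand with the last term makes the
-- induction go through: r times the n-th term is n + 1 times the next one, hence at least the next
-- one.
[1-r]expSum≼1 : ∀ {r} n → 0# ≼ r → (1# ⊖ r) ⊗ expSum r n ⊕ r ⊗ expTerm r n ≼ 1#
[1-r]expSum≼1 {r} zero 0≼r = ≼-reflexive
  (ring 1 (λ r → (κ 1ℚ ∶- r) ∶* (κ 1ℚ ∶* κ 1ℚ) ∶+ r ∶* (κ 1ℚ ∶* κ 1ℚ) ∶= κ 1ℚ) ≐-refl r)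
[1-r]expSum≼1 {r} (suc n) 0≼r = begin
  (1# ⊖ r) ⊗ (s ⊕ t′) ⊕ r ⊗ t′
    ≈⟨ ring 3 (λ r s t′ → (κ 1ℚ ∶- r) ∶* (s ∶+ t′) ∶+ r ∶* t′ ∶= (κ 1ℚ ∶- r) ∶* s ∶+ t′) ≐-refl r s t′ ⟩
  (1# ⊖ r) ⊗ s ⊕ t′
    ≲⟨ ⊕-mono ≼-refl (≼-by (ν n ⊗ t′) (0≼-⊗ (0≼ν n) (0≼expTerm (suc n) 0≼r))
         (≐-trans (ring 2 (λ n t → t ∶+ n ∶* t ∶= (κ 1ℚ ∶+ n) ∶* t) ≐-refl (ν n) t′)
           (≐-trans (⊗-cong (≐-sym (ν-suc n)) ≐-refl) (D-expTerm r n)))) ⟩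
  (1# ⊖ r) ⊗ s ⊕ r ⊗ expTerm r n
    ≲⟨ [1-r]expSum≼1 n 0≼r ⟩
  1# ∎
  where
  s = expSum r n
  t′ = expTerm r (suc n)

expSum≼inverse : ∀ {r u} n → 0# ≼ r → 0# ≼ u → (1# ⊖ r) ⊗ u ≐ 1# → expSum r n ≼ u
expSum≼inverse {r} {u} n 0≼r 0≼u eq = ⊗-cancelˡ (1# ⊖ r) 0≼u eq (begin
  (1# ⊖ r) ⊗ expSum r n                   ≲⟨ ≼-by _ (0≼-⊗ 0≼r (0≼expTerm n 0≼r)) ≐-refl ⟩
  (1# ⊖ r) ⊗ expSum r n ⊕ r ⊗ expTerm r n ≲⟨ [1-r]expSum≼1 n 0≼r ⟩
  1#                                      ≈⟨ eq ⟨
  (1# ⊖ r) ⊗ u                            ∎)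

expSum-0 : ∀ n → expSum 0# n ≼ 1#
expSum-0 n = expSum≼inverse n ≼-refl 0≼1
  (ring 0 ((κ 1ℚ ∶- κ 0ℚ) ∶* κ 1ℚ ∶= κ 1ℚ) ≐-refl)

-- Here u = 1/(1 - r), and e^r ≤ u is multiplied up m times through the addition formula. The bound
-- is uniform in n, as `expSum-⊕≼` requires of its second summand.
expSum-multiple : ∀ {r u} m n → 0# ≼ r → 0# ≼ u → (1# ⊖ r) ⊗ u ≐ 1# →
  expSum (ν m ⊗ r) n ≼ u ↑ m
expSum-multiple {r} {u} zero n 0≼r 0≼u eq = begin
  expSum (0# ⊗ r) n ≈⟨ Σ≤-cong n (λ k → expTerm-cong k
                         (ring 1 (λ r → κ 0ℚ ∶* r ∶= κ 0ℚ) ≐-refl r)) ⟩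
  expSum 0# n       ≲⟨ expSum-0 n ⟩
  1#                ∎
expSum-multiple {r} {u} (suc m) n 0≼r 0≼u eq = begin
  expSum (ν (suc m) ⊗ r) n ≈⟨ Σ≤-cong n (λ k → expTerm-cong k (≐-trans (⊗-cong (ν-suc m) ≐-refl)
                                (ring 2 (λ m r → (κ 1ℚ ∶+ m) ∶* r ∶= r ∶+ m ∶* r) ≐-refl (ν m) r))) ⟩
  expSum (r ⊕ ν m ⊗ r) n   ≲⟨ expSum-⊕≼ n 0≼r (λ k → expSum-multiple m k 0≼r 0≼u eq) ⟩
  expSum r n ⊗ u ↑ m       ≲⟨ ⊗-monoʳ (0≼↑ m 0≼u) (expSum≼inverse n 0≼r 0≼u eq) ⟩
  u ⊗ u ↑ m                ∎

expSum-bounded : ∀ x → 0# ≼ x → Σ[ k ∈ ℕ ] ∀ n → expSum x n ≼ ν k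
expSum-bounded x 0≼x =
  let m , x≼m = archimedean x
      -- Write m as 2m halves: e^½ ≤ 1/(1 - ½) = 2, so the partial sums stay below 2^(2m).
      k , u≼k = archimedean (ν 2 ↑ (m ℕ.* 2))
  in k , λ n → begin
    expSum x n                    ≲⟨ expSum-mono n 0≼x x≼m ⟩
    expSum (ν m) n                ≈⟨ Σ≤-cong n (λ j → expTerm-cong j (≐-trans
                                       (ring 1 (λ m → m ∶= (m ∶* (κ 1ℚ ∶+ κ 1ℚ)) ∶* κ ½) ≐-refl (ν m))
                                       (⊗-cong (≐-sym (≐-trans (ν-⊗ m 2) (⊗-cong ≐-refl (ν-⊕ 1 1)))) ≐-refl))) ⟩
    expSum (ν (m ℕ.* 2) ⊗ half) n ≲⟨ expSum-multiple (m ℕ.* 2) n 0≼half (0≼ν 2)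
                                       (ring 0 ((κ 1ℚ ∶- κ ½) ∶* κ (+ 2 ℚ./ 1) ∶= κ 1ℚ) ≐-refl) ⟩
    ν 2 ↑ (m ℕ.* 2)               ≲⟨ u≼k ⟩
    ν k                           ∎

-- Limits of the exponential series

+-as-⊕ : ∀ x y {u v} → x ≐ u → y ≐ v → x + y ≐ u ⊕ v
+-as-⊕ x y e f = ≐-trans (⊕≐ x y) (⊕-cong e f)

*-as-⊗ : ∀ x y {u v} → x ≐ u → y ≐ v → x * y ≐ u ⊗ v
*-as-⊗ x y e f = ≐-trans (⊗≐ x y) (⊗-cong e f)

^-as-↑ : ∀ x n → x ^ n ≐ x ↑ n
^-as-↑ x zero    = ι≐ 1ℚ
^-as-↑ x (suc n) = *-as-⊗ x (x ^ n) ≐-refl (^-as-↑ x n)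

expTerm≐ : ∀ x k → x ^ k * 1/ k ! ≐ expTerm x k
expTerm≐ x k = *-as-⊗ (x ^ k) (1/ k !) (^-as-↑ x k) (ι≐ _)

-- Matches a right-nested list sum of n + 1 terms with the left-nested `Σ≤` up to index n. The index
-- function g is generalised because `applyUpTo` recurses by composing it with `suc`.
sum-applyUpTo : ∀ f a (g : ℕ → ℕ) n → (∀ k → f k ≐ a k) →
  sum (map f (applyUpTo g (suc n))) ≐ Σ≤ (a ∘ g) n
sum-applyUpTo f a g zero e = ≐-trans (+-as-⊕ (f (g 0)) 0ℝ (e (g 0)) (ι≐ 0ℚ))
  (ring 1 (λ x → x ∶+ κ 0ℚ ∶= x) ≐-refl (a (g 0)))
sum-applyUpTo f a g (suc n) e = ≐-trans (+-as-⊕ (f (g 0)) _ (e (g 0)) (sum-applyUpTo f a (g ∘ suc) n e))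
  (≐-sym (Σ≤-head (a ∘ g) n))

limit≼expSum : ∀ {x y} → y IsExpOf x → ∀ ε → 0ℚ ℚ.< ε →
  Σ[ N ∈ ℕ ] ∀ n → N ℕ.≤ n → y ≼ expSum x n ⊕ ι ε
limit≼expSum {x} {y} h ε 0<ε =
  let N , hN = h ε 0<ε
  in N , λ n N≤n → ≼-trans ⟨ proj₂ (hN (suc n) (ℕ.m≤n⇒m≤1+n N≤n)) ⟩
       (≼-reflexive (+-as-⊕ _ (fromℚ ε) (sum-applyUpTo _ (expTerm x) id n (expTerm≐ x)) (ι≐ ε)))

half↑-small : ∀ k ε → 0ℚ ℚ.< ε → Σ[ n ∈ ℕ ] ν k ⊗ half ↑ n ≼ ι ε
half↑-small k ε 0<ε =
  let μ , 0<μ , με≡1 = positive-quotient 1ℚ ε (ℚ.positive⁻¹ 1ℚ) 0<ε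
      -- Any n ≥ 2k/ε works, since 2^(-n) (1 + n/2) ≤ 1.
      n , kμ≼n = archimedean ((ν k ⊗ ι μ) ⊗ (1# ⊕ 1#))
  in n , (begin
    ν k ⊗ half ↑ n
      ≈⟨ ⊗-cong (⊗-identityʳ (ν k)) ≐-refl ⟨
    (ν k ⊗ 1#) ⊗ half ↑ n
      ≈⟨ ⊗-cong (⊗-cong ≐-refl (≐-trans (≐-sym (ι-* μ ε)) (ι-cong με≡1))) ≐-refl ⟨
    (ν k ⊗ (ι μ ⊗ ι ε)) ⊗ half ↑ n
      ≈⟨ ring 4 (λ k μ ε p → (k ∶* (μ ∶* ε)) ∶* p ∶=
           (p ∶* ε) ∶* (((k ∶* μ) ∶* (κ 1ℚ ∶+ κ 1ℚ)) ∶* κ ½)) ≐-refl (ν k) (ι μ) (ι ε) (half ↑ n) ⟩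
    (half ↑ n ⊗ ι ε) ⊗ (((ν k ⊗ ι μ) ⊗ (1# ⊕ 1#)) ⊗ half)
      ≲⟨ ⊗-monoˡ (0≼-⊗ (0≼↑ n 0≼half) (ι-mono (ℚ.<⇒≤ 0<ε))) (⊗-monoʳ 0≼half kμ≼n) ⟩
    (half ↑ n ⊗ ι ε) ⊗ (ν n ⊗ half)
      ≲⟨ ⊗-monoˡ (0≼-⊗ (0≼↑ n 0≼half) (ι-mono (ℚ.<⇒≤ 0<ε)))
           (≼-by 1# 0≼1 (⊕-comm (ν n ⊗ half) 1#)) ⟩
    (half ↑ n ⊗ ι ε) ⊗ (1# ⊕ ν n ⊗ half)
      ≈⟨ ring 3 (λ p ε c → (p ∶* ε) ∶* c ∶= ε ∶* (p ∶* c)) ≐-refl (half ↑ n) (ι ε) (1# ⊕ ν n ⊗ half) ⟩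
    ι ε ⊗ (half ↑ n ⊗ (1# ⊕ ν n ⊗ half))
      ≈⟨ ⊗-cong ≐-refl (⊗-cong (↑-cong n (ring 0 (κ ½ ∶= κ 1ℚ ∶- κ ½) ≐-refl)) ≐-refl) ⟩
    ι ε ⊗ ((1# ⊖ half) ↑ n ⊗ (1# ⊕ ν n ⊗ half))
      ≲⟨ ⊗-monoˡ (ι-mono (ℚ.<⇒≤ 0<ε)) ([1-a]^k[1+ka]≼1 n 0≼half half≼1) ⟩
    ι ε ⊗ 1#
      ≈⟨ ⊗-identityʳ (ι ε) ⟩
    ι ε ∎)
  where
  half≼1 : half ≼ 1#
  half≼1 = ≼-by half 0≼half (ring 0 (κ ½ ∶+ κ ½ ∶= κ 1ℚ) ≐-refl)

2^ : ℕ → ℝ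
2^ n = (1# ⊕ 1#) ↑ n

2^⊗half↑ : ∀ n → 2^ n ⊗ half ↑ n ≐ 1#
2^⊗half↑ n = ≐-trans (≐-sym (⊗-↑ (1# ⊕ 1#) half n))
  (≐-trans (↑-cong n (ring 0 ((κ 1ℚ ∶+ κ 1ℚ) ∶* κ ½ ∶= κ 1ℚ) ≐-refl)) (1↑ n))

-- Finitely many exceptional indices are absorbed into a geometric error d · 2^(-n) rather than cut
-- off, because convolving a geometric sequence with the exponential terms has a closed form.
finite-majorant : ∀ x (s : ℕ → ℝ) N →
  Σ[ d ∈ ℕ ] ∀ n → n ℕ.< N → x ≼ s n ⊕ ν d ⊗ half ↑ n
finite-majorant x s zero    = 0 , λ _ ()
finite-majorant x s (suc N) =
  let d , h = finite-majorant x s N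
      k , x-s≼k = archimedean ((x ⊖ s N) ⊗ 2^ N)
  in d ℕ.+ k , λ n n<1+N → extend d k h x-s≼k n (ℕ.m≤n⇒m<n∨m≡n (ℕ.≤-pred n<1+N))
  where
  weaken : ∀ a b n → a ℕ.≤ b → s n ⊕ ν a ⊗ half ↑ n ≼ s n ⊕ ν b ⊗ half ↑ n
  weaken a b n a≤b = ⊕-mono ≼-refl (⊗-monoʳ (0≼↑ n 0≼half) (ν-mono a≤b))
  extend : ∀ d k → (∀ n → n ℕ.< N → x ≼ s n ⊕ ν d ⊗ half ↑ n) → (x ⊖ s N) ⊗ 2^ N ≼ ν k →
    ∀ n → (n ℕ.< N) ⊎ (n ≡ N) → x ≼ s n ⊕ ν (d ℕ.+ k) ⊗ half ↑ n
  extend d k h _ n (inj₁ n<N) = ≼-trans (h n n<N) (weaken d (d ℕ.+ k) n (ℕ.m≤m+n d k))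
  extend d k _ x-s≼k n (inj₂ refl) = begin
    x
      ≈⟨ ring 2 (λ x s → x ∶= s ∶+ (x ∶- s) ∶* κ 1ℚ) ≐-refl x (s n) ⟩
    s n ⊕ (x ⊖ s n) ⊗ 1#
      ≈⟨ ⊕-cong ≐-refl (⊗-cong ≐-refl (2^⊗half↑ n)) ⟨
    s n ⊕ (x ⊖ s n) ⊗ (2^ n ⊗ half ↑ n)
      ≈⟨ ⊕-cong ≐-refl (⊗-assoc _ _ _) ⟨
    s n ⊕ ((x ⊖ s n) ⊗ 2^ n) ⊗ half ↑ n
      ≲⟨ ⊕-mono ≼-refl (⊗-monoʳ (0≼↑ n 0≼half) x-s≼k) ⟩
    s n ⊕ ν k ⊗ half ↑ n
      ≲⟨ weaken k (d ℕ.+ k) n (ℕ.m≤n+m k d) ⟩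
    s n ⊕ ν (d ℕ.+ k) ⊗ half ↑ n ∎

-- With c the exponential terms of 2z, the sequence 2^(-k) c k is that of z. The error of
-- `finite-majorant`, convolved with the series of z, is thus 2^(-n) times a bounded partial sum and
-- vanishes in the limit.
conv-half↑ : ∀ c n → conv (λ k → half ↑ k ⊗ c k) (half ↑_) n ≐ half ↑ n ⊗ Σ≤ c n
conv-half↑ c zero    = ring 1 (λ c → (κ 1ℚ ∶* c) ∶* κ 1ℚ ∶= κ 1ℚ ∶* c) ≐-refl (c zero)
conv-half↑ c (suc n) = ≐-trans (⊕-cong ≐-refl (≐-trans
  (conv-cong n (λ k → ⊗-assoc half (half ↑ k) (c (suc k))) (λ _ → ≐-refl))
  (≐-trans (conv-⊗ˡ half (λ k → half ↑ k ⊗ c (suc k)) (half ↑_) n)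
    (⊗-cong ≐-refl (conv-half↑ (c ∘ suc) n)))))
  (≐-trans (ring 4 (λ c h p s → (κ 1ℚ ∶* c) ∶* (h ∶* p) ∶+ h ∶* (p ∶* s) ∶= (h ∶* p) ∶* (c ∶+ s)) ≐-refl
    (c zero) half (half ↑ n) (Σ≤ (c ∘ suc) n))
  (⊗-cong ≐-refl (≐-sym (Σ≤-head c n))))

expTerm-double : ∀ z k → expTerm z k ≐ half ↑ k ⊗ expTerm (z ⊕ z) k
expTerm-double z k = ≐-trans (⊗-cong (≐-trans
    (↑-cong k (ring 1 (λ z → z ∶= κ ½ ∶* (z ∶+ z)) ≐-refl z)) (⊗-↑ half (z ⊕ z) k)) ≐-refl)
  (⊗-assoc _ _ _)

-- exp ℓ ≤ exp (z + ℓ) for z ≥ 0, read off from e(z + ℓ) = Σ z^j/j! · (partial sums of exp ℓ),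
-- where the finitely many partial sums that are not yet close to exp ℓ are damped by z^j/j!.
expOf≼ : ∀ {x y z v} → y IsExpOf x → 0# ≼ y → 0# ≼ z → (∀ n → expSum (z ⊕ x) n ≼ v) → y ≼ v
expOf≼ {x} {y} {z} {v} y-exp 0≼y 0≼z h = ≼-limit λ ε 0<ε →
  let w , hw = expSum-bounded (z ⊕ z) (0≼-⊕ 0≼z 0≼z)
      η , 0<η , wη≐ε/2 = ε-scaled (suc w) (ε ℚ.* ½) (0<-* 0<ε 0<½)
      N , hN = limit≼expSum y-exp η 0<η
      d , hd = finite-majorant (y ⊖ ι η) (expSum x) N
      n , hn = half↑-small (d ℕ.* w) (ε ℚ.* ½) (0<-* 0<ε 0<½)
      majorant = λ k → expSum x k ⊕ ν d ⊗ half ↑ k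
      y-η≼ : ∀ k → y ⊖ ι η ≼ majorant k
      y-η≼ k = by-cases N d η hN hd k (ℕ.≤-<-connex N k)
      b = expTerm z
      S = expSum z n
      S≼w : S ≼ ν w
      S≼w = ≼-trans (expSum-mono n 0≼z (≼-by z 0≼z ≐-refl)) (hw n)
  in begin
    y
      ≈⟨ ⊗-identityˡ y ⟨
    1# ⊗ y
      ≲⟨ ⊗-monoʳ 0≼y (1≼expSum n 0≼z) ⟩
    S ⊗ y
      ≈⟨ ring 3 (λ s y η → s ∶* y ∶= s ∶* (y ∶- η) ∶+ s ∶* η) ≐-refl S y (ι η) ⟩
    S ⊗ (y ⊖ ι η) ⊕ S ⊗ ι η
      ≈⟨ ⊕-cong (conv-const b (y ⊖ ι η) n) ≐-refl ⟨
    conv b (λ _ → y ⊖ ι η) n ⊕ S ⊗ ι η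
      ≲⟨ ⊕-mono (conv-mono n (λ k → 0≼expTerm k 0≼z) y-η≼)
           (⊗-monoʳ (ι-mono (ℚ.<⇒≤ 0<η)) (≼-trans S≼w (ν-mono (ℕ.n≤1+n w)))) ⟩
    conv b majorant n ⊕ ν (suc w) ⊗ ι η
      ≈⟨ ⊕-cong (≐-trans (conv-⊕ʳ b (expSum x) (λ k → ν d ⊗ half ↑ k) n)
           (⊕-cong (≐-sym (expSum-⊕ z x n)) (≐-trans (conv-⊗ʳ (ν d) b (half ↑_) n)
             (⊗-cong ≐-refl (≐-trans (conv-cong n (expTerm-double z) (λ _ → ≐-refl))
               (conv-half↑ (expTerm (z ⊕ z)) n)))))) wη≐ε/2 ⟩
    (expSum (z ⊕ x) n ⊕ ν d ⊗ (half ↑ n ⊗ expSum (z ⊕ z) n)) ⊕ ι (ε ℚ.* ½)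
      ≲⟨ ⊕-mono (⊕-mono (h n) (⊗-monoˡ (0≼ν d) (⊗-monoˡ (0≼↑ n 0≼half) (hw n)))) ≼-refl ⟩
    (v ⊕ ν d ⊗ (half ↑ n ⊗ ν w)) ⊕ ι (ε ℚ.* ½)
      ≈⟨ ⊕-cong (⊕-cong ≐-refl (≐-trans
           (ring 3 (λ d p w → d ∶* (p ∶* w) ∶= (d ∶* w) ∶* p) ≐-refl (ν d) (half ↑ n) (ν w))
           (⊗-cong (≐-sym (ν-⊗ d w)) ≐-refl))) ≐-refl ⟩
    (v ⊕ ν (d ℕ.* w) ⊗ half ↑ n) ⊕ ι (ε ℚ.* ½)
      ≲⟨ ⊕-mono (⊕-mono ≼-refl hn) ≼-refl ⟩
    (v ⊕ ι (ε ℚ.* ½)) ⊕ ι (ε ℚ.* ½)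
      ≈⟨ ⊕-assoc _ _ _ ⟩
    v ⊕ (ι (ε ℚ.* ½) ⊕ ι (ε ℚ.* ½))
      ≈⟨ ⊕-cong ≐-refl (≐-trans (≐-sym (ι-+ _ _)) (ι-cong (half+half ε))) ⟩
    v ⊕ ι ε ∎
  where
  by-cases : ∀ N d η → (∀ n → N ℕ.≤ n → y ≼ expSum x n ⊕ ι η) →
    (∀ n → n ℕ.< N → y ⊖ ι η ≼ expSum x n ⊕ ν d ⊗ half ↑ n) →
    ∀ k → (N ℕ.≤ k) ⊎ (k ℕ.< N) → y ⊖ ι η ≼ expSum x k ⊕ ν d ⊗ half ↑ k
  by-cases N d η hN hd k (inj₂ k<N) = hd k k<N
  by-cases N d η hN hd k (inj₁ N≤k) = begin
    y ⊖ ι η                       ≲⟨ ⊕-mono (hN k N≤k) ≼-refl ⟩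
    (expSum x k ⊕ ι η) ⊖ ι η      ≈⟨ ring 2 (λ s η → (s ∶+ η) ∶- η ∶= s) ≐-refl (expSum x k) (ι η) ⟩
    expSum x k                    ≲⟨ ≼-by _ (0≼-⊗ (0≼ν d) (0≼↑ k 0≼half)) ≐-refl ⟩
    expSum x k ⊕ ν d ⊗ half ↑ k   ∎

-- Squares, and locating reals among rationals and integers

opaque
  unfolding ι

  0≼square : ∀ x → 0# ≼ x ⊗ x
  0≼square x = ⟨ (λ ε 0<ε → 0 , λ n _ → 0≤-+ (0≤square (seq x n)) (ℚ.<⇒≤ 0<ε)) ⟩
    where
    0≤square : ∀ p → 0ℚ ℚ.≤ p ℚ.* p
    0≤square p with ℚ.≤-total 0ℚ p
    ... | inj₁ 0≤p = 0≤-* 0≤p 0≤p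
    ... | inj₂ p≤0 = ℚ.nonNegative⁻¹ (p ℚ.* p)
      {{ℚ.nonPos*nonPos⇒nonPos p {{ℚ.nonPositive p≤0}} p {{ℚ.nonPositive p≤0}}}}

¼ : ℚ
¼ = ½ ℚ.* ½

<⇒≱ : ∀ {p q} → p ℚ.< q → ¬ q ℚ.≤ p
<⇒≱ p<q q≤p = ℚ.<-irrefl refl (ℚ.<-≤-trans p<q q≤p)

0<difference : ∀ {p q} → p ℚ.< q → 0ℚ ℚ.< q ℚ.- p
0<difference {p} {q} p<q = subst (ℚ._< q ℚ.- p) (ℚ.+-inverseʳ p) (ℚ.+-monoˡ-< (ℚ.- p) p<q)

<⇒ι≼ : ∀ {x y} → x < y → Σ[ ε ∈ ℚ ] (0ℚ ℚ.< ε × x ⊕ ι ε ≼ y)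
<⇒ι≼ {x} {y} (ε , 0<ε , N , h) = ε , 0<ε ,
  ≼-trans {y = x + fromℚ ε} (≼-reflexive (≐-sym (+-as-⊕ x (fromℚ ε) ≐-refl (ι≐ ε))))
    ⟨ (λ η 0<η → N , λ n le → ℚ.≤-trans (h n le)
      (≤-by {seq y n} {seq y n ℚ.+ η} η (ℚ.<⇒≤ 0<η) refl)) ⟩

two-halves : ∀ p q → (p ℚ.+ (q ℚ.- p) ℚ.* ½) ℚ.+ (q ℚ.- p) ℚ.* ½ ≡ q
two-halves = solve 2 (λ p q → (p :+ (q :- p) :* con ½) :+ (q :- p) :* con ½ := q) refl

midpoint< : ∀ p q → q ℚ.< p → q ℚ.+ (p ℚ.- q) ℚ.* ½ ℚ.< p
midpoint< p q q<p = subst (q ℚ.+ η ℚ.<_) (two-halves q p)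
  (subst (ℚ._< (q ℚ.+ η) ℚ.+ η) (ℚ.+-identityʳ (q ℚ.+ η))
    (ℚ.+-monoʳ-< (q ℚ.+ η) (0<-* (0<difference q<p) 0<½)))
  where
  η = (p ℚ.- q) ℚ.* ½

-- If q < p, the hypothesis at tolerance (p - q)/2 would put p at or below the midpoint. Since the
-- order on ℚ is decidable, refuting q < p is enough.
fromℚ-+-cancelʳ-≤ : ∀ {p q} → fromℚ p ≼ fromℚ q → p ℚ.≤ q
fromℚ-+-cancelʳ-≤ {p} {q} ⟨ h ⟩ = decidable-stable (p ℚ.≤? q) λ p≰q →
  <⇒≱ (midpoint< p q (ℚ.≰⇒> p≰q))
    (proj₂ (h ((p ℚ.- q) ℚ.* ½) (0<-* (0<difference (ℚ.≰⇒> p≰q)) 0<½)) _ ℕ.≤-refl)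

ι-+-cancelʳ-≤ : ∀ {p q} → ι p ≼ ι q → p ℚ.≤ q
ι-+-cancelʳ-≤ {p} {q} h = fromℚ-+-cancelʳ-≤
  (≼-trans (≼-reflexive (ι≐ p)) (≼-trans h (≼-reflexive (≐-sym (ι≐ q)))))

+-cancelʳ : ∀ p r q → p ℚ.+ r ℚ.≤ q ℚ.+ r → p ℚ.≤ q
+-cancelʳ p r q h = subst₂ ℚ._≤_ (p+r-r p r) (p+r-r q r) (ℚ.+-monoˡ-≤ (ℚ.- r) h)
  where
  p+r-r : ∀ p r → (p ℚ.+ r) ℚ.- r ≡ p
  p+r-r = solve 2 (λ p r → (p :+ r) :- r := p) refl

-- The constructive substitute for comparing x with a threshold: a single term of x, accurate to
-- half the width, is compared with the midpoint of p and q.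
≼⊎≽ : ∀ x {p q} → p ℚ.< q → (x ≼ ι q) ⊎ (ι p ≼ x)
≼⊎≽ x {p} {q} p<q = split (ℚ.≤-total (seq x N) mid)
  where
  η = (q ℚ.- p) ℚ.* ½
  0<η : 0ℚ ℚ.< η
  0<η = 0<-* (0<difference p<q) 0<½
  mid = p ℚ.+ η
  N = proj₁ (cauchy x η 0<η)
  near = proj₂ (cauchy x η 0<η)
  below : seq x N ℚ.≤ mid → ∀ n → N ℕ.≤ n → seq x n ℚ.≤ q
  below x≤mid n N≤n = ℚ.≤-trans (close⇒≤ (seq x n) (seq x N) (near n N N≤n ℕ.≤-refl))
    (ℚ.≤-trans (ℚ.+-monoˡ-≤ η x≤mid) (ℚ.≤-reflexive (two-halves p q)))
  above : mid ℚ.≤ seq x N → ∀ n → N ℕ.≤ n → p ℚ.≤ seq x n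
  above mid≤x n N≤n = +-cancelʳ p η (seq x n)
    (ℚ.≤-trans mid≤x (close⇒≤ (seq x N) (seq x n) (near N n ℕ.≤-refl N≤n)))
  split : (seq x N ℚ.≤ mid) ⊎ (mid ℚ.≤ seq x N) → (x ≼ ι q) ⊎ (ι p ≼ x)
  split (inj₁ x≤mid) = inj₁ (eventually≤⇒≼ι x q N (below x≤mid))
  split (inj₂ mid≤x) = inj₂ (eventually≥⇒ι≼ x p N (above mid≤x))

rational-within : ∀ x {ε} → 0ℚ ℚ.< ε → Σ[ q ∈ ℚ ] (ι q ≼ x × x ≼ ι (q ℚ.+ ε))
rational-within x {ε} 0<ε = q
  , eventually≥⇒ι≼ x q N (λ n N≤n → +-cancelʳ q η (seq x n)
      (ℚ.≤-trans (ℚ.≤-reflexive (q+η≡ (seq x N) η))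
        (close⇒≤ (seq x N) (seq x n) (near N n ℕ.≤-refl N≤n))))
  , eventually≤⇒≼ι x (q ℚ.+ ε) N (λ n N≤n → ℚ.≤-trans
      (close⇒≤ (seq x n) (seq x N) (near n N N≤n ℕ.≤-refl))
      (ℚ.≤-reflexive (q+ε≡ (seq x N) ε)))
  where
  η = ε ℚ.* ½
  N = proj₁ (cauchy x η (0<-* 0<ε 0<½))
  near = proj₂ (cauchy x η (0<-* 0<ε 0<½))
  q = seq x N ℚ.- η
  q+η≡ : ∀ y η → (y ℚ.- η) ℚ.+ η ≡ y
  q+η≡ = solve 2 (λ y η → (y :- η) :+ η := y) refl
  q+ε≡ : ∀ y ε → y ℚ.+ ε ℚ.* ½ ≡ (y ℚ.- ε ℚ.* ½) ℚ.+ ε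
  q+ε≡ = solve 2 (λ y ε → y :+ ε :* con ½ := (y :- ε :* con ½) :+ ε) refl

-- Once x is positive and xy is within ½ of 1, a nonpositive term of y would make xy ≤ 0, which is
-- impossible.
0≼-inverse : ∀ {x y} → 0ℝ < x → x * y ≃ 1ℝ → 0# ≼ y
0≼-inverse {x} {y} (ε , 0<ε , N , h) e = eventually≥⇒ι≼ y 0ℚ (N ℕ.⊔ M) (λ n le →
  0≤y n (ℕ.m⊔n≤o⇒m≤o N M le) (ℕ.m⊔n≤o⇒n≤o N M le) (ℚ.≤-total 0ℚ (seq y n)))
  where
  M = proj₁ (e ½ 0<½)
  1≤xy+½ : ∀ n → M ℕ.≤ n → 1ℚ ℚ.≤ seq x n ℚ.* seq y n ℚ.+ ½
  1≤xy+½ n M≤n = close⇒≤ 1ℚ (seq x n ℚ.* seq y n)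
    (close-sym (seq x n ℚ.* seq y n) 1ℚ (proj₂ (e ½ 0<½) n M≤n))
  0≤x : ∀ n → N ℕ.≤ n → 0ℚ ℚ.≤ seq x n
  0≤x n N≤n = ℚ.≤-trans (ℚ.≤-trans (ℚ.<⇒≤ 0<ε) (ℚ.≤-reflexive (sym (ℚ.+-identityˡ ε)))) (h n N≤n)
  ½<1 : ½ ℚ.< 1ℚ
  ½<1 = ℚ.*<* (+<+ (ℕ.s≤s (ℕ.s≤s ℕ.z≤n)))
  0≤y : ∀ n → N ℕ.≤ n → M ℕ.≤ n → (0ℚ ℚ.≤ seq y n) ⊎ (seq y n ℚ.≤ 0ℚ) → 0ℚ ℚ.≤ seq y n
  0≤y n N≤n M≤n (inj₁ 0≤y) = 0≤y
  0≤y n N≤n M≤n (inj₂ y≤0) = contradiction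
    (ℚ.≤-trans (1≤xy+½ n M≤n) (ℚ.≤-trans (ℚ.+-monoˡ-≤ ½ xy≤0) (ℚ.≤-reflexive (ℚ.+-identityˡ ½))))
    (<⇒≱ ½<1)
    where
    xy≤0 : seq x n ℚ.* seq y n ℚ.≤ 0ℚ
    xy≤0 = ℚ.≤-trans (ℚ.*-monoˡ-≤-nonNeg (seq x n) {{ℚ.nonNegative (0≤x n N≤n)}} y≤0)
      (ℚ.≤-reflexive (ℚ.*-zeroʳ (seq x n)))

-- These are u/(u+1) and (u+1)/u. The pair serves twice: as 1 - r and its inverse in the bound on
-- e^r, and as the bases z and x of the random walk.
[1-τ][1+τ]≐1 : ∀ u .{{_ : ℕ.NonZero u}} → (1# ⊖ τ (suc u)) ⊗ (1# ⊕ τ u) ≐ 1#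
[1-τ][1+τ]≐1 u = ≐-trans
  (ring 3 (λ r t m → (κ 1ℚ ∶- r) ∶* (κ 1ℚ ∶+ t) ∶=
      κ 1ℚ ∶+ (t ∶* (κ 1ℚ ∶- (κ 1ℚ ∶+ m) ∶* r) ∶+ r ∶* (m ∶* t ∶- κ 1ℚ))) ≐-refl r t m)
  (≐-trans (⊕-cong ≐-refl (⊕-cong
     (⊗-cong ≐-refl (⊕-cong ≐-refl (⊝-cong (≐-trans (⊗-cong (≐-sym (ν-suc u)) ≐-refl) (ν⊗τ (suc u))))))
     (⊗-cong ≐-refl (⊕-cong (ν⊗τ u) ≐-refl))))
  (ring 2 (λ r t → κ 1ℚ ∶+ (t ∶* (κ 1ℚ ∶- κ 1ℚ) ∶+ r ∶* (κ 1ℚ ∶- κ 1ℚ)) ∶= κ 1ℚ) ≐-refl r t))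
  where
  r = τ (suc u)
  t = τ u
  m = ν u

τ≼1 : ∀ u .{{_ : ℕ.NonZero u}} → τ u ≼ 1#
τ≼1 u@(suc _) = ν-cancelˡ u (begin
  ν u ⊗ τ u ≈⟨ ν⊗τ u ⟩
  ν 1       ≲⟨ ν-mono {1} {u} (ℕ.s≤s ℕ.z≤n) ⟩
  ν u       ≈⟨ ⊗-identityʳ (ν u) ⟨
  ν u ⊗ 1#  ∎)

IsPositive : ℝ → Set
IsPositive x = Σ[ ε ∈ ℚ ] (0ℚ ℚ.< ε × ι ε ≼ x)

nat-reciprocal : ∀ {x} → IsPositive x → Σ[ k ∈ ℕ ] (1# ≼ ν (suc k) ⊗ x × ν (suc k) ⊗ x ≼ ν 2 ⊕ x)
nat-reciprocal {x} (ε , 0<ε , ε≼x) =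
  let 0<ε/2 = 0<-* 0<ε 0<½
      q , q≼x , x≼q+ε/2 = rational-within x 0<ε/2
      ε≤q+ε/2 = ι-+-cancelʳ-≤ (≼-trans ε≼x x≼q+ε/2)
      -- Precision ε/2 forces q ≥ ε/2, hence x ≤ 2q. An integer N between 1/q and 1/q + 1 then has
      -- Nx ≤ 2 + x.
      ε/2≤q = +-cancelʳ (ε ℚ.* ½) (ε ℚ.* ½) q (subst (ℚ._≤ q ℚ.+ ε ℚ.* ½) (sym (half+half ε)) ε≤q+ε/2)
      0<q = ℚ.<-≤-trans 0<ε/2 ε/2≤q
      x≼q+q = ≼-trans x≼q+ε/2 (≼-trans (ι-mono (ℚ.+-monoʳ-≤ q ε/2≤q)) (≼-reflexive (ι-+ q q)))
      μ , 0<μ , μq≡1 = positive-quotient 1ℚ q (ℚ.positive⁻¹ 1ℚ) 0<q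
      k , μ≤k , k≤μ+1 = rational-ceiling μ (ℚ.<⇒≤ 0<μ)
      μ⊗q≐1 = ≐-trans (≐-sym (ι-* μ q)) (ι-cong μq≡1)
      0≼x = ≼-trans (ι-mono (ℚ.<⇒≤ 0<q)) q≼x
  in k
   , (begin
       1#              ≈⟨ μ⊗q≐1 ⟨
       ι μ ⊗ ι q       ≲⟨ ⊗-mono (ι-mono (ℚ.<⇒≤ 0<μ)) 0≼x (ι-mono μ≤k) q≼x ⟩
       ν (suc k) ⊗ x   ∎)
   , (begin
       ν (suc k) ⊗ x               ≲⟨ ⊗-monoʳ 0≼x (≼-trans (ι-mono k≤μ+1) (≼-reflexive (ι-+ μ 1ℚ))) ⟩
       (ι μ ⊕ 1#) ⊗ x              ≈⟨ ring 2 (λ μ x → (μ ∶+ κ 1ℚ) ∶* x ∶= μ ∶* x ∶+ x) ≐-refl (ι μ) x ⟩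
       ι μ ⊗ x ⊕ x                 ≲⟨ ⊕-mono (⊗-monoˡ (ι-mono (ℚ.<⇒≤ 0<μ)) x≼q+q) ≼-refl ⟩
       ι μ ⊗ (ι q ⊕ ι q) ⊕ x       ≈⟨ ring 3 (λ μ q x → μ ∶* (q ∶+ q) ∶+ x ∶= (κ 1ℚ ∶+ κ 1ℚ) ∶* (μ ∶* q) ∶+ x)
                                        ≐-refl (ι μ) (ι q) x ⟩
       (1# ⊕ 1#) ⊗ (ι μ ⊗ ι q) ⊕ x ≈⟨ ⊕-cong (⊗-cong ≐-refl μ⊗q≐1) ≐-refl ⟩
       (1# ⊕ 1#) ⊗ 1# ⊕ x          ≈⟨ ⊕-cong (ring 0 ((κ 1ℚ ∶+ κ 1ℚ) ∶* κ 1ℚ ∶= κ (+ 2 ℚ./ 1)) ≐-refl) ≐-refl ⟩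
       ν 2 ⊕ x                     ∎)

nat-ceiling : ∀ {x} → IsPositive x → Σ[ k ∈ ℕ ] (x ≼ ν k × ν k ≼ x ⊕ ν 2)
nat-ceiling {x} (ε , 0<ε , ε≼x) =
  let q , q≼x , x≼q+1 = rational-within x {1ℚ} (ℚ.positive⁻¹ 1ℚ)
      0≤q+1 = ι-+-cancelʳ-≤ (≼-trans (ι-mono (ℚ.<⇒≤ 0<ε)) (≼-trans ε≼x x≼q+1))
      k , q+1≤k , k≤q+2 = rational-ceiling (q ℚ.+ 1ℚ) 0≤q+1
  in suc k , ≼-trans x≼q+1 (ι-mono q+1≤k) , (begin
    ν (suc k)            ≲⟨ ι-mono k≤q+2 ⟩
    ι ((q ℚ.+ 1ℚ) ℚ.+ 1ℚ) ≈⟨ ≐-trans (ι-+ _ _) (⊕-cong (ι-+ q 1ℚ) ≐-refl) ⟩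
    (ι q ⊕ 1#) ⊕ 1#      ≈⟨ ring 1 (λ q → (q ∶+ κ 1ℚ) ∶+ κ 1ℚ ∶= q ∶+ κ (+ 2 ℚ./ 1)) ≐-refl (ι q) ⟩
    ι q ⊕ ν 2            ≲⟨ ⊕-mono q≼x ≼-refl ⟩
    x ⊕ ν 2              ∎)

-- From the logarithm to the error exponent L and the spacing B

module _ {δ δ⁻¹ ℓ : ℝ} (0<δ : 0ℝ < δ) (δ<1 : δ < 1ℝ) (δδ⁻¹≃1 : δ * δ⁻¹ ≃ 1ℝ) (ℓ-log : ℓ IsLogOf δ⁻¹) where

  0≼δ : 0# ≼ δ
  0≼δ = let ε , 0<ε , h = <⇒ι≼ 0<δ in begin
    0#         ≲⟨ ι-mono (ℚ.<⇒≤ 0<ε) ⟩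
    ι ε        ≈⟨ ⊕-identityˡ (ι ε) ⟨
    0# ⊕ ι ε   ≈⟨ ⊕-cong (ι≐ 0ℚ) ≐-refl ⟨
    0ℝ ⊕ ι ε   ≲⟨ h ⟩
    δ          ∎

  1≼δδ⁻¹ : 1# ≼ δ ⊗ δ⁻¹
  1≼δδ⁻¹ = begin
    1#      ≈⟨ ι≐ 1ℚ ⟨
    1ℝ      ≲⟨ ≃⇒≽ δδ⁻¹≃1 ⟩
    δ * δ⁻¹ ≈⟨ ⊗≐ δ δ⁻¹ ⟩
    δ ⊗ δ⁻¹ ∎

  -- e^(−m/(u+1)) ≥ (1 − 1/(u+1))^m
  log≼⇒power≼ : ∀ u .{{_ : ℕ.NonZero u}} m → ℓ ≼ ν m ⊗ τ (suc u) → (1# ⊖ τ (suc u)) ↑ m ≼ δ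
  log≼⇒power≼ u m ℓ≼mr = begin
    q ↑ m                   ≈⟨ ⊗-identityʳ (q ↑ m) ⟨
    q ↑ m ⊗ 1#              ≲⟨ ⊗-monoˡ 0≼q^m 1≼δδ⁻¹ ⟩
    q ↑ m ⊗ (δ ⊗ δ⁻¹)       ≲⟨ ⊗-monoˡ 0≼q^m (⊗-monoˡ 0≼δ δ⁻¹≼x^m) ⟩
    q ↑ m ⊗ (δ ⊗ x ↑ m)     ≈⟨ ring 3 (λ q δ x → q ∶* (δ ∶* x) ∶= δ ∶* (q ∶* x)) ≐-refl (q ↑ m) δ (x ↑ m) ⟩
    δ ⊗ (q ↑ m ⊗ x ↑ m)     ≈⟨ ⊗-cong ≐-refl (≐-trans (≐-sym (⊗-↑ q x m))
                                 (≐-trans (↑-cong m ([1-τ][1+τ]≐1 u)) (1↑ m))) ⟩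
    δ ⊗ 1#                  ≈⟨ ⊗-identityʳ δ ⟩
    δ                       ∎
    where
    r = τ (suc u)
    q = 1# ⊖ r
    x = 1# ⊕ τ u
    0≼q^m = 0≼↑ m (0≼-⊖ (τ≼1 (suc u)))
    δ⁻¹≼x^m : δ⁻¹ ≼ x ↑ m
    -- Taking z = mr - ℓ ≥ 0 compares exp ℓ with exp (mr) whatever the sign of ℓ.
    δ⁻¹≼x^m = expOf≼ {z = ν m ⊗ r ⊖ ℓ} ℓ-log (0≼-inverse {δ} {δ⁻¹} 0<δ δδ⁻¹≃1) (0≼-⊖ ℓ≼mr) (λ n → ≼-trans
      (≼-reflexive (Σ≤-cong n (λ k → expTerm-cong k
        (ring 2 (λ s ℓ → (s ∶- ℓ) ∶+ ℓ ∶= s) ≐-refl (ν m ⊗ r) ℓ))))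
      (expSum-multiple m n (0≼τ (suc u)) (0≼-⊕ 0≼1 (0≼τ u)) ([1-τ][1+τ]≐1 u)))

  -- Let δ + ε ≤ 1 and 1 ≤ (j+1)ε. If ℓ ≤ 1/(j+2), then 1 - 1/(j+2) ≤ δ, so ε ≤ 1/(j+2),
  -- contradicting (j+2)ε ≥ 1 + ε. The approximate comparison at this threshold leaves ℓ bounded
  -- below by half of it.
  0<ℓ : IsPositive ℓ
  0<ℓ =
    let ε , 0<ε , δ+ε≼1ℝ = <⇒ι≼ δ<1
        δ+ε≼1 = ≼-trans δ+ε≼1ℝ (≼-reflexive (ι≐ 1ℚ))
        μ , 0<μ , με≡1 = positive-quotient 1ℚ ε (ℚ.positive⁻¹ 1ℚ) 0<ε
        j , μ≤j , _ = rational-ceiling μ (ℚ.<⇒≤ 0<μ)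
        r = + 1 ℚ./ suc (suc j)
        0<r = ℚ.positive⁻¹ r {{ℚ.normalize-pos 1 (suc (suc j))}}
        r/2 = r ℚ.* ½
        r/2<r = subst₂ ℚ._<_ (ℚ.+-identityʳ r/2) (half+half r) (ℚ.+-monoʳ-< r/2 (0<-* 0<r 0<½))
    in r/2 , 0<-* 0<r 0<½ , large ε 0<ε δ+ε≼1 μ με≡1 j μ≤j (≼⊎≽ ℓ r/2<r)
    where
    large : ∀ ε → 0ℚ ℚ.< ε → δ ⊕ ι ε ≼ 1# → ∀ μ → μ ℚ.* ε ≡ 1ℚ → ∀ j → μ ℚ.≤ + suc j ℚ./ 1 →
      let r = + 1 ℚ./ suc (suc j) in (ℓ ≼ ι r) ⊎ (ι (r ℚ.* ½) ≼ ℓ) → ι (r ℚ.* ½) ≼ ℓ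
    large ε 0<ε δ+ε≼1 μ με≡1 j μ≤j (inj₂ r/2≼ℓ) = r/2≼ℓ
    large ε 0<ε δ+ε≼1 μ με≡1 j μ≤j (inj₁ ℓ≼r) = contradiction (ι-+-cancelʳ-≤ 1+ε≼1) (<⇒≱ 1<1+ε)
      where
      r = τ (suc (suc j))
      1<1+ε : 1ℚ ℚ.< 1ℚ ℚ.+ ε
      1<1+ε = subst (ℚ._< 1ℚ ℚ.+ ε) (ℚ.+-identityʳ 1ℚ) (ℚ.+-monoʳ-< 1ℚ 0<ε)
      1-r≼δ : 1# ⊖ r ≼ δ
      1-r≼δ = ≼-trans (≼-reflexive (≐-sym (⊗-identityʳ (1# ⊖ r))))
        (log≼⇒power≼ (suc j) 1 (≼-trans ℓ≼r (≼-reflexive (≐-sym (⊗-identityˡ r)))))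
      ε≼r : ι ε ≼ r
      ε≼r = begin
        ι ε                              ≈⟨ ring 2 (λ ε r → ε ∶= ((κ 1ℚ ∶- r) ∶+ ε) ∶+ (r ∶- κ 1ℚ)) ≐-refl (ι ε) r ⟩
        ((1# ⊖ r) ⊕ ι ε) ⊕ (r ⊖ 1#)      ≲⟨ ⊕-mono (≼-trans (⊕-mono 1-r≼δ ≼-refl) δ+ε≼1) ≼-refl ⟩
        1# ⊕ (r ⊖ 1#)                    ≈⟨ ring 1 (λ r → κ 1ℚ ∶+ (r ∶- κ 1ℚ) ∶= r) ≐-refl r ⟩
        r                                ∎
      1+ε≼1 : ι (1ℚ ℚ.+ ε) ≼ 1#
      1+ε≼1 = begin
        ι (1ℚ ℚ.+ ε)             ≈⟨ ι-+ 1ℚ ε ⟩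
        1# ⊕ ι ε                 ≈⟨ ⊕-cong (≐-trans (≐-sym (ι-cong με≡1)) (ι-* μ ε)) ≐-refl ⟩
        ι μ ⊗ ι ε ⊕ ι ε          ≲⟨ ⊕-mono (⊗-monoʳ (ι-mono (ℚ.<⇒≤ 0<ε)) (ι-mono μ≤j)) ≼-refl ⟩
        ν (suc j) ⊗ ι ε ⊕ ι ε    ≈⟨ ≐-trans (ring 2 (λ k ε → k ∶* ε ∶+ ε ∶= (κ 1ℚ ∶+ k) ∶* ε) ≐-refl (ν (suc j)) (ι ε))
                                      (⊗-cong (≐-sym (ν-suc (suc j))) ≐-refl) ⟩
        ν (suc (suc j)) ⊗ ι ε    ≲⟨ ⊗-monoˡ (0≼ν (suc (suc j))) ε≼r ⟩
        ν (suc (suc j)) ⊗ r      ≈⟨ ν⊗τ (suc (suc j)) ⟩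
        1#                       ∎

  -- 2^(1−L) bounds the error probability of the algorithm that considers one coin in B.
  Adequate : ℕ → ℕ → Set
  Adequate L B = (ν L ≼ ν 26 ⊗ (ν B ⊗ ℓ)) × ((1# ⊖ δ) ⊗ ν B ⊕ (half ↑ L ⊕ half ↑ L) ≼ 1#)

  -- No skipping: B = 1 and L = m + 1 with m ≥ 2ℓ, so that 2 · 2^(-L) = 2^(-m) ≤ δ. Rounding gives L
  -- ≤ 2ℓ + 3, and 3 ≤ 24ℓ because ℓ ≥ 1/8; this is the origin of 26.
  adequate-large : ι (¼ ℚ.* ½) ≼ ℓ → Σ[ L ∈ ℕ ] Σ[ β ∈ ℕ ] Adequate L (suc β)
  adequate-large ⅛≼ℓ =
    let m , 2ℓ≼m , m≼2ℓ+2 = nat-ceiling {ℓ ⊕ ℓ} (¼ , 0<-* 0<½ 0<½ , (begin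
          ι ¼                            ≈⟨ ≐-trans (ι-cong refl) (ι-+ (¼ ℚ.* ½) (¼ ℚ.* ½)) ⟩
          ι (¼ ℚ.* ½) ⊕ ι (¼ ℚ.* ½)      ≲⟨ ⊕-mono ⅛≼ℓ ⅛≼ℓ ⟩
          ℓ ⊕ ℓ                          ∎))
    in suc m , 0 , rate m m≼2ℓ+2 , error m 2ℓ≼m
    where
    rate : ∀ m → ν m ≼ (ℓ ⊕ ℓ) ⊕ ν 2 → ν (suc m) ≼ ν 26 ⊗ (ν 1 ⊗ ℓ)
    rate m h = begin
      ν (suc m)                  ≈⟨ ν-suc m ⟩
      1# ⊕ ν m                   ≲⟨ ⊕-mono ≼-refl h ⟩
      1# ⊕ ((ℓ ⊕ ℓ) ⊕ ν 2)       ≈⟨ ring 1 (λ ℓ → κ 1ℚ ∶+ ((ℓ ∶+ ℓ) ∶+ κ (+ 2 ℚ./ 1)) ∶=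
                                      (ℓ ∶+ ℓ) ∶+ κ (+ 24 ℚ./ 1) ∶* κ (¼ ℚ.* ½)) ≐-refl ℓ ⟩
      (ℓ ⊕ ℓ) ⊕ ν 24 ⊗ ι (¼ ℚ.* ½) ≲⟨ ⊕-mono ≼-refl (⊗-monoˡ (0≼ν 24) ⅛≼ℓ) ⟩
      (ℓ ⊕ ℓ) ⊕ ν 24 ⊗ ℓ         ≈⟨ ring 1 (λ ℓ → (ℓ ∶+ ℓ) ∶+ κ (+ 24 ℚ./ 1) ∶* ℓ ∶=
                                      κ (+ 26 ℚ./ 1) ∶* (κ 1ℚ ∶* ℓ)) ≐-refl ℓ ⟩
      ν 26 ⊗ (ν 1 ⊗ ℓ)           ∎
    error : ∀ m → ℓ ⊕ ℓ ≼ ν m → (1# ⊖ δ) ⊗ ν 1 ⊕ (half ↑ suc m ⊕ half ↑ suc m) ≼ 1#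
    error m h = begin
      (1# ⊖ δ) ⊗ ν 1 ⊕ (half ↑ suc m ⊕ half ↑ suc m)
        ≈⟨ ring 2 (λ δ p → (κ 1ℚ ∶- δ) ∶* κ 1ℚ ∶+ (κ ½ ∶* p ∶+ κ ½ ∶* p) ∶= (κ 1ℚ ∶- δ) ∶+ p) ≐-refl δ (half ↑ m) ⟩
      (1# ⊖ δ) ⊕ half ↑ m
        ≈⟨ ⊕-cong ≐-refl (↑-cong m (ring 0 (κ ½ ∶= κ 1ℚ ∶- κ (+ 1 ℚ./ 2)) ≐-refl)) ⟩
      (1# ⊖ δ) ⊕ (1# ⊖ τ 2) ↑ m
        ≲⟨ ⊕-mono ≼-refl (log≼⇒power≼ 1 m (begin
             ℓ             ≈⟨ ring 1 (λ ℓ → ℓ ∶= (ℓ ∶+ ℓ) ∶* κ (+ 1 ℚ./ 2)) ≐-refl ℓ ⟩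
             (ℓ ⊕ ℓ) ⊗ τ 2 ≲⟨ ⊗-monoʳ (0≼τ 2) h ⟩
             ν m ⊗ τ 2     ∎)) ⟩
      (1# ⊖ δ) ⊕ δ
        ≈⟨ ring 1 (λ δ → (κ 1ℚ ∶- δ) ∶+ δ ∶= κ 1ℚ) ≐-refl δ ⟩
      1# ∎

  -- Here L = 2 makes the walk fail with probability at most ½, and B is about 1/(8ℓ). Rounding
  -- gives 8Bℓ ≤ 2 + 8ℓ ≤ 4, hence ℓ ≤ 1/(2B) and so 1 - δ ≤ 1/(2B).
  adequate-small : ℓ ≼ ι ¼ → Σ[ L ∈ ℕ ] Σ[ β ∈ ℕ ] Adequate L (suc β)
  adequate-small ℓ≼¼ =
    let ε , 0<ε , ε≼ℓ = 0<ℓ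
        0≼ℓ = ≼-trans (ι-mono (ℚ.<⇒≤ 0<ε)) ε≼ℓ
        β , 1≼8Bℓ , 8Bℓ≼ = nat-reciprocal {ν 8 ⊗ ℓ} (ε , 0<ε , (begin
          ι ε     ≲⟨ ε≼ℓ ⟩
          ℓ       ≲⟨ ≼-by (ν 7 ⊗ ℓ) (0≼-⊗ (0≼ν 7) 0≼ℓ)
                       (ring 1 (λ ℓ → ℓ ∶+ κ (+ 7 ℚ./ 1) ∶* ℓ ∶= κ (+ 8 ℚ./ 1) ∶* ℓ) ≐-refl ℓ) ⟩
          ν 8 ⊗ ℓ ∎))
    in 2 , β , rate β 0≼ℓ 1≼8Bℓ , error β 8Bℓ≼
    where
    rate : ∀ β → 0# ≼ ℓ → 1# ≼ ν (suc β) ⊗ (ν 8 ⊗ ℓ) → ν 2 ≼ ν 26 ⊗ (ν (suc β) ⊗ ℓ)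
    rate β 0≼ℓ h = begin
      ν 2                              ≈⟨ ⊗-identityʳ (ν 2) ⟨
      ν 2 ⊗ 1#                         ≲⟨ ⊗-monoˡ (0≼ν 2) h ⟩
      ν 2 ⊗ (ν (suc β) ⊗ (ν 8 ⊗ ℓ))    ≲⟨ ≼-by (ν 10 ⊗ (ν (suc β) ⊗ ℓ)) (0≼-⊗ (0≼ν 10) (0≼-⊗ (0≼ν (suc β)) 0≼ℓ))
                                            (ring 2 (λ b ℓ → κ (+ 2 ℚ./ 1) ∶* (b ∶* (κ (+ 8 ℚ./ 1) ∶* ℓ)) ∶+
                                               κ (+ 10 ℚ./ 1) ∶* (b ∶* ℓ) ∶= κ (+ 26 ℚ./ 1) ∶* (b ∶* ℓ))
                                               ≐-refl (ν (suc β)) ℓ) ⟩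
      ν 26 ⊗ (ν (suc β) ⊗ ℓ)           ∎
    error : ∀ β → ν (suc β) ⊗ (ν 8 ⊗ ℓ) ≼ ν 2 ⊕ ν 8 ⊗ ℓ →
      (1# ⊖ δ) ⊗ ν (suc β) ⊕ (half ↑ 2 ⊕ half ↑ 2) ≼ 1#
    error β h = begin
      (1# ⊖ δ) ⊗ b ⊕ (half ↑ 2 ⊕ half ↑ 2)
        ≲⟨ ⊕-mono (⊗-monoʳ (0≼ν (suc β)) 1-δ≼r) ≼-refl ⟩
      r ⊗ b ⊕ (half ↑ 2 ⊕ half ↑ 2)
        ≈⟨ ring 2 (λ r b → r ∶* b ∶+ (κ ½ ∶* (κ ½ ∶* κ 1ℚ) ∶+ κ ½ ∶* (κ ½ ∶* κ 1ℚ)) ∶=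
             κ ½ ∶* ((b ∶+ b) ∶* r) ∶+ κ ½) ≐-refl r b ⟩
      half ⊗ ((b ⊕ b) ⊗ r) ⊕ half
        ≈⟨ ⊕-cong (⊗-cong ≐-refl (≐-trans (⊗-cong (≐-sym 2B) ≐-refl) (ν⊗τ (suc u)))) ≐-refl ⟩
      half ⊗ 1# ⊕ half
        ≈⟨ ring 0 (κ ½ ∶* κ 1ℚ ∶+ κ ½ ∶= κ 1ℚ) ≐-refl ⟩
      1# ∎
      where
      b = ν (suc β)
      u = suc (β ℕ.+ β)
      r = τ (suc u)
      2B : ν (suc u) ≐ b ⊕ b
      2B = ≐-trans (ι-cong (cong (λ k → + suc k ℚ./ 1) (sym (ℕ.+-suc β β)))) (ν-⊕ (suc β) (suc β))
      2Bℓ≼1 : ν (suc u) ⊗ ℓ ≼ ν (suc u) ⊗ (ν 1 ⊗ r)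
      2Bℓ≼1 = begin
        ν (suc u) ⊗ ℓ             ≈⟨ ⊗-cong 2B ≐-refl ⟩
        (b ⊕ b) ⊗ ℓ               ≈⟨ ring 2 (λ b ℓ → (b ∶+ b) ∶* ℓ ∶= κ ¼ ∶* (b ∶* (κ (+ 8 ℚ./ 1) ∶* ℓ))) ≐-refl b ℓ ⟩
        ι ¼ ⊗ (b ⊗ (ν 8 ⊗ ℓ))     ≲⟨ ⊗-monoˡ (ι-mono (ℚ.<⇒≤ (0<-* 0<½ 0<½)))
                                       (≼-trans h (⊕-mono ≼-refl (⊗-monoˡ (0≼ν 8) ℓ≼¼))) ⟩
        ι ¼ ⊗ (ν 2 ⊕ ν 8 ⊗ ι ¼)   ≈⟨ ring 0 (κ ¼ ∶* (κ (+ 2 ℚ./ 1) ∶+ κ (+ 8 ℚ./ 1) ∶* κ ¼) ∶= κ 1ℚ) ≐-refl ⟩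
        1#                        ≈⟨ ν⊗τ (suc u) ⟨
        ν (suc u) ⊗ r             ≈⟨ ⊗-cong ≐-refl (⊗-identityˡ r) ⟨
        ν (suc u) ⊗ (ν 1 ⊗ r)     ∎
      1-δ≼r : 1# ⊖ δ ≼ r
      1-δ≼r = begin
        1# ⊖ δ                ≈⟨ ring 2 (λ δ r → κ 1ℚ ∶- δ ∶= ((κ 1ℚ ∶- r) ∶* κ 1ℚ) ∶+ (r ∶- δ)) ≐-refl δ r ⟩
        (1# ⊖ r) ↑ 1 ⊕ (r ⊖ δ) ≲⟨ ⊕-mono (log≼⇒power≼ u 1 (ν-cancelˡ (suc u) 2Bℓ≼1)) ≼-refl ⟩
        δ ⊕ (r ⊖ δ)           ≈⟨ ring 2 (λ δ r → δ ∶+ (r ∶- δ) ∶= r) ≐-refl δ r ⟩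
        r                     ∎

  adequate : Σ[ L ∈ ℕ ] Σ[ β ∈ ℕ ] Adequate L (suc β)
  adequate = split (≼⊎≽ ℓ ⅛<¼)
    where
    ⅛<¼ : ¼ ℚ.* ½ ℚ.< ¼
    ⅛<¼ = ℚ.*<* (+<+ (ℕ.s≤s (ℕ.s≤s (ℕ.s≤s (ℕ.s≤s (ℕ.s≤s ℕ.z≤n))))))
    split : (ℓ ≼ ι ¼) ⊎ (ι (¼ ℚ.* ½) ≼ ℓ) → Σ[ L ∈ ℕ ] Σ[ β ∈ ℕ ] Adequate L (suc β)
    split (inj₁ ℓ≼¼) = adequate-small ℓ≼¼
    split (inj₂ ⅛≼ℓ) = adequate-large ⅛≼ℓ

-- Expectations

E : ∀ {A : Set} → Dist A → (A → ℝ) → ℝ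
E []            f = 0#
E ((w , a) ∷ d) f = w ⊗ f a ⊕ E d f

E-++ : ∀ {A : Set} (d d′ : Dist A) f → E (d ++ d′) f ≐ E d f ⊕ E d′ f
E-++ []            d′ f = ≐-sym (⊕-identityˡ _)
E-++ ((w , a) ∷ d) d′ f = ≐-trans (⊕-cong ≐-refl (E-++ d d′ f)) (≐-sym (⊕-assoc _ _ _))

E-scale : ∀ {A : Set} w (d : Dist A) f → E (map (map₁ (w *_)) d) f ≐ w ⊗ E d f
E-scale w []            f = ring 1 (λ w → κ 0ℚ ∶= w ∶* κ 0ℚ) ≐-refl w
E-scale w ((v , a) ∷ d) f = ≐-trans (⊕-cong (⊗-cong (⊗≐ w v) ≐-refl) (E-scale w d f))
  (ring 4 (λ w v x s → (w ∶* v) ∶* x ∶+ w ∶* s ∶= w ∶* (v ∶* x ∶+ s)) ≐-refl w v (f a) (E d f))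

E->>= : ∀ {A B : Set} (d : Dist A) (g : A → Dist B) f → E (d >>= g) f ≐ E d (λ a → E (g a) f)
E->>= []            g f = ≐-refl
E->>= ((w , a) ∷ d) g f = ≐-trans (E-++ (map (map₁ (w *_)) (g a)) (d >>= g) f)
  (⊕-cong (E-scale w (g a) f) (E->>= d g f))

E-pure : ∀ {A : Set} (a : A) f → E (pure a) f ≐ f a
E-pure a f = ≐-trans (⊕-cong (⊗-cong (ι≐ 1ℚ) ≐-refl) ≐-refl)
  (ring 1 (λ x → κ 1ℚ ∶* x ∶+ κ 0ℚ ∶= x) ≐-refl (f a))

mix : ℝ → ℝ → ℝ → ℝ
mix p x y = p ⊗ x ⊕ (1# ⊖ p) ⊗ y

mix-mono : ∀ {p x x′ y y′} → 0# ≼ p → p ≼ 1# → x ≼ x′ → y ≼ y′ → mix p x y ≼ mix p x′ y′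
mix-mono 0≼p p≼1 x≼x′ y≼y′ = ⊕-mono (⊗-monoˡ 0≼p x≼x′) (⊗-monoˡ (0≼-⊖ p≼1) y≼y′)

E-bernoulli : ∀ {A : Set} p (g : Bool → Dist A) f →
  E (bernoulli p >>= g) f ≐ mix p (E (g true) f) (E (g false) f)
E-bernoulli p g f = ≐-trans (E->>= (bernoulli p) g f)
  (⊕-cong ≐-refl (≐-trans (⊕-cong (⊗-cong (+-as-⊕ 1ℝ (- p) (ι≐ 1ℚ) (⊝≐ p)) ≐-refl) ≐-refl)
    (ring 1 (λ x → x ∶+ κ 0ℚ ∶= x) ≐-refl _)))

0≼E-weighted : ∀ {A : Set} w (as : List A) f → 0# ≼ w → (∀ a → 0# ≼ f a) →
  0# ≼ E (map (λ a → w , a) as) f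
0≼E-weighted w []       f 0≼w 0≼f = ≼-refl
0≼E-weighted w (a ∷ as) f 0≼w 0≼f = 0≼-⊕ (0≼-⊗ 0≼w (0≼f a)) (0≼E-weighted w as f 0≼w 0≼f)

E-weighted-∈ : ∀ {A : Set} w {as : List A} f → 0# ≼ w → (∀ a → 0# ≼ f a) → ∀ {a} → a ∈ as →
  w ⊗ f a ≼ E (map (λ a → w , a) as) f
E-weighted-∈ w {a ∷ as} f 0≼w 0≼f (here refl) = ≼-by _ (0≼E-weighted w as f 0≼w 0≼f) ≐-refl
E-weighted-∈ w {a ∷ as} f 0≼w 0≼f (there a∈as) = ≼-trans (E-weighted-∈ w f 0≼w 0≼f a∈as)
  (≼-by _ (0≼-⊗ 0≼w (0≼f a)) (⊕-comm _ _))

0≼weight : ∀ j → 0# ≼ fromℚ (+ 1 ℚ./ suc j)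
0≼weight j = ≼-trans (0≼τ (suc j)) (≼-reflexive (≐-sym (ι≐ _)))

0≼E-uniform : ∀ {A : Set} j (g : Fin (suc j) → Dist A) f → (∀ i → 0# ≼ E (g i) f) →
  0# ≼ E (uniform j >>= g) f
0≼E-uniform j g f h = ≼-trans
  (0≼E-weighted _ (allFin (suc j)) (λ i → E (g i) f) (0≼weight j) h)
  (≼-reflexive (≐-sym (E->>= (uniform j) g f)))

E-uniform-≥ : ∀ {A : Set} j (g : Fin (suc j) → Dist A) f → (∀ i → 0# ≼ E (g i) f) → ∀ i →
  τ (suc j) ⊗ E (g i) f ≼ E (uniform j >>= g) f
E-uniform-≥ j g f h i = ≼-trans (≼-reflexive (⊗-cong (≐-sym (ι≐ _)) ≐-refl))
  (≼-trans (E-weighted-∈ _ (λ i → E (g i) f) (0≼weight j) h (∈-allFin i))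
    (≼-reflexive (≐-sym (E->>= (uniform j) g f))))

indicator : ∀ {A : Set} {P : A → Set} → Decidable P → A → ℝ
indicator P? a = if does (P? a) then 1# else 0#

totalWeight : ∀ {A : Set} → Dist A → ℝ
totalWeight d = sum (map proj₁ d)

totalWeight-∷ : ∀ {A : Set} w (a : A) d {s} → totalWeight d ≐ s → totalWeight ((w , a) ∷ d) ≐ w ⊕ s
totalWeight-∷ w a d e = +-as-⊕ w (totalWeight d) ≐-refl e

Pr≐E : ∀ {A : Set} {P : A → Set} (d : Dist A) (P? : Decidable P) → Pr d P? ≐ E d (indicator P?)
Pr≐E []            P? = ι≐ 0ℚ
Pr≐E {A} {P} ((w , a) ∷ d) P? = by-cases (P? a)
  where
  Q? = P? ∘ proj₂
  rewriting : ∀ {d d′ : Dist A} {v} → d ≡ d′ → totalWeight d′ ≐ v → totalWeight d ≐ v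
  rewriting refl e = e
  weighted : ∀ {b c} → b ≡ c → w ⊗ (if c then 1# else 0#) ⊕ E d (indicator P?) ≐
                               w ⊗ (if b then 1# else 0#) ⊕ E d (indicator P?)
  weighted refl = ≐-refl
  by-cases : Dec (P a) → totalWeight (filter Q? ((w , a) ∷ d)) ≐ w ⊗ indicator P? a ⊕ E d (indicator P?)
  by-cases (yes pa) = rewriting (List.filter-accept Q? pa)
    (≐-trans (totalWeight-∷ w a (filter Q? d) (Pr≐E d P?))
    (≐-trans (⊕-cong (≐-sym (⊗-identityʳ w)) ≐-refl) (weighted (dec-true (P? a) pa))))
  by-cases (no ¬pa) = rewriting (List.filter-reject Q? ¬pa) (≐-trans (Pr≐E d P?)
    (≐-trans (ring 2 (λ w s → s ∶= w ∶* κ 0ℚ ∶+ s) ≐-refl w (E d (indicator P?)))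
      (weighted (dec-false (P? a) ¬pa))))

-- The algorithm and its success probability

module Algorithm (h S₀ b β : ℕ) where

  -- The number of coins to skip and the budget of the stored coin; nothing before the first arrival.
  State : Set
  State = Maybe (ℕ × ℕ)

  -- Tosses happen only at positive distance, so the argument is the distance minus one while the
  -- result is the new distance itself. The first toss is the king's.
  advance : Bool → Bool → ℕ → ℕ
  advance true  true  w = suc w
  advance true  false w = w
  advance false true  w = suc (suc w)
  advance false false w = suc w

  challenge : ℕ → ℕ → Program 1 (λ _ → State) arrival 1
  -- Distance 0 takes precedence over an empty budget: a king who has just beaten the challenger
  -- stays, even with nothing left.
  challenge zero    S       = return (just (β , S))
  -- The budget has run out at positive distance, so the challenger takes over with a fresh budget.
  -- The old king is discarded first, since there is room for one coin only.
  challenge (suc w) zero    = discard zero (store (ℕ.s≤s ℕ.z≤n) (return (just (β , S₀))))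
  challenge (suc w) (suc S) =
    tossStored zero λ king → tossArriving λ new → challenge (advance king new w) S

  visit : ℕ → ℕ → ∀ k → Program 1 (λ _ → State) arrival k
  visit (suc c) S k             = return (just (c , S))
  visit zero    S 0             = store (ℕ.s≤s ℕ.z≤n) (return (just (β , S₀)))
  visit zero    S 1             = challenge h (S ℕ.+ b)
  -- A default for a case that cannot arise: `store` never lets a second coin in.
  visit zero    S (suc (suc k)) = return nothing

  algorithm : StreamingAlgorithm 1
  algorithm = record
    { State = State
    ; start = nothing
    ; step = step
    ; finish = finish }
    where
    step : State → ∀ k → Program 1 (λ _ → State) arrival k
    -- `start` is a fixed state, so the random offset is drawn when the first coin arrives.
    step nothing        k = random β (λ j → visit (toℕ j) 0 k)
    step (just (c , S)) k = visit c S k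
    finish : State → ∀ k → Program 1 (λ k → Maybe (Fin k)) ended k
    finish _ zero    = return nothing
    finish _ (suc k) = return (just zero)

  open StreamingAlgorithm algorithm using (start; step; finish)

  module _ {n : ℕ} (p : Fin n → ℝ) (0≼p : ∀ i → 0# ≼ p i) (p≼1 : ∀ i → p i ≼ 1#) where

    0≼E-run : ∀ {m R φ k} (c : Arriving φ n) t (M : Vec (Fin n) k) (P : Program m R φ k) F →
      (∀ o → 0# ≼ F o) → 0# ≼ E (run p c t M P) F
    0≼E-bernoulli : ∀ {A : Set} i (g : Bool → Dist A) F → (∀ x → 0# ≼ E (g x) F) →
      0# ≼ E (bernoulli (p i) >>= g) F
    0≼E-bernoulli i g F h = ≼-trans
      (0≼-⊕ (0≼-⊗ (0≼p i) (h true)) (0≼-⊗ (0≼-⊖ (p≼1 i)) (h false)))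
      (≼-reflexive (≐-sym (E-bernoulli (p i) g F)))
    0≼E-run c t M (return r)       F h = ≼-trans (h _) (≼-reflexive (≐-sym (E-pure _ F)))
    0≼E-run c t M (random j f)     F h =
      0≼E-uniform j (λ i → run p c t M (f i)) F (λ i → 0≼E-run c t M (f i) F h)
    0≼E-run c t M (tossArriving f) F h =
      0≼E-bernoulli c (λ x → run p c (suc t) M (f x)) F (λ x → 0≼E-run c (suc t) M (f x) F h)
    0≼E-run c t M (tossStored i f) F h =
      0≼E-bernoulli (lookup M i) (λ x → run p c (suc t) M (f x)) F (λ x → 0≼E-run c (suc t) M (f x) F h)
    0≼E-run c t M (store _ P)      F h = 0≼E-run c t (c ∷ M) P F h
    0≼E-run c t M (discard i P)    F h = 0≼E-run c t _ P F h

    -- Optional stopping by induction on the budget: a function below F at both exits and below its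
    -- own average over one round is below the expectation of F. The potential φ is left open
    -- because it differs according to whether the best coin is king, challenger or still to come.
    challenge-≥ : ∀ (king i : Fin n) F (φ : ℕ → ℕ → ℝ) →
      (∀ t S → φ 0 S ≼ F (outcome t (king ∷ []) (just (β , S)))) →
      (∀ t w → φ (suc w) 0 ≼ F (outcome t (i ∷ []) (just (β , S₀)))) →
      (∀ w S → φ (suc w) (suc S) ≼ mix (p king) (mix (p i) (φ (suc w) S) (φ w S))
                                                (mix (p i) (φ (suc (suc w)) S) (φ (suc w) S))) →
      ∀ w S t → φ w S ≼ E (run p i t (king ∷ []) (challenge w S)) F
    challenge-≥ king i F φ stay swap toss zero    S       t =
      ≼-trans (stay t S) (≼-reflexive (≐-sym (E-pure _ F)))
    challenge-≥ king i F φ stay swap toss (suc w) zero    t =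
      ≼-trans (swap t w) (≼-reflexive (≐-sym (E-pure _ F)))
    challenge-≥ king i F φ stay swap toss (suc w) (suc S) t = begin
      φ (suc w) (suc S)
        ≲⟨ toss w S ⟩
      mix (p king) (mix (p i) (φ (suc w) S) (φ w S)) (mix (p i) (φ (suc (suc w)) S) (φ (suc w) S))
        ≲⟨ mix-mono (0≼p king) (p≼1 king)
             (mix-mono (0≼p i) (p≼1 i) (IH (suc w)) (IH w))
             (mix-mono (0≼p i) (p≼1 i) (IH (suc (suc w))) (IH (suc w))) ⟩
      mix (p king) (mix (p i) (after true true) (after true false))
                   (mix (p i) (after false true) (after false false))
        ≈⟨ ⊕-cong (⊗-cong ≐-refl (E-bernoulli (p i) (outcomes true) F))
                  (⊗-cong ≐-refl (E-bernoulli (p i) (outcomes false) F)) ⟨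
      mix (p king) (E (bernoulli (p i) >>= outcomes true) F)
                   (E (bernoulli (p i) >>= outcomes false) F)
        ≈⟨ E-bernoulli (p king) (λ x → bernoulli (p i) >>= outcomes x) F ⟨
      E (run p i t (king ∷ []) (challenge (suc w) (suc S))) F ∎
      where
      outcomes : Bool → Bool → Dist (Outcome n (λ _ → State))
      outcomes x y = run p i (suc (suc t)) (king ∷ []) (challenge (advance x y w) S)
      after : Bool → Bool → ℝ
      after x y = E (outcomes x y) F
      IH : ∀ w → φ w S ≼ E (run p i (suc (suc t)) (king ∷ []) (challenge w S)) F
      IH w = challenge-≥ king i F φ stay swap toss w S (suc (suc t))

split-at : ∀ {A : Set} {a : A} {as} → Unique as → a ∈ as →
  Σ[ xs ∈ List A ] Σ[ ys ∈ List A ] (as ≡ xs ++ a ∷ ys × All (_≢ a) xs × All (_≢ a) ys)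
split-at (a≢as ∷ _) (here refl) = [] , _ , refl , [] , All.map (λ a≢x x≡a → a≢x (sym x≡a)) a≢as
split-at (x≢as ∷ as!) (there a∈as) =
  let xs , ys , eq , xs≢a , ys≢a = split-at as! a∈as
  in _ ∷ xs , ys , cong (_ ∷_) eq , All.lookup x≢as a∈as ∷ xs≢a , ys≢a

-- Drift of the walk in one round

1≼1+t : ∀ {t} → 0# ≼ t → 1# ≼ 1# ⊕ t
1≼1+t 0≼t = ≼-by _ 0≼t ≐-refl

1≼↑ : ∀ {x} n → 1# ≼ x → 1# ≼ x ↑ n
1≼↑ n 1≼x = ≼-trans (≼-reflexive (≐-sym (1↑ n))) (↑-mono n 0≼1 1≼x)

↑≼1 : ∀ {x} n → 0# ≼ x → x ≼ 1# → x ↑ n ≼ 1#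
↑≼1 n 0≼x x≼1 = ≼-trans (↑-mono n 0≼x x≼1) (≼-reflexive (1↑ n))

⊖-monoʳ : ∀ x {y z} → y ≼ z → x ⊖ z ≼ x ⊖ y
⊖-monoʳ x {y} {z} y≼z = ≼-by (z ⊖ y) (0≼-⊖ y≼z)
  (ring 3 (λ x y z → (x ∶- z) ∶+ (z ∶- y) ∶= x ∶- y) ≐-refl x y z)

⊖-≼ : ∀ x {y} → 0# ≼ y → x ⊖ y ≼ x
⊖-≼ x {y} 0≼y = ≼-by y 0≼y (ring 2 (λ x y → (x ∶- y) ∶+ y ∶= x) ≐-refl x y)

module Walk (u : ℕ) .{{_ : ℕ.NonZero u}} where

  -- The step t is half of the gap that `contraction` demands. The base z is 1/x, so rescaling by z²
  -- turns the estimate for the best coin as king into the one for it as challenger, where y is only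
  -- needed as y ≤ 1.
  t x y z : ℝ
  t = τ u
  x = 1# ⊕ t
  y = 1# ⊖ half ⊗ (t ⊗ t)
  z = 1# ⊖ τ (suc u)

  0≼t : 0# ≼ t
  0≼t = 0≼τ u

  t≼1 : t ≼ 1#
  t≼1 = τ≼1 u

  1≼x : 1# ≼ x
  1≼x = 1≼1+t 0≼t

  0≼x : 0# ≼ x
  0≼x = ≼-trans 0≼1 1≼x

  zx≐1 : z ⊗ x ≐ 1#
  zx≐1 = [1-τ][1+τ]≐1 u

  0≼z : 0# ≼ z
  0≼z = 0≼-⊖ (τ≼1 (suc u))

  0≼½t² : 0# ≼ half ⊗ (t ⊗ t)
  0≼½t² = 0≼-⊗ 0≼half (0≼-⊗ 0≼t 0≼t)

  ½t²≼1 : half ⊗ (t ⊗ t) ≼ 1#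
  ½t²≼1 = begin
    half ⊗ (t ⊗ t)   ≲⟨ ⊗-mono 0≼half (0≼-⊗ 0≼1 0≼1) (≼-by half 0≼half (ring 0 (κ ½ ∶+ κ ½ ∶= κ 1ℚ) ≐-refl))
                          (⊗-mono 0≼t 0≼1 t≼1 t≼1) ⟩
    1# ⊗ (1# ⊗ 1#)   ≈⟨ ring 0 (κ 1ℚ ∶* (κ 1ℚ ∶* κ 1ℚ) ∶= κ 1ℚ) ≐-refl ⟩
    1#               ∎

  0≼y : 0# ≼ y
  0≼y = 0≼-⊖ ½t²≼1

  y≼1 : y ≼ 1#
  y≼1 = ⊖-≼ 1# 0≼½t²

  -- With biases q ≥ p + 2t, one round multiplies x^distance by y in expectation.
  contraction : ∀ {p q} → 0# ≼ p → p ≼ 1# → 0# ≼ q → q ≼ 1# → t ⊕ t ≼ q ⊖ p →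
    (q ⊕ (1# ⊖ q) ⊗ x) ⊗ (p ⊗ x ⊕ (1# ⊖ p)) ≼ x ⊗ y
  contraction {p} {q} 0≼p p≼1 0≼q q≼1 gap = ≼-by
    -- The left side is (1 + (1-q)t)(1 + pt). Its distance to xy is t times the excess of q - p over
    -- 2t, plus t² times ½(1-t) + (1-p) + qp; every summand is nonnegative.
    (t ⊗ ((q ⊖ p) ⊖ (t ⊕ t)) ⊕
      (t ⊗ t ⊗ (half ⊗ (1# ⊖ t)) ⊕ t ⊗ t ⊗ ((1# ⊖ p) ⊕ q ⊗ p)))
    (0≼-⊕ (0≼-⊗ 0≼t (0≼-⊖ gap))
      (0≼-⊕ (0≼-⊗ (0≼-⊗ 0≼t 0≼t) (0≼-⊗ 0≼half (0≼-⊖ t≼1)))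
        (0≼-⊗ (0≼-⊗ 0≼t 0≼t) (0≼-⊕ (0≼-⊖ p≼1) (0≼-⊗ 0≼q 0≼p)))))
    (ring 3 (λ p q t →
      let x = κ 1ℚ ∶+ t in
      ((q ∶+ (κ 1ℚ ∶- q) ∶* x) ∶* (p ∶* x ∶+ (κ 1ℚ ∶- p))) ∶+
      (t ∶* ((q ∶- p) ∶- (t ∶+ t)) ∶+
        (t ∶* t ∶* (κ ½ ∶* (κ 1ℚ ∶- t)) ∶+ t ∶* t ∶* ((κ 1ℚ ∶- p) ∶+ q ∶* p)))
      ∶= x ∶* (κ 1ℚ ∶- κ ½ ∶* (t ∶* t))) ≐-refl p q t)

  king-round : ∀ {p q} → 0# ≼ p → p ≼ 1# → 0# ≼ q → q ≼ 1# → t ⊕ t ≼ q ⊖ p → ∀ w S →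
    1# ⊖ x ↑ suc w ⊗ y ↑ suc S ≼
      mix q (mix p (1# ⊖ x ↑ suc w ⊗ y ↑ S) (1# ⊖ x ↑ w ⊗ y ↑ S))
            (mix p (1# ⊖ x ↑ suc (suc w) ⊗ y ↑ S) (1# ⊖ x ↑ suc w ⊗ y ↑ S))
  king-round {p} {q} 0≼p p≼1 0≼q q≼1 gap w S = begin
    1# ⊖ x ↑ suc w ⊗ y ↑ suc S
      ≈⟨ ring 4 (λ x y X Y → κ 1ℚ ∶- (x ∶* X) ∶* (y ∶* Y) ∶= κ 1ℚ ∶- (X ∶* Y) ∶* (x ∶* y)) ≐-refl
           x y (x ↑ w) (y ↑ S) ⟩
    1# ⊖ (x ↑ w ⊗ y ↑ S) ⊗ (x ⊗ y)
      ≲⟨ ⊖-monoʳ 1# (⊗-monoˡ (0≼-⊗ (0≼↑ w 0≼x) (0≼↑ S 0≼y)) (contraction 0≼p p≼1 0≼q q≼1 gap)) ⟩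
    1# ⊖ (x ↑ w ⊗ y ↑ S) ⊗ ((q ⊕ (1# ⊖ q) ⊗ x) ⊗ (p ⊗ x ⊕ (1# ⊖ p)))
      ≈⟨ ring 5 (λ p q x X Y →
           κ 1ℚ ∶- (X ∶* Y) ∶* ((q ∶+ (κ 1ℚ ∶- q) ∶* x) ∶* (p ∶* x ∶+ (κ 1ℚ ∶- p))) ∶=
           q ∶* (p ∶* (κ 1ℚ ∶- (x ∶* X) ∶* Y) ∶+ (κ 1ℚ ∶- p) ∶* (κ 1ℚ ∶- X ∶* Y)) ∶+
           (κ 1ℚ ∶- q) ∶* (p ∶* (κ 1ℚ ∶- (x ∶* (x ∶* X)) ∶* Y) ∶+
                           (κ 1ℚ ∶- p) ∶* (κ 1ℚ ∶- (x ∶* X) ∶* Y))) ≐-refl p q x (x ↑ w) (y ↑ S) ⟩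
    mix q (mix p (1# ⊖ x ↑ suc w ⊗ y ↑ S) (1# ⊖ x ↑ w ⊗ y ↑ S))
          (mix p (1# ⊖ x ↑ suc (suc w) ⊗ y ↑ S) (1# ⊖ x ↑ suc w ⊗ y ↑ S)) ∎

  challenger-round : ∀ {p q} → 0# ≼ p → p ≼ 1# → 0# ≼ q → q ≼ 1# → t ⊕ t ≼ q ⊖ p → ∀ a w →
    a ⊖ z ↑ suc w ≼
      mix p (mix q (a ⊖ z ↑ suc w) (a ⊖ z ↑ w)) (mix q (a ⊖ z ↑ suc (suc w)) (a ⊖ z ↑ suc w))
  challenger-round {p} {q} 0≼p p≼1 0≼q q≼1 gap a w = begin
    a ⊖ z ⊗ z ↑ w
      ≲⟨ ⊖-monoʳ a (⊗-monoʳ (0≼↑ w 0≼z) bracket≼z) ⟩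
    a ⊖ ((p ⊕ (1# ⊖ p) ⊗ z) ⊗ (q ⊗ z ⊕ (1# ⊖ q))) ⊗ z ↑ w
      ≈⟨ ring 5 (λ p q a z Z →
           a ∶- ((p ∶+ (κ 1ℚ ∶- p) ∶* z) ∶* (q ∶* z ∶+ (κ 1ℚ ∶- q))) ∶* Z ∶=
           p ∶* (q ∶* (a ∶- z ∶* Z) ∶+ (κ 1ℚ ∶- q) ∶* (a ∶- Z)) ∶+
           (κ 1ℚ ∶- p) ∶* (q ∶* (a ∶- z ∶* (z ∶* Z)) ∶+ (κ 1ℚ ∶- q) ∶* (a ∶- z ∶* Z))) ≐-refl p q a z (z ↑ w) ⟩
    mix p (mix q (a ⊖ z ↑ suc w) (a ⊖ z ↑ w)) (mix q (a ⊖ z ↑ suc (suc w)) (a ⊖ z ↑ suc w)) ∎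
    where
    1≐zx : 1# ≐ z ⊗ x
    1≐zx = ≐-sym zx≐1
    bracket≼z : (p ⊕ (1# ⊖ p) ⊗ z) ⊗ (q ⊗ z ⊕ (1# ⊖ q)) ≼ z
    bracket≼z = begin
      (p ⊕ (1# ⊖ p) ⊗ z) ⊗ (q ⊗ z ⊕ (1# ⊖ q))
        ≈⟨ ring 3 (λ p q z → (p ∶+ (κ 1ℚ ∶- p) ∶* z) ∶* (q ∶* z ∶+ (κ 1ℚ ∶- q)) ∶=
             (p ∶* κ 1ℚ ∶+ (κ 1ℚ ∶- p) ∶* z) ∶* (q ∶* z ∶+ (κ 1ℚ ∶- q) ∶* κ 1ℚ)) ≐-refl p q z ⟩
      (p ⊗ 1# ⊕ (1# ⊖ p) ⊗ z) ⊗ (q ⊗ z ⊕ (1# ⊖ q) ⊗ 1#)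
        ≈⟨ ⊗-cong (⊕-cong (⊗-cong ≐-refl 1≐zx) ≐-refl) (⊕-cong ≐-refl (⊗-cong ≐-refl 1≐zx)) ⟩
      (p ⊗ (z ⊗ x) ⊕ (1# ⊖ p) ⊗ z) ⊗ (q ⊗ z ⊕ (1# ⊖ q) ⊗ (z ⊗ x))
        ≈⟨ ring 4 (λ p q z x →
             (p ∶* (z ∶* x) ∶+ (κ 1ℚ ∶- p) ∶* z) ∶* (q ∶* z ∶+ (κ 1ℚ ∶- q) ∶* (z ∶* x)) ∶=
             (z ∶* z) ∶* ((q ∶+ (κ 1ℚ ∶- q) ∶* x) ∶* (p ∶* x ∶+ (κ 1ℚ ∶- p)))) ≐-refl p q z x ⟩
      (z ⊗ z) ⊗ ((q ⊕ (1# ⊖ q) ⊗ x) ⊗ (p ⊗ x ⊕ (1# ⊖ p)))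
        ≲⟨ ⊗-monoˡ (0≼-⊗ 0≼z 0≼z) (contraction 0≼p p≼1 0≼q q≼1 gap) ⟩
      (z ⊗ z) ⊗ (x ⊗ y)
        ≲⟨ ⊗-monoˡ (0≼-⊗ 0≼z 0≼z) (⊗-monoˡ 0≼x y≼1) ⟩
      (z ⊗ z) ⊗ (x ⊗ 1#)
        ≈⟨ ring 2 (λ z x → (z ∶* z) ∶* (x ∶* κ 1ℚ) ∶= z ∶* (z ∶* x)) ≐-refl z x ⟩
      z ⊗ (z ⊗ x)
        ≈⟨ ⊗-cong ≐-refl zx≐1 ⟩
      z ⊗ 1#
        ≈⟨ ⊗-identityʳ z ⟩
      z ∎

-- Success probability along the stream

module Success (u : ℕ) .{{_ : ℕ.NonZero u}} (h S₀ b β : ℕ)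
  (budget-suffices : Walk.x u ↑ h ⊗ Walk.y u ↑ b ≼ 1#)
  {n : ℕ} (p : Fin n → ℝ) (0≼p : ∀ i → 0# ≼ p i) (p≼1 : ∀ i → p i ≼ 1#)
  (best : Fin n) (gap : ∀ i → i ≢ best → Walk.t u ⊕ Walk.t u ≼ p best ⊖ p i) where

  open Walk u
  open Algorithm h S₀ b β
  open StreamingAlgorithm algorithm using (start; step; finish)

  win : Outcome n (λ k → Maybe (Fin k)) → ℝ
  win = indicator (λ o → output o ≟ just best)

  0≼win : ∀ o → 0# ≼ win o
  0≼win o = 0≼if (does (output o ≟ just best))
    where
    0≼if : ∀ c → 0# ≼ (if c then 1# else 0#)
    0≼if true  = 0≼1
    0≼if false = ≼-refl

  conclude : Outcome n (λ _ → State) → Dist (Outcome n (λ k → Maybe (Fin k)))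
  conclude o = run p tt (tosses o) (memory o) (finish (result o) (stored o))

  winProb : List (Fin n) → Outcome n (λ _ → State) → ℝ
  winProb cs o = E (arrivals p algorithm cs o) (λ o′ → E (conclude o′) win)

  winProb-[] : ∀ o → winProb [] o ≐ E (conclude o) win
  winProb-[] o = E-pure o (λ o′ → E (conclude o′) win)

  winProb-∷ : ∀ c cs o → winProb (c ∷ cs) o ≐
    E (run p c (tosses o) (memory o) (step (result o) (stored o))) (winProb cs)
  winProb-∷ c cs o = E->>= (run p c (tosses o) (memory o) (step (result o) (stored o)))
    (arrivals p algorithm cs) (λ o′ → E (conclude o′) win)

  0≼winProb : ∀ cs o → 0# ≼ winProb cs o
  0≼winProb [] o = ≼-trans (0≼E-run p 0≼p p≼1 tt (tosses o) (memory o) (finish (result o) (stored o)) win 0≼win)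
    (≼-reflexive (≐-sym (winProb-[] o)))
  0≼winProb (c ∷ cs) o = ≼-trans
    (0≼E-run p 0≼p p≼1 c (tosses o) (memory o) (step (result o) (stored o)) (winProb cs) (0≼winProb cs))
    (≼-reflexive (≐-sym (winProb-∷ c cs o)))

  winProb-skip : ∀ c cs t {k} (M : Vec (Fin n) k) d S →
    winProb cs (outcome t M (just (d , S))) ≼ winProb (c ∷ cs) (outcome t M (just (suc d , S)))
  winProb-skip c cs t M d S = ≼-reflexive (≐-trans
    (≐-sym (E-pure (outcome t M (just (d , S))) (winProb cs)))
    (≐-sym (winProb-∷ c cs (outcome t M (just (suc d , S))))))

  winProb-store : ∀ c cs t S →
    winProb cs (outcome t (c ∷ []) (just (β , S₀))) ≼ winProb (c ∷ cs) (outcome t [] (just (0 , S)))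
  winProb-store c cs t S = ≼-reflexive (≐-trans
    (≐-sym (E-pure (outcome t (c ∷ []) (just (β , S₀))) (winProb cs)))
    (≐-sym (winProb-∷ c cs (outcome t [] (just (0 , S))))))

  winProb-challenge : ∀ {v} king c cs t S →
    v ≼ E (run p c t (king ∷ []) (challenge h (S ℕ.+ b))) (winProb cs) →
    v ≼ winProb (c ∷ cs) (outcome t (king ∷ []) (just (0 , S)))
  winProb-challenge king c cs t S h = ≼-trans h
    (≼-reflexive (≐-sym (winProb-∷ c cs (outcome t (king ∷ []) (just (0 , S))))))

  -- The bound depends on the remaining budget but not on the number of coins to come: the grant of
  -- b compensates the factor x^h of a new challenge, so no loss accumulates.
  king-best : ∀ cs → All (_≢ best) cs → ∀ t c S →
    1# ⊖ y ↑ S ≼ winProb cs (outcome t (best ∷ []) (just (c , S)))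
  king-best [] [] t c S = begin
    1# ⊖ y ↑ S  ≲⟨ ⊖-≼ 1# (0≼↑ S 0≼y) ⟩
    1#          ≈⟨ won ⟨
    win final   ≈⟨ E-pure final win ⟨
    E (conclude (outcome t (best ∷ []) (just (c , S)))) win
                ≈⟨ winProb-[] (outcome t (best ∷ []) (just (c , S))) ⟨
    winProb [] (outcome t (best ∷ []) (just (c , S))) ∎
    where
    final : Outcome n (λ k → Maybe (Fin k))
    final = outcome t (best ∷ []) (just zero)
    won : win final ≐ 1#
    won = if-true (dec-true (just best ≟ just best) refl)
      where
      if-true : ∀ {c} → c ≡ true → (if c then 1# else 0#) ≐ 1#
      if-true refl = ≐-refl
  king-best (i ∷ cs) (i≢best ∷ cs≢best) t (suc c) S =
    ≼-trans (king-best cs cs≢best t c S) (winProb-skip i cs t (best ∷ []) c S)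
  king-best (i ∷ cs) (i≢best ∷ cs≢best) t zero S = winProb-challenge best i cs t S (begin
    1# ⊖ y ↑ S
      ≈⟨ ⊕-cong ≐-refl (⊝-cong (⊗-identityʳ (y ↑ S))) ⟨
    1# ⊖ y ↑ S ⊗ 1#
      ≲⟨ ⊖-monoʳ 1# (⊗-monoˡ (0≼↑ S 0≼y) budget-suffices) ⟩
    1# ⊖ y ↑ S ⊗ (x ↑ h ⊗ y ↑ b)
      ≈⟨ ⊕-cong ≐-refl (⊝-cong (≐-trans
           (ring 3 (λ s x b → s ∶* (x ∶* b) ∶= x ∶* (s ∶* b)) ≐-refl (y ↑ S) (x ↑ h) (y ↑ b))
           (⊗-cong ≐-refl (≐-sym (↑-+ y S b))))) ⟩
    1# ⊖ x ↑ h ⊗ y ↑ (S ℕ.+ b)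
      ≲⟨ challenge-≥ p 0≼p p≼1 best i (winProb cs) (λ w S → 1# ⊖ x ↑ w ⊗ y ↑ S)
           (λ t S → ≼-trans (≼-reflexive (⊕-cong ≐-refl (⊝-cong (⊗-identityˡ (y ↑ S)))))
             (king-best cs cs≢best t β S))
           (λ t w → begin
             1# ⊖ x ↑ suc w ⊗ 1# ≈⟨ ⊕-cong ≐-refl (⊝-cong (⊗-identityʳ (x ↑ suc w))) ⟩
             1# ⊖ x ↑ suc w      ≲⟨ ⊖-monoʳ 1# (1≼↑ (suc w) 1≼x) ⟩
             1# ⊖ 1#             ≈⟨ ring 0 (κ 1ℚ ∶- κ 1ℚ ∶= κ 0ℚ) ≐-refl ⟩
             0#                  ≲⟨ 0≼winProb cs (outcome t (i ∷ []) (just (β , S₀))) ⟩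
             winProb cs (outcome t (i ∷ []) (just (β , S₀))) ∎)
           (king-round (0≼p i) (p≼1 i) (0≼p best) (p≼1 best) (gap i i≢best))
           h (S ℕ.+ b) t ⟩
    E (run p i t (best ∷ []) (challenge h (S ℕ.+ b))) (winProb cs) ∎)

  -- After the given prefix of coins, an algorithm that is to skip c coins considers the next one.
  Hits : ℕ → List (Fin n) → Set
  Hits c       []       = c ≡ 0
  Hits (suc c) (_ ∷ xs) = Hits c xs
  Hits zero    (_ ∷ xs) = Hits β xs

  -- Built backwards from the best coin: prepending a coin raises the offset by one, and wraps it
  -- from β to 0, in which case the new coin is itself considered.
  some-hits : ∀ xs → Σ[ j ∈ ℕ ] (j ℕ.≤ β × Hits j xs)
  some-hits []       = 0 , ℕ.z≤n , refl
  some-hits (x ∷ xs) =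
    let j , j≤β , hits = some-hits xs
    in extend j hits (ℕ.m≤n⇒m<n∨m≡n j≤β)
    where
    extend : ∀ j → Hits j xs → (j ℕ.< β) ⊎ (j ≡ β) → Σ[ j ∈ ℕ ] (j ℕ.≤ β × Hits j (x ∷ xs))
    extend j hits (inj₁ j<β)  = suc j , j<β , hits
    extend j hits (inj₂ refl) = 0 , ℕ.z≤n , hits

  guarantee : ℝ
  guarantee = (1# ⊖ y ↑ S₀) ⊖ z ↑ h

  -- Before the best coin arrives it does not matter who is king or how much budget is left. The two
  -- error terms stand for being dethroned after winning and for losing the own challenge.
  awaiting-best : ∀ xs ys → All (_≢ best) xs → All (_≢ best) ys → ∀ c S t {k} (M : Vec (Fin n) k) →
    k ℕ.≤ 1 → (∀ j → lookup M j ≢ best) → Hits c xs →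
    guarantee ≼ winProb (xs ++ best ∷ ys) (outcome t M (just (c , S)))
  awaiting-best [] ys _ ys≢best .0 S t [] _ _ refl = begin
    guarantee  ≲⟨ ⊖-≼ (1# ⊖ y ↑ S₀) (0≼↑ h 0≼z) ⟩
    1# ⊖ y ↑ S₀ ≲⟨ king-best ys ys≢best t β S₀ ⟩
    winProb ys (outcome t (best ∷ []) (just (β , S₀))) ≲⟨ winProb-store best ys t S ⟩
    winProb (best ∷ ys) (outcome t [] (just (0 , S))) ∎
  awaiting-best [] ys _ ys≢best .0 S t (king ∷ []) _ M≢best refl =
    winProb-challenge king best ys t S
      (challenge-≥ p 0≼p p≼1 king best (winProb ys) (λ w _ → (1# ⊖ y ↑ S₀) ⊖ z ↑ w)
        -- At distance 0 the best coin has lost for good; the potential is -y^S₀ there, and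
        -- nonnegativity of the winning probability suffices.
        (λ t S → begin
          (1# ⊖ y ↑ S₀) ⊖ 1# ≈⟨ ring 1 (λ s → (κ 1ℚ ∶- s) ∶- κ 1ℚ ∶= κ 0ℚ ∶- s) ≐-refl (y ↑ S₀) ⟩
          0# ⊖ y ↑ S₀        ≲⟨ ⊖-≼ 0# (0≼↑ S₀ 0≼y) ⟩
          0#                 ≲⟨ 0≼winProb ys (outcome t (king ∷ []) (just (β , S))) ⟩
          winProb ys (outcome t (king ∷ []) (just (β , S))) ∎)
        (λ t w → ≼-trans (⊖-≼ (1# ⊖ y ↑ S₀) (0≼↑ (suc w) 0≼z)) (king-best ys ys≢best t β S₀))
        (λ w S → challenger-round (0≼p king) (p≼1 king) (0≼p best) (p≼1 best)
          (gap king (M≢best zero)) (1# ⊖ y ↑ S₀) w)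
        h (S ℕ.+ b) t)
  awaiting-best [] ys _ _ c S t (_ ∷ _ ∷ _) (ℕ.s≤s ()) _ _
  awaiting-best (i ∷ xs) ys (_ ∷ xs≢best) ys≢best (suc c) S t M k≤1 M≢best hits =
    ≼-trans (awaiting-best xs ys xs≢best ys≢best c S t M k≤1 M≢best hits)
      (winProb-skip i (xs ++ best ∷ ys) t M c S)
  awaiting-best (i ∷ xs) ys (i≢best ∷ xs≢best) ys≢best zero S t [] _ _ hits =
    ≼-trans (awaiting-best xs ys xs≢best ys≢best β S₀ t (i ∷ []) (ℕ.s≤s ℕ.z≤n) (λ { zero → i≢best }) hits)
      (winProb-store i (xs ++ best ∷ ys) t S)
  awaiting-best (i ∷ xs) ys (i≢best ∷ xs≢best) ys≢best zero S t (king ∷ []) k≤1 M≢best hits =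
    winProb-challenge king i (xs ++ best ∷ ys) t S
      -- Neither contender is the best coin, so a constant potential will do: both outcomes carry
      -- the same guarantee.
      (challenge-≥ p 0≼p p≼1 king i (winProb (xs ++ best ∷ ys)) (λ _ _ → guarantee)
        (λ t S → awaiting-best xs ys xs≢best ys≢best β S t (king ∷ []) k≤1 M≢best hits)
        (λ t w → awaiting-best xs ys xs≢best ys≢best β S₀ t (i ∷ []) k≤1 (λ { zero → i≢best }) hits)
        (λ w S → ≼-reflexive (ring 3 (λ v p q → v ∶=
           p ∶* (q ∶* v ∶+ (κ 1ℚ ∶- q) ∶* v) ∶+ (κ 1ℚ ∶- p) ∶* (q ∶* v ∶+ (κ 1ℚ ∶- q) ∶* v))
           ≐-refl guarantee (p king) (p i)))
        h (S ℕ.+ b) t)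
  awaiting-best (i ∷ xs) ys _ _ zero S t (_ ∷ _ ∷ _) (ℕ.s≤s ()) _ _

  -- A single offset is retained out of β + 1; the others contribute nonnegatively.
  winProb-start : ∀ c cs j → winProb (c ∷ cs) (outcome 0 [] (just (toℕ {suc β} j , 0))) ⊗ τ (suc β) ≼
    winProb (c ∷ cs) (outcome 0 [] nothing)
  winProb-start c cs j = begin
    winProb (c ∷ cs) (outcome 0 [] (just (toℕ j , 0))) ⊗ τ (suc β)
      ≈⟨ ⊗-cong (winProb-∷ c cs (outcome 0 [] (just (toℕ j , 0)))) ≐-refl ⟩
    E (run p c 0 [] (visit (toℕ j) 0 0)) (winProb cs) ⊗ τ (suc β)
      ≈⟨ ⊗-comm _ _ ⟩
    τ (suc β) ⊗ E (run p c 0 [] (visit (toℕ j) 0 0)) (winProb cs)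
      ≲⟨ E-uniform-≥ β (λ j → run p c 0 [] (visit (toℕ j) 0 0)) (winProb cs)
           (λ j → 0≼E-run p 0≼p p≼1 c 0 [] (visit (toℕ j) 0 0) (winProb cs) (0≼winProb cs)) j ⟩
    E (run p c 0 [] (step nothing 0)) (winProb cs)
      ≈⟨ winProb-∷ c cs (outcome 0 [] nothing) ⟨
    winProb (c ∷ cs) (outcome 0 [] nothing) ∎

  success : guarantee ⊗ τ (suc β) ≼ Pr (execute p algorithm) (λ o → output o ≟ just best)
  success =
    let xs , ys , eq , xs≢best , ys≢best = split-at (allFin⁺ n) (∈-allFin best)
        j , j≤β , hits = some-hits xs
        i = fromℕ< (ℕ.s≤s j≤β)
    in begin
      guarantee ⊗ τ (suc β)
        ≲⟨ ⊗-monoʳ (0≼τ (suc β)) (awaiting-best xs ys xs≢best ys≢best (toℕ i) 0 0 [] ℕ.z≤n (λ ())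
             (subst (λ j → Hits j xs) (sym (Fin.toℕ-fromℕ< (ℕ.s≤s j≤β))) hits)) ⟩
      winProb (xs ++ best ∷ ys) (outcome 0 [] (just (toℕ i , 0))) ⊗ τ (suc β)
        ≲⟨ nonempty xs ys i ⟩
      winProb (xs ++ best ∷ ys) (outcome 0 [] nothing)
        ≈⟨ same (sym eq) ⟩
      winProb (allFin n) (outcome 0 [] nothing)
        ≈⟨ E->>= (arrivals p algorithm (allFin n) (outcome 0 [] nothing)) conclude win ⟨
      E (execute p algorithm) win
        ≈⟨ Pr≐E (execute p algorithm) (λ o → output o ≟ just best) ⟨
      Pr (execute p algorithm) (λ o → output o ≟ just best) ∎
    where
    nonempty : ∀ xs ys i → winProb (xs ++ best ∷ ys) (outcome 0 [] (just (toℕ {suc β} i , 0))) ⊗ τ (suc β) ≼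
      winProb (xs ++ best ∷ ys) (outcome 0 [] nothing)
    nonempty []       ys i = winProb-start best ys i
    nonempty (x ∷ xs) ys i = winProb-start x (xs ++ best ∷ ys) i
    same : ∀ {cs cs′} → cs ≡ cs′ → winProb cs (outcome 0 [] nothing) ≐ winProb cs′ (outcome 0 [] nothing)
    same refl = ≐-refl

-- The number of tosses

Always : ∀ {A : Set} → (A → Set) → Dist A → Set
Always Q = All (Q ∘ proj₂)

Always->>= : ∀ {A B : Set} {Q : A → Set} {R : B → Set} (d : Dist A) (g : A → Dist B) →
  Always Q d → (∀ a → Q a → Always R (g a)) → Always R (d >>= g)
Always->>= []            g []       h = []
Always->>= ((w , a) ∷ d) g (q ∷ qs) h = All.++⁺ (All.map⁺ (h a q)) (Always->>= d g qs h)

Always-bernoulli : ∀ {A : Set} {R : A → Set} p (g : Bool → Dist A) →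
  (∀ x → Always R (g x)) → Always R (bernoulli p >>= g)
Always-bernoulli p g h = Always->>= {Q = λ _ → ⊤} (bernoulli p) g (tt ∷ tt ∷ []) (λ x _ → h x)

Always-uniform : ∀ {A : Set} {R : A → Set} j (g : Fin (suc j) → Dist A) →
  (∀ i → Always R (g i)) → Always R (uniform j >>= g)
Always-uniform j g h =
  Always->>= {Q = λ _ → ⊤} (uniform j) g (All.map⁺ (All.universal (λ _ → tt) (allFin (suc j)))) (λ i _ → h i)

module Tosses (h S₀ b β : ℕ) {n : ℕ} (p : Fin n → ℝ) where

  open Algorithm h S₀ b β
  open StreamingAlgorithm algorithm using (start; step; finish)

  -- `gain` bounds the growth of tosses plus twice the budget in one challenge: 2b from the grant
  -- and at most 2S₀ from a change of king. `rate` adds the first king's 2S₀, so that the total can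
  -- be charged to challenges alone.
  gain rate : ℕ
  gain = 2 ℕ.* S₀ ℕ.+ 2 ℕ.* b
  rate = gain ℕ.+ 2 ℕ.* S₀

  data Spent (X : ℕ) : Outcome n (λ _ → State) → Set where
    spent : ∀ {t i S} → t ℕ.+ 2 ℕ.* S ℕ.≤ 2 ℕ.* S₀ ℕ.+ X → Spent X (outcome t (i ∷ []) (just (β , S)))

  -- A round makes two tosses and uses one unit of budget, leaving t + 2S unchanged. Only a change
  -- of king can raise it, by at most 2S₀.
  challenge-Spent : ∀ king i X w S t → t ℕ.+ 2 ℕ.* S ℕ.≤ X →
    Always (Spent X) (run p i t (king ∷ []) (challenge w S))
  challenge-Spent king i X zero    S       t le = spent (ℕ.≤-trans le (ℕ.m≤n+m X (2 ℕ.* S₀))) ∷ []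
  challenge-Spent king i X (suc w) zero    t le =
    spent (ℕ.≤-trans (ℕ.≤-reflexive (ℕ.+-comm t (2 ℕ.* S₀)))
      (ℕ.+-monoʳ-≤ (2 ℕ.* S₀) (ℕ.≤-trans (ℕ.m≤m+n t _) le))) ∷ []
  challenge-Spent king i X (suc w) (suc S) t le =
    Always-bernoulli (p king) (λ x → bernoulli (p i) >>= outcomes x) λ x →
    Always-bernoulli (p i) (outcomes x) λ y →
    challenge-Spent king i X (advance x y w) S (suc (suc t)) (ℕ.≤-trans (ℕ.≤-reflexive two-tosses) le)
    where
    outcomes : Bool → Bool → Dist (Outcome n (λ _ → State))
    outcomes x y = run p i (suc (suc t)) (king ∷ []) (challenge (advance x y w) S)
    two-tosses : suc (suc t) ℕ.+ 2 ℕ.* S ≡ t ℕ.+ 2 ℕ.* suc S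
    two-tosses = semiring 2 (λ t S → ♯ 2 ∔ t ∔ ♯ 2 ⨰ S ≗ t ∔ ♯ 2 ⨰ (♯ 1 ∔ S)) refl t S

  -- After m arrivals; q is the number of challenges made to stored coins.
  data Accounted (m : ℕ) : Outcome n (λ _ → State) → Set where
    fresh   : Accounted m (outcome 0 [] nothing)
    waiting : ∀ {c S} → c ℕ.≤ β → Accounted m (outcome 0 [] (just (c , S)))
    -- So far q + 1 coins were considered, `suc β` apart, and c skips of the current block are still
    -- due. The bound t ≤ q · `rate` is kept besides the budget bound because for q = 0 it says that
    -- storing the first coin costs no toss, which matters for streams much shorter than `suc β`.
    reigned : ∀ {t i c S} q → c ℕ.≤ β → suc β ℕ.* q ℕ.+ suc β ℕ.≤ m ℕ.+ c →
      t ℕ.+ 2 ℕ.* S ℕ.≤ 2 ℕ.* S₀ ℕ.+ q ℕ.* gain → t ℕ.≤ q ℕ.* rate →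
      Accounted m (outcome t (i ∷ []) (just (c , S)))

  visit-Accounted-empty : ∀ i m c S → c ℕ.≤ β → Always (Accounted (suc m)) (run p i 0 [] (visit c S 0))
  visit-Accounted-empty i m (suc c) S c<β = waiting (ℕ.<⇒≤ c<β) ∷ []
  visit-Accounted-empty i m zero    S _   = reigned 0 ℕ.≤-refl
    (ℕ.≤-trans (ℕ.≤-reflexive (cong (ℕ._+ suc β) (ℕ.*-zeroʳ (suc β)))) (ℕ.s≤s (ℕ.m≤n+m β m)))
    (ℕ.m≤m+n (2 ℕ.* S₀) 0) ℕ.z≤n ∷ []

  step-Accounted : ∀ i m o → Accounted m o →
    Always (Accounted (suc m)) (run p i (tosses o) (memory o) (step (result o) (stored o)))
  step-Accounted i m _ fresh =
    Always-uniform β (λ j → run p i 0 [] (visit (toℕ j) 0 0))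
      λ j → visit-Accounted-empty i m (toℕ j) 0 (Fin.toℕ≤pred[n] j)
  step-Accounted i m _ (waiting {c} {S} c≤β) = visit-Accounted-empty i m c S c≤β
  step-Accounted i m _ (reigned {c = suc c} q c<β arrived budget tossed) =
    reigned q (ℕ.<⇒≤ c<β) (ℕ.≤-trans arrived (ℕ.≤-reflexive (ℕ.+-suc m c))) budget tossed ∷ []
  step-Accounted i m _ (reigned {t} {king} {zero} {S} q _ arrived budget tossed) =
    All.map (λ {wo} → account {proj₂ wo}) (challenge-Spent king i (t ℕ.+ 2 ℕ.* (S ℕ.+ b)) h (S ℕ.+ b) t ℕ.≤-refl)
    where
    arrived′ : suc β ℕ.* suc q ℕ.+ suc β ℕ.≤ suc m ℕ.+ β
    arrived′ = ℕ-Reasoning.begin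
      suc β ℕ.* suc q ℕ.+ suc β           ℕ-Reasoning.≡⟨ cong (ℕ._+ suc β)
                                            (trans (ℕ.*-suc (suc β) q) (ℕ.+-comm (suc β) _)) ⟩
      (suc β ℕ.* q ℕ.+ suc β) ℕ.+ suc β   ℕ-Reasoning.≤⟨ ℕ.+-monoˡ-≤ (suc β) arrived ⟩
      (m ℕ.+ 0) ℕ.+ suc β                 ℕ-Reasoning.≡⟨ cong (ℕ._+ suc β) (ℕ.+-identityʳ m) ⟩
      m ℕ.+ suc β                         ℕ-Reasoning.≡⟨ ℕ.+-suc m β ⟩
      suc m ℕ.+ β ℕ-Reasoning.∎
    budget′ : ∀ {s} → s ℕ.≤ 2 ℕ.* S₀ ℕ.+ (t ℕ.+ 2 ℕ.* (S ℕ.+ b)) → s ℕ.≤ 2 ℕ.* S₀ ℕ.+ suc q ℕ.* gain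
    budget′ {s} le = ℕ-Reasoning.begin
      s                                             ℕ-Reasoning.≤⟨ le ⟩
      2 ℕ.* S₀ ℕ.+ (t ℕ.+ 2 ℕ.* (S ℕ.+ b))          ℕ-Reasoning.≡⟨ semiring 4 (λ s₀ t s b →
                                                         ♯ 2 ⨰ s₀ ∔ (t ∔ ♯ 2 ⨰ (s ∔ b)) ≗
                                                         (t ∔ ♯ 2 ⨰ s) ∔ (♯ 2 ⨰ s₀ ∔ ♯ 2 ⨰ b)) refl S₀ t S b ⟩
      (t ℕ.+ 2 ℕ.* S) ℕ.+ gain                      ℕ-Reasoning.≤⟨ ℕ.+-monoˡ-≤ gain budget ⟩
      (2 ℕ.* S₀ ℕ.+ q ℕ.* gain) ℕ.+ gain            ℕ-Reasoning.≡⟨ semiring 3 (λ a q g → (♯ 2 ⨰ a ∔ q ⨰ g) ∔ g ≗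
                                                         ♯ 2 ⨰ a ∔ (♯ 1 ∔ q) ⨰ g) refl S₀ q gain ⟩
      2 ℕ.* S₀ ℕ.+ suc q ℕ.* gain ℕ-Reasoning.∎
    tossed′ : ∀ {s} → s ℕ.≤ 2 ℕ.* S₀ ℕ.+ suc q ℕ.* gain → s ℕ.≤ suc q ℕ.* rate
    tossed′ {s} le = ℕ-Reasoning.begin
      s                                             ℕ-Reasoning.≤⟨ le ⟩
      2 ℕ.* S₀ ℕ.+ suc q ℕ.* gain                   ℕ-Reasoning.≤⟨ ℕ.m≤m+n _ (q ℕ.* (2 ℕ.* S₀)) ⟩
      2 ℕ.* S₀ ℕ.+ suc q ℕ.* gain ℕ.+ q ℕ.* (2 ℕ.* S₀) ℕ-Reasoning.≡⟨ semiring 3 (λ a q g →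
                                                         (a ∔ (♯ 1 ∔ q) ⨰ g) ∔ q ⨰ a ≗
                                                         (♯ 1 ∔ q) ⨰ (g ∔ a)) refl (2 ℕ.* S₀) q gain ⟩
      suc q ℕ.* rate ℕ-Reasoning.∎
    account : ∀ {o} → Spent (t ℕ.+ 2 ℕ.* (S ℕ.+ b)) o → Accounted (suc m) o
    account (spent le) = reigned (suc q) ℕ.≤-refl arrived′ (budget′ le)
      (tossed′ (ℕ.≤-trans (ℕ.m≤m+n _ _) (budget′ le)))

  arrivals-Accounted : ∀ cs m o → Accounted m o →
    Always (Accounted (length cs ℕ.+ m)) (arrivals p algorithm cs o)
  arrivals-Accounted []       m o a = a ∷ []
  arrivals-Accounted (c ∷ cs) m o a =
    Always->>= (run p c (tosses o) (memory o) (step (result o) (stored o))) (arrivals p algorithm cs)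
      (step-Accounted c m o a) (λ o′ a′ → subst (λ k → Always (Accounted k) (arrivals p algorithm cs o′))
        (ℕ.+-suc (length cs) m) (arrivals-Accounted cs (suc m) o′ a′))

  Accounted⇒tosses : ∀ {m o} → Accounted m o → tosses o ℕ.* suc β ℕ.≤ m ℕ.* rate
  Accounted⇒tosses fresh       = ℕ.z≤n
  Accounted⇒tosses (waiting _) = ℕ.z≤n
  Accounted⇒tosses {m} (reigned {t} {c = c} q c≤β arrived _ tossed) = ℕ-Reasoning.begin
    t ℕ.* suc β            ℕ-Reasoning.≤⟨ ℕ.*-monoˡ-≤ (suc β) tossed ⟩
    q ℕ.* rate ℕ.* suc β   ℕ-Reasoning.≡⟨ trans (ℕ.*-comm (q ℕ.* rate) (suc β)) (sym (ℕ.*-assoc (suc β) q rate)) ⟩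
    suc β ℕ.* q ℕ.* rate   ℕ-Reasoning.≤⟨ ℕ.*-monoˡ-≤ rate (ℕ.+-cancelʳ-≤ (suc β) _ m (ℕ.≤-trans arrived
                                (ℕ.+-monoʳ-≤ m (ℕ.≤-trans c≤β (ℕ.n≤1+n β))))) ⟩
    m ℕ.* rate ℕ-Reasoning.∎

  conclude-tosses : ∀ {m o} → Accounted m o →
    Always (λ o′ → tosses o′ ℕ.* suc β ℕ.≤ m ℕ.* rate)
      (run p tt (tosses o) (memory o) (finish (result o) (stored o)))
  conclude-tosses fresh       = ℕ.z≤n ∷ []
  conclude-tosses (waiting _) = ℕ.z≤n ∷ []
  conclude-tosses a@(reigned _ _ _ _ _) = Accounted⇒tosses a ∷ []

  tosses-bounded : Always (λ o → tosses o ℕ.* suc β ℕ.≤ n ℕ.* rate) (execute p algorithm)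
  tosses-bounded = Always->>= (arrivals p algorithm (allFin n) (outcome 0 [] nothing))
    (λ o → run p tt (tosses o) (memory o) (finish (result o) (stored o)))
    (subst (λ k → Always (Accounted k) (arrivals p algorithm (allFin n) (outcome 0 [] nothing)))
      (trans (ℕ.+-identityʳ _) (List.length-tabulate {n = n} id))
      (arrivals-Accounted (allFin n) 0 (outcome 0 [] nothing) fresh))
    (λ o → conclude-tosses)

-- The parameters for t = 1/u: each additional factor ½ in the error costs u + 1 units of distance
-- and 2u² units of budget, and b = 2uh is the budget that pays for a distance h.
module Parameters (u : ℕ) .{{_ : ℕ.NonZero u}} (L : ℕ) where

  open Walk u

  h S₀ b : ℕ
  h  = L ℕ.* suc u
  S₀ = L ℕ.* (2 ℕ.* (u ℕ.* u))
  b  = h ℕ.* (2 ℕ.* u)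

  z↑h≼ : z ↑ h ≼ half ↑ L
  z↑h≼ = begin
    z ↑ h           ≈⟨ ↑-* z L (suc u) ⟩
    (z ↑ suc u) ↑ L ≲⟨ ↑-mono L (0≼↑ (suc u) 0≼z)
                         ([1-a]^k≼½ (suc u) (0≼τ (suc u)) (τ≼1 (suc u)) (≼-reflexive (≐-sym (ν⊗τ (suc u))))) ⟩
    half ↑ L        ∎

  2u : ν (2 ℕ.* u) ≐ ν u ⊕ ν u
  2u = ≐-trans (ν-⊗ 2 u) (ring 1 (λ u → κ (+ 2 ℚ./ 1) ∶* u ∶= u ∶+ u) ≐-refl (ν u))

  y↑S₀≼ : y ↑ S₀ ≼ half ↑ L
  y↑S₀≼ = begin
    y ↑ S₀                        ≈⟨ ↑-* y L (2 ℕ.* (u ℕ.* u)) ⟩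
    (y ↑ (2 ℕ.* (u ℕ.* u))) ↑ L   ≲⟨ ↑-mono L (0≼↑ (2 ℕ.* (u ℕ.* u)) 0≼y)
                                       ([1-a]^k≼½ (2 ℕ.* (u ℕ.* u)) 0≼½t² ½t²≼1 (≼-reflexive (≐-sym 2u²½t²≐1))) ⟩
    half ↑ L                      ∎
    where
    2u²½t²≐1 : ν (2 ℕ.* (u ℕ.* u)) ⊗ (half ⊗ (t ⊗ t)) ≐ 1#
    2u²½t²≐1 = ≐-trans (⊗-cong (≐-trans (ν-⊗ 2 (u ℕ.* u)) (⊗-cong ≐-refl (ν-⊗ u u))) ≐-refl)
      (≐-trans (ring 2 (λ u t →
         (κ (+ 2 ℚ./ 1) ∶* (u ∶* u)) ∶* (κ ½ ∶* (t ∶* t)) ∶= (u ∶* t) ∶* (u ∶* t)) ≐-refl (ν u) t)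
      (≐-trans (⊗-cong (ν⊗τ u) (ν⊗τ u)) (⊗-identityˡ 1#)))

  budget-suffices : x ↑ h ⊗ y ↑ b ≼ 1#
  budget-suffices = begin
    x ↑ h ⊗ y ↑ b                 ≈⟨ ⊗-cong ≐-refl (↑-* y h (2 ℕ.* u)) ⟩
    x ↑ h ⊗ (y ↑ (2 ℕ.* u)) ↑ h   ≈⟨ ⊗-↑ x (y ↑ (2 ℕ.* u)) h ⟨
    (x ⊗ y ↑ (2 ℕ.* u)) ↑ h       ≲⟨ ↑≼1 h (0≼-⊗ 0≼x (0≼↑ (2 ℕ.* u) 0≼y)) xy^2u≼1 ⟩
    1#                            ∎
    where
    2u½t²≐t : ν (2 ℕ.* u) ⊗ (half ⊗ (t ⊗ t)) ≐ t
    2u½t²≐t = ≐-trans (⊗-cong 2u ≐-refl)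
      (≐-trans (ring 2 (λ u t → (u ∶+ u) ∶* (κ ½ ∶* (t ∶* t)) ∶= (u ∶* t) ∶* t) ≐-refl (ν u) t)
      (≐-trans (⊗-cong (ν⊗τ u) ≐-refl) (⊗-identityˡ t)))
    xy^2u≼1 : x ⊗ y ↑ (2 ℕ.* u) ≼ 1#
    xy^2u≼1 = begin
      x ⊗ y ↑ (2 ℕ.* u)  ≈⟨ ⊗-comm x _ ⟩
      y ↑ (2 ℕ.* u) ⊗ x  ≈⟨ ⊗-cong ≐-refl (⊕-cong ≐-refl 2u½t²≐t) ⟨
      y ↑ (2 ℕ.* u) ⊗ (1# ⊕ ν (2 ℕ.* u) ⊗ (half ⊗ (t ⊗ t)))
                         -- With a = t²/2 and k = 2u the product ka is t, so 1 + ka is exactly x.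
                         ≲⟨ [1-a]^k[1+ka]≼1 (2 ℕ.* u) 0≼½t² ½t²≼1 ⟩
      1#                 ∎

  rate≤ : 1 ℕ.≤ u → ∀ {n} (p : Fin n → ℝ) β → Tosses.rate h S₀ b β p ℕ.≤ 16 ℕ.* (L ℕ.* (u ℕ.* u))
  rate≤ 1≤u p β = ℕ-Reasoning.begin
    (2 ℕ.* S₀ ℕ.+ 2 ℕ.* b) ℕ.+ 2 ℕ.* S₀
      ℕ-Reasoning.≡⟨ semiring 2 (λ L u → (♯ 2 ⨰ (L ⨰ (♯ 2 ⨰ (u ⨰ u))) ∔ ♯ 2 ⨰ ((L ⨰ (♯ 1 ∔ u)) ⨰ (♯ 2 ⨰ u)))
           ∔ ♯ 2 ⨰ (L ⨰ (♯ 2 ⨰ (u ⨰ u))) ≗ ♯ 12 ⨰ (L ⨰ (u ⨰ u)) ∔ ♯ 4 ⨰ (L ⨰ (u ⨰ ♯ 1))) refl L u ⟩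
    12 ℕ.* (L ℕ.* (u ℕ.* u)) ℕ.+ 4 ℕ.* (L ℕ.* (u ℕ.* 1))
      ℕ-Reasoning.≤⟨ ℕ.+-monoʳ-≤ (12 ℕ.* (L ℕ.* (u ℕ.* u))) (ℕ.*-monoʳ-≤ 4 (ℕ.*-monoʳ-≤ L (ℕ.*-monoʳ-≤ u 1≤u))) ⟩
    12 ℕ.* (L ℕ.* (u ℕ.* u)) ℕ.+ 4 ℕ.* (L ℕ.* (u ℕ.* u))
      ℕ-Reasoning.≡⟨ semiring 1 (λ a → ♯ 12 ⨰ a ∔ ♯ 4 ⨰ a ≗ ♯ 16 ⨰ a) refl (L ℕ.* (u ℕ.* u)) ⟩
    16 ℕ.* (L ℕ.* (u ℕ.* u)) ℕ-Reasoning.∎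

-- From the gap to the step size, and the final bounds

module _ {n : ℕ} {p : Fin n → ℝ} (p∈[0,1] : ∀ i → (0ℝ ≤ p i) × (p i ≤ 1ℝ))
         {best : Fin n} {Δ : ℝ} (hasGap : HasGap p best Δ) where

  open HasGap hasGap

  0≼bias : ∀ i → 0# ≼ p i
  0≼bias i = ≼-trans (≼-reflexive (≐-sym (ι≐ 0ℚ))) ⟨ proj₁ (p∈[0,1] i) ⟩

  bias≼1 : ∀ i → p i ≼ 1#
  bias≼1 i = ≼-trans ⟨ proj₂ (p∈[0,1] i) ⟩ (≼-reflexive (ι≐ 1ℚ))

  Δ≼best-other : ∀ i → i ≢ best → Δ ≼ p best ⊖ p i
  Δ≼best-other i i≢best = begin
    Δ                    ≲⟨ ≃⇒≽ {p best - p second} {Δ} gap ⟩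
    p best - p second    ≈⟨ ⊖-as-⊖ ⟩
    p best ⊖ p second    ≲⟨ ⊖-monoʳ (p best) ⟨ second-largest i i≢best ⟩ ⟩
    p best ⊖ p i         ∎
    where
    ⊖-as-⊖ : p best - p second ≐ p best ⊖ p second
    ⊖-as-⊖ = +-as-⊕ (p best) (- p second) ≐-refl (⊝≐ (p second))

  -- Turns the rounding bound NΔ ≤ 2 + Δ into the absolute constant NΔ ≤ 3.
  Δ≼1 : Δ ≼ 1#
  Δ≼1 = begin
    Δ                  ≲⟨ Δ≼best-other second second≢best ⟩
    p best ⊖ p second  ≲⟨ ⊖-≼ (p best) (0≼bias second) ⟩
    p best             ≲⟨ bias≼1 best ⟩
    1#                 ∎

  module _ (k : ℕ) (1≼NΔ : 1# ≼ ν (suc k) ⊗ Δ) (NΔ≼2+Δ : ν (suc k) ⊗ Δ ≼ ν 2 ⊕ Δ) where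

    private
      N = suc k
      u = N ℕ.+ N

    -- This is the reason for u = 2N: the gap 2t demanded by `contraction` becomes 1/N, which is at
    -- most Δ.
    1/N≼gap : ∀ i → i ≢ best → τ u ⊕ τ u ≼ p best ⊖ p i
    1/N≼gap i i≢best = ≼-trans (ν-cancelˡ N (begin
      ν N ⊗ (τ u ⊕ τ u) ≈⟨ ring 2 (λ n t → n ∶* (t ∶+ t) ∶= (n ∶+ n) ∶* t) ≐-refl (ν N) (τ u) ⟩
      (ν N ⊕ ν N) ⊗ τ u ≈⟨ ≐-trans (⊗-cong (≐-sym (ν-⊕ N N)) ≐-refl) (ν⊗τ u) ⟩
      1#                ≲⟨ 1≼NΔ ⟩
      ν N ⊗ Δ           ∎)) (Δ≼best-other i i≢best)

    0≼NΔ : 0# ≼ ν N ⊗ Δ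
    0≼NΔ = ≼-trans 0≼1 1≼NΔ

    NΔ≼3 : ν N ⊗ Δ ≼ ν 3
    NΔ≼3 = begin
      ν N ⊗ Δ   ≲⟨ NΔ≼2+Δ ⟩
      ν 2 ⊕ Δ   ≲⟨ ⊕-mono ≼-refl Δ≼1 ⟩
      ν 2 ⊕ ν 1 ≈⟨ ν-⊕ 2 1 ⟨
      ν 3       ∎

    -- 14976 = 16 · 2² · 3² · 26, from 16 L u² with u = 2N, NΔ ≤ 3 and L ≤ 26 B ℓ.
    toss-cost : ∀ {ℓ} L β T → ν L ≼ ν 26 ⊗ (ν (suc β) ⊗ ℓ) →
      T ℕ.* suc β ℕ.≤ n ℕ.* (16 ℕ.* (L ℕ.* (u ℕ.* u))) →
      ν T ⊗ (Δ ⊗ Δ) ≼ ν 14976 ⊗ (ν n ⊗ ℓ)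
    toss-cost {ℓ} L β T L≼ TB≤ = ν-cancelˡ (suc β) (begin
      B ⊗ (ν T ⊗ (Δ ⊗ Δ))
        ≈⟨ ≐-trans (ring 3 (λ b t d → b ∶* (t ∶* (d ∶* d)) ∶= (t ∶* b) ∶* (d ∶* d)) ≐-refl B (ν T) Δ)
             (⊗-cong (≐-sym (ν-⊗ T (suc β))) ≐-refl) ⟩
      ν (T ℕ.* suc β) ⊗ (Δ ⊗ Δ)
        ≲⟨ ⊗-monoʳ (0≼square Δ) (ν-mono TB≤) ⟩
      ν (n ℕ.* (16 ℕ.* (L ℕ.* (u ℕ.* u)))) ⊗ (Δ ⊗ Δ)
        ≈⟨ ⊗-cong (≐-trans (ν-⊗ n (16 ℕ.* (L ℕ.* (u ℕ.* u)))) (⊗-cong ≐-refl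
             (≐-trans (ν-⊗ 16 (L ℕ.* (u ℕ.* u))) (⊗-cong ≐-refl
             (≐-trans (ν-⊗ L (u ℕ.* u)) (⊗-cong ≐-refl (≐-trans (ν-⊗ u u) (⊗-cong (ν-⊕ N N) (ν-⊕ N N))))))))) ≐-refl ⟩
      (ν n ⊗ (ν 16 ⊗ (ν L ⊗ ((ν N ⊕ ν N) ⊗ (ν N ⊕ ν N))))) ⊗ (Δ ⊗ Δ)
        ≈⟨ ring 4 (λ n l m d → (n ∶* (κ (+ 16 ℚ./ 1) ∶* (l ∶* ((m ∶+ m) ∶* (m ∶+ m))))) ∶* (d ∶* d) ∶=
             (κ (+ 64 ℚ./ 1) ∶* (n ∶* l)) ∶* ((m ∶* d) ∶* (m ∶* d))) ≐-refl (ν n) (ν L) (ν N) Δ ⟩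
      (ν 64 ⊗ (ν n ⊗ ν L)) ⊗ ((ν N ⊗ Δ) ⊗ (ν N ⊗ Δ))
        ≲⟨ ⊗-monoˡ (0≼-⊗ (0≼ν 64) (0≼-⊗ (0≼ν n) (0≼ν L))) (⊗-mono 0≼NΔ (0≼ν 3) NΔ≼3 NΔ≼3) ⟩
      (ν 64 ⊗ (ν n ⊗ ν L)) ⊗ (ν 3 ⊗ ν 3)
        ≈⟨ ring 2 (λ n l → (κ (+ 64 ℚ./ 1) ∶* (n ∶* l)) ∶* (κ (+ 3 ℚ./ 1) ∶* κ (+ 3 ℚ./ 1)) ∶=
             (κ (+ 576 ℚ./ 1) ∶* n) ∶* l) ≐-refl (ν n) (ν L) ⟩
      (ν 576 ⊗ ν n) ⊗ ν L
        ≲⟨ ⊗-monoˡ (0≼-⊗ (0≼ν 576) (0≼ν n)) L≼ ⟩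
      (ν 576 ⊗ ν n) ⊗ (ν 26 ⊗ (B ⊗ ℓ))
        ≈⟨ ring 3 (λ n b ℓ → (κ (+ 576 ℚ./ 1) ∶* n) ∶* (κ (+ 26 ℚ./ 1) ∶* (b ∶* ℓ)) ∶=
             b ∶* (κ (+ 14976 ℚ./ 1) ∶* (n ∶* ℓ))) ≐-refl (ν n) B ℓ ⟩
      B ⊗ (ν 14976 ⊗ (ν n ⊗ ℓ)) ∎)
      where B = ν (suc β)

theorem1 : Σ[ C ∈ ℕ ]
    ((Δ δ δ⁻¹ ℓ : ℝ) → 0ℝ < Δ → 0ℝ < δ → δ < 1ℝ →
    δ * δ⁻¹ ≃ 1ℝ → ℓ IsLogOf δ⁻¹ →
    Σ[ A ∈ StreamingAlgorithm 1 ]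
    ((n : ℕ) (p : Fin n → ℝ) → (∀ i → (0ℝ ≤ p i) × (p i ≤ 1ℝ)) →
    (best : Fin n) → HasGap p best Δ →
    All (λ wo → fromℕ (tosses (proj₂ wo)) * (Δ * Δ) ≤ fromℕ C * (fromℕ n * ℓ))
    (execute p A)
    × (1ℝ - δ ≤ Pr (execute p A) (λ o → output o ≟ just best))))
theorem1 = 14976 , λ Δ δ δ⁻¹ ℓ 0<Δ 0<δ δ<1 δδ⁻¹≃1 ℓ-log →
  let ε , 0<ε , 0+ε≼Δ = <⇒ι≼ {0ℝ} {Δ} 0<Δ
      ε≼Δ = ≼-trans (≼-reflexive (≐-trans (≐-sym (⊕-identityˡ (ι ε))) (⊕-cong (≐-sym (ι≐ 0ℚ)) ≐-refl))) 0+ε≼Δ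
      k , 1≼NΔ , NΔ≼2+Δ = nat-reciprocal {Δ} (ε , 0<ε , ε≼Δ)
      L , β , L≼ , error = adequate {δ} {δ⁻¹} {ℓ} 0<δ δ<1 δδ⁻¹≃1 ℓ-log
      u = suc k ℕ.+ suc k
      open Parameters u L
      open Walk u
  in Algorithm.algorithm h S₀ b β , λ n p p∈[0,1] best hasGap →
    let open Success u h S₀ b β budget-suffices p (0≼bias p∈[0,1] hasGap) (bias≼1 p∈[0,1] hasGap) best
          (1/N≼gap p∈[0,1] hasGap k 1≼NΔ NΔ≼2+Δ)
    in All.map (λ {wo} TB≤ → bound (cost-as Δ ℓ n (tosses (proj₂ wo))
         (toss-cost p∈[0,1] hasGap k 1≼NΔ NΔ≼2+Δ L β (tosses (proj₂ wo)) L≼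
           (ℕ.≤-trans TB≤ (ℕ.*-monoʳ-≤ n (rate≤ (ℕ.s≤s ℕ.z≤n) p β))))))
         (Tosses.tosses-bounded h S₀ b β p)
     , bound (≼-trans (confidence δ L β (y ↑ S₀) (z ↑ h) error y↑S₀≼ z↑h≼) success)
  where
  cost-as : ∀ Δ ℓ n T → ν T ⊗ (Δ ⊗ Δ) ≼ ν 14976 ⊗ (ν n ⊗ ℓ) →
    fromℕ T * (Δ * Δ) ≼ fromℕ 14976 * (fromℕ n * ℓ)
  cost-as Δ ℓ n T h = ≼-trans (≼-reflexive (*-as-⊗ (fromℕ T) (Δ * Δ) (ι≐ _) (⊗≐ Δ Δ)))
    (≼-trans h (≼-reflexive (≐-sym
      (*-as-⊗ (fromℕ 14976) (fromℕ n * ℓ) (ι≐ _) (*-as-⊗ (fromℕ n) ℓ (ι≐ _) ≐-refl)))))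
  confidence : ∀ δ L β Y Z → (1# ⊖ δ) ⊗ ν (suc β) ⊕ (half ↑ L ⊕ half ↑ L) ≼ 1# →
    Y ≼ half ↑ L → Z ≼ half ↑ L → 1ℝ - δ ≼ ((1# ⊖ Y) ⊖ Z) ⊗ τ (suc β)
  confidence δ L β Y Z error Y≼ Z≼ = begin
    1ℝ - δ
      ≈⟨ +-as-⊕ 1ℝ (- δ) (ι≐ 1ℚ) (⊝≐ δ) ⟩
    1# ⊖ δ
      ≈⟨ ≐-trans (⊗-assoc (1# ⊖ δ) (ν (suc β)) (τ (suc β)))
           (≐-trans (⊗-cong ≐-refl (ν⊗τ (suc β))) (⊗-identityʳ (1# ⊖ δ))) ⟨
    ((1# ⊖ δ) ⊗ ν (suc β)) ⊗ τ (suc β)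
      -- By adequacy (1 - δ)B ≤ 1 - 2 · 2^(-L), and each of Y and Z is at most 2^(-L); the remainder
      -- collects these three slacks.
      ≲⟨ ⊗-monoʳ (0≼τ (suc β)) (≼-by
           ((1# ⊖ ((1# ⊖ δ) ⊗ ν (suc β) ⊕ (e ⊕ e))) ⊕ ((e ⊖ Y) ⊕ (e ⊖ Z)))
           (0≼-⊕ (0≼-⊖ error) (0≼-⊕ (0≼-⊖ Y≼) (0≼-⊖ Z≼)))
           (ring 4 (λ a e Y Z → a ∶+ ((κ 1ℚ ∶- (a ∶+ (e ∶+ e))) ∶+ ((e ∶- Y) ∶+ (e ∶- Z))) ∶=
             (κ 1ℚ ∶- Y) ∶- Z) ≐-refl ((1# ⊖ δ) ⊗ ν (suc β)) e Y Z)) ⟩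
    ((1# ⊖ Y) ⊖ Z) ⊗ τ (suc β) ∎
    where e = half ↑ L
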